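{- Let $m\ge 2$, $q=3^m$, $\mathbb{F}=\mathbb{F}_q$, and $a\in\mathbb{F}^*$. Let $u_1\in\mathbb{F}$ be such that $u_1^3+u_1^2-a$ is a square in $\mathbb{F}$ (i.e. there is $y\in\mathbb{F}$ with $(u_1,y)\in E(a)$) and $$\mathrm{Tr}\!\left(\frac{a\sqrt{u_1^3+u_1^2-a}}{u_1^3}\right)\neq 0$$ (this condition does not depend on the choice of square root). Define $u_2,u_3,\dots$ recursively by $$u_{i+1}=\frac{(u_i^3-a)^3+a\,u_i^3}{(u_i^3-a)^2},\qquad i=1,2,\dots,$$ the recursion being continued as long as $u_i\neq a^{1/3}$. Then there exists an integer $k\le m$ such that one of the following holds: (i) $u_k=a^{1/3}$ and $u_i\neq a^{1/3}$ for all $i<k$; or (ii) $u_{k+1}=u_{k+1+r}$ for some integer $r\ge 1$, and the elements $u_i$, $1\le i<k+1+r$, are pairwise distinct. In either case $3^k$ divides $K(a)$ and $3^{k+1}$ does not divide $K(a)$ (with the convention below when $K(a)=0$).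
   Context: $\mathbb{F}=\mathbb{F}_{3^m}$ and $\mathrm{Tr}(x)=x+x^3+\dots+x^{3^{m-1}}$ is the absolute trace to $\mathbb{F}_3$. For $x\in\mathbb{F}$ and $i\ge1$, $x^{ -i}$ means $x^{q-1-i}$, and $b/x=b\,x^{ -1}$. $a^{1/3}$ denotes the unique cube root of $a$ in $\mathbb{F}$. With $\omega=e^{2\pi i/3}$, $K(a)=\sum_{x\in\mathbb{F}}\omega^{\mathrm{Tr}(x+a/x)}$. $E(a)=\{(x,y)\in\mathbb{F}\times\mathbb{F}: y^2=x^3+x^2-a\}$. Convention: if $K(a)=0$, one says that $3^m$ divides $K(a)$ but $3^{m+1}$ does not. -}

module Defs where

open import Algebra.Bundles using (CommutativeRing; RawSemiring; Semiring)
import Algebra.Definitions.RawSemiring as RawSemiringDefs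
import Algebra.Properties.CommutativeMonoid.Sum as CommutativeMonoidSum
import Algebra.Properties.Group as GroupProperties
import Algebra.Properties.Semiring.Exp as Exp
import Algebra.Properties.Semiring.Mult as Mult
import Algebra.Solver.Ring.NaturalCoefficients.Default as RingSolver
open import Data.Bool.Base using (if_then_else_)
open import Data.Fin.Base using (Fin; toℕ; punchOut)
import Data.Fin.Permutation as Perm
import Data.Fin.Properties as Fin
open import Data.Integer.Base as ℤ using (ℤ; +_; 0ℤ; 1ℤ; -1ℤ)
import Data.Integer.Divisibility as ℤ
open import Data.Nat.Base as ℕ using (ℕ; zero; suc; _∸_)
import Data.Nat.Properties as ℕ
open import Data.Product.Base using (∃; _×_; _,_; proj₁; proj₂)
open import Function.Base using (_∘_)
open import Function.Bundles using (Inverse)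
open import Function.Definitions using (Injective)
open import Function.Properties.Inverse using (Inverse⇒Injection)
open import Level using (_⊔_) renaming (suc to lsuc)
open import Relation.Binary.Definitions using (Decidable)
open import Relation.Binary.PropositionalEquality.Core as ≡ using (_≡_)
import Relation.Binary.PropositionalEquality.Properties as ≡
import Relation.Binary.Reasoning.Setoid as SetoidReasoning
open import Relation.Nullary using (yes; no; does; contradiction)
open import Relation.Nullary.Decidable using (via-injection)

record FiniteField c ℓ (q : ℕ) : Set (lsuc (c ⊔ ℓ)) where
  field
    commutativeRing : CommutativeRing c ℓ
  open CommutativeRing commutativeRing public
  field
    1≉0         : 1# ≉ 0#
    inverse     : ∀ x → x ≉ 0# → ∃ λ y → x * y ≈ 1#
    enumeration : Inverse setoid (≡.setoid (Fin q))

  open RawSemiringDefs (Semiring.rawSemiring semiring) public using (_^_; sum)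

  index : Carrier → Fin q
  index = Inverse.to enumeration

  element : Fin q → Carrier
  element = Inverse.from enumeration

  element-index : ∀ x → element (index x) ≈ x
  element-index = Inverse.strictlyInverseʳ enumeration

  index-element : ∀ i → index (element i) ≡ i
  index-element = Inverse.strictlyInverseˡ enumeration

  index-cong : ∀ {x y} → x ≈ y → index x ≡ index y
  index-cong = Inverse.to-cong enumeration

  _≟_ : Decidable _≈_
  _≟_ = via-injection (Inverse⇒Injection enumeration) Fin._≟_

  -- x ⁻^ i is x⁻ⁱ = x^(q-1-i); in particular 0⁻ⁱ = 0 for 1 ≤ i < q - 1.
  infixr 8 _⁻^_
  _⁻^_ : Carrier → ℕ → Carrier
  x ⁻^ i = x ^ (q ∸ 1 ∸ i)

  infixl 7 _/_
  _/_ : Carrier → Carrier → Carrier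
  b / x = b * x ⁻^ 1

-- ℤ[ω] with ω = e^(2πi/3): re + im·ω, where ω² = -1 - ω.
record ℤ[ω] : Set where
  constructor _+_ω
  field
    re im : ℤ

ℤ[ω]-rawSemiring : RawSemiring _ _
ℤ[ω]-rawSemiring = record
  { Carrier = ℤ[ω]
  ; _≈_     = _≡_
  ; _+_     = λ { (a + b ω) (c + d ω) → (a ℤ.+ c) + (b ℤ.+ d) ω }
  ; _*_     = λ { (a + b ω) (c + d ω) →
                  (a ℤ.* c ℤ.- b ℤ.* d) + (a ℤ.* d ℤ.+ b ℤ.* c ℤ.- b ℤ.* d) ω }
  ; 0#      = 0ℤ + 0ℤ ω
  ; 1#      = 1ℤ + 0ℤ ω
  }

module ℤω = RawSemiringDefs ℤ[ω]-rawSemiring using (_^_; sum)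

ω : ℤ[ω]
ω = 0ℤ + 1ℤ ω

fromℤ : ℤ → ℤ[ω]
fromℤ n = n + 0ℤ ω

-- "3ᵏ divides K" for a Kloosterman sum K over 𝔽_{3ᵐ}, with the convention
-- that 0 is divisible by 3ᵐ but not by 3ᵐ⁺¹.
3^_Divides⟨_⟩_ : ℕ → ℕ → ℤ → Set
3^ k Divides⟨ m ⟩ K = (+ (3 ℕ.^ k) ℤ.∣ K) × (K ≡ 0ℤ → k ℕ.≤ m)

module Ternary {c ℓ} (m : ℕ) (F : FiniteField c ℓ (3 ℕ.^ m)) where
  open FiniteField F

  private
    q = 3 ℕ.^ m
    open Exp semiring using (^-congˡ)
    open Mult semiring using (×1-homo-*) renaming (_×_ to _·_)
    open CommutativeMonoidSum +-commutativeMonoid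
      using (sum-permute; sum-cong-≋; ∑-distrib-+; sum-replicate)
    open GroupProperties +-group using (identityʳ-unique; x∙y⁻¹≈ε⇒x≈y)
    open RingSolver commutativeSemiring using (solve; _:=_; _:+_; _:*_; con)
    open SetoidReasoning setoid

    x^n≈0⇒x≈0 : ∀ x n → x ^ n ≈ 0# → x ≈ 0#
    x^n≈0⇒x≈0 x zero    1≈0 = contradiction 1≈0 1≉0
    x^n≈0⇒x≈0 x (suc n) x*xⁿ≈0 with x ≟ 0#
    ... | yes x≈0 = x≈0
    ... | no  x≉0 with y , xy≈1 ← inverse x x≉0 = x^n≈0⇒x≈0 x n (begin
      x ^ n              ≈⟨ *-identityˡ _ ⟨
      1# * x ^ n         ≈⟨ *-congʳ (trans (*-comm y x) xy≈1) ⟨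
      y * x * x ^ n      ≈⟨ *-assoc _ _ _ ⟩
      y * (x * x ^ n)    ≈⟨ *-congˡ x*xⁿ≈0 ⟩
      y * 0#             ≈⟨ zeroʳ y ⟩
      0#                 ∎)

    translation : Perm.Permutation q q
    translation = Perm.permutation
      (λ i → index (element i + 1#)) (λ i → index (element i - 1#))
      (λ i → ≡.trans (index-cong (cancel₁ i)) (index-element i))
      (λ i → ≡.trans (index-cong (cancel₂ i)) (index-element i))
      where
      cancel₁ : ∀ i → element (index (element i - 1#)) + 1# ≈ element i
      cancel₁ i = begin
        element (index (element i - 1#)) + 1# ≈⟨ +-congʳ (element-index _) ⟩
        element i - 1# + 1#                   ≈⟨ +-assoc _ _ _ ⟩
        element i + (- 1# + 1#)               ≈⟨ +-congˡ (-‿inverseˡ 1#) ⟩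
        element i + 0#                        ≈⟨ +-identityʳ _ ⟩
        element i                             ∎
      cancel₂ : ∀ i → element (index (element i + 1#)) - 1# ≈ element i
      cancel₂ i = begin
        element (index (element i + 1#)) - 1# ≈⟨ +-congʳ (element-index _) ⟩
        element i + 1# - 1#                   ≈⟨ +-assoc _ _ _ ⟩
        element i + (1# - 1#)                 ≈⟨ +-congˡ (-‿inverseʳ 1#) ⟩
        element i + 0#                        ≈⟨ +-identityʳ _ ⟩
        element i                             ∎

    q·1≈0 : q · 1# ≈ 0#
    q·1≈0 = identityʳ-unique (sum element) (q · 1#) (begin
      sum element + q · 1#                     ≈⟨ +-congˡ (sum-replicate q) ⟨
      sum element + sum {q} (λ _ → 1#)         ≈⟨ ∑-distrib-+ element (λ _ → 1#) ⟨
      sum (λ i → element i + 1#)               ≈⟨ sum-cong-≋ (λ i → element-index (element i + 1#)) ⟨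
      sum (λ i → element (translation Perm.⟨$⟩ʳ i)) ≈⟨ sum-permute element translation ⟨
      sum element                              ∎)

    3ⁿ·1≈[3·1]ⁿ : ∀ n → (3 ℕ.^ n) · 1# ≈ (3 · 1#) ^ n
    3ⁿ·1≈[3·1]ⁿ zero    = +-identityʳ 1#
    3ⁿ·1≈[3·1]ⁿ (suc n) =
      trans (×1-homo-* 3 (3 ℕ.^ n)) (*-congˡ (3ⁿ·1≈[3·1]ⁿ n))

  characteristic : 3 · 1# ≈ 0#
  characteristic = x^n≈0⇒x≈0 _ m (trans (sym (3ⁿ·1≈[3·1]ⁿ m)) q·1≈0)

  cube-injective : ∀ {x y} → x ^ 3 ≈ y ^ 3 → x ≈ y
  cube-injective {x} {y} x³≈y³ =
    x∙y⁻¹≈ε⇒x≈y x y (x^n≈0⇒x≈0 d 3 (identityʳ-unique (y ^ 3) (d ^ 3) (begin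
      y ^ 3 + d ^ 3                  ≈⟨ +-identityʳ _ ⟨
      y ^ 3 + d ^ 3 + 0#             ≈⟨ +-congˡ (trans (*-congʳ characteristic) (zeroˡ w)) ⟨
      y ^ 3 + d ^ 3 + 3 · 1# * w     ≈⟨ expand y d ⟨
      (y + d) ^ 3                    ≈⟨ ^-congˡ 3 y+d≈x ⟩
      x ^ 3                          ≈⟨ x³≈y³ ⟩
      y ^ 3                          ∎)))
    where
    d = x - y
    w = y * y * d + y * d * d
    y+d≈x : y + d ≈ x
    y+d≈x = begin
      y + (x - y)   ≈⟨ +-comm _ _ ⟩
      x - y + y     ≈⟨ +-assoc _ _ _ ⟩
      x + (- y + y) ≈⟨ +-congˡ (-‿inverseˡ y) ⟩
      x + 0#        ≈⟨ +-identityʳ x ⟩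
      x             ∎
    expand : ∀ y d → (y + d) ^ 3 ≈ y ^ 3 + d ^ 3 + 3 · 1# * (y * y * d + y * d * d)
    expand = solve 2 (λ y d →
        cube (y :+ d) := cube y :+ cube d :+ three :* (y :* y :* d :+ y :* d :* d)) refl
      where
      three = con 1 :+ (con 1 :+ (con 1 :+ con 0))
      cube  = λ x → x :* (x :* (x :* con 1))

  private
    injective⇒surjective : ∀ {n} (f : Fin n → Fin n) → Injective _≡_ _≡_ f →
                           ∀ j → ∃ λ i → f i ≡ j
    injective⇒surjective {suc n} f f-inj j with Fin.any? (λ i → f i Fin.≟ j)
    ... | yes hit  = hit
    ... | no  miss = contradiction
      (Fin.injective⇒≤ {f = λ i → punchOut (j≢f i)}
        (f-inj ∘ Fin.punchOut-injective (j≢f _) (j≢f _)))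
      ℕ.1+n≰n
      where
      j≢f : ∀ i → j ≡ f i → _
      j≢f i j≡fi = miss (i , ≡.sym j≡fi)

    element-injective : ∀ {i j} → element i ≈ element j → i ≡ j
    element-injective {i} {j} eq =
      ≡.trans (≡.sym (index-element i)) (≡.trans (index-cong eq) (index-element j))

    index-injective : ∀ {x y} → index x ≡ index y → x ≈ y
    index-injective {x} {y} eq =
      trans (sym (element-index x)) (trans (reflexive (≡.cong element eq)) (element-index y))

  cubeRoot : ∀ a → ∃ λ r → r ^ 3 ≈ a
  cubeRoot a with i , fi≡j ← injective⇒surjective (λ i → index (element i ^ 3))
      (element-injective ∘ cube-injective ∘ index-injective) (index a)
    = element i , index-injective fi≡j

  -- The cube root is unique by cube-injective.
  ∛_ : Carrier → Carrier
  ∛ a = proj₁ (cubeRoot a)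

  ∛-cubed : ∀ a → (∛ a) ^ 3 ≈ a
  ∛-cubed a = proj₂ (cubeRoot a)

  Tr : Carrier → Carrier
  Tr x = sum {m} (λ i → x ^ (3 ℕ.^ toℕ i))

  -- The representative in {0, 1, 2} of an element of the prime field {0, 1, -1}
  -- where Tr takes its values; it is never applied to anything else.
  residue : Carrier → ℕ
  residue t = if does (t ≟ 0#) then 0 else if does (t ≟ 1#) then 1 else 2

  Kloosterman : Carrier → ℤ[ω]
  Kloosterman a = ℤω.sum (λ i → let x = element i in ω ℤω.^ residue (Tr (x + a / x)))

  E : Carrier → Carrier × Carrier → Set ℓ
  E a (x , y) = y ^ 2 ≈ x ^ 3 + x ^ 2 - a

  step : Carrier → Carrier → Carrier
  step a u = ((u ^ 3 - a) ^ 3 + a * u ^ 3) / (u ^ 3 - a) ^ 2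

  -- u 1, u 2, … is generated by step for as long as u i ≉ ∛ a; u 0 and the terms
  -- after the first occurrence of ∛ a, where the recursion stops, are arbitrary.
  IsOrbit : Carrier → (ℕ → Carrier) → Set ℓ
  IsOrbit a u = ∀ i → 1 ℕ.≤ i → (∀ j → 1 ℕ.≤ j → j ℕ.≤ i → u j ≉ ∛ a) →
                u (suc i) ≈ step a (u i)

  TerminatesAt : Carrier → (ℕ → Carrier) → ℕ → Set ℓ
  TerminatesAt a u k =
    1 ℕ.≤ k × u k ≈ ∛ a × (∀ i → 1 ℕ.≤ i → i ℕ.< k → u i ≉ ∛ a)

  -- The last conjunct says that u 1, …, u (k + 1 + r) are all generated.
  CyclesFrom : Carrier → (ℕ → Carrier) → ℕ → Set ℓ
  CyclesFrom a u k = ∃ λ r →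
    1 ℕ.≤ r ×
    u (k ℕ.+ 1) ≈ u (k ℕ.+ 1 ℕ.+ r) ×
    (∀ i j → 1 ℕ.≤ i → i ℕ.< j → j ℕ.< k ℕ.+ 1 ℕ.+ r → u i ≉ u j) ×
    (∀ i → 1 ℕ.≤ i → i ℕ.< k ℕ.+ 1 ℕ.+ r → u i ≉ ∛ a)

{-# OPTIONS --safe #-}
-- The number of points of the curve E(a) is q + K(a): rewriting 3 #{x : Tr(x + a/x) = 0} by
-- additive Hilbert 90 and completing the square gives the curve w² = (z³ − z)² − a, which depends
-- on z only through t = z²; splitting ∑_t (1 + χ(t)) (1 + χ(g(t))) yields twice the count for E(a).
-- Tripling on E(a) is (x , y) ↦ (z² − 1 − a t , z³ − z) with t = 1/(x³ − a), z = y³ t; it has kernel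
-- {O , ±τ}, τ = (∛a , ∛a), its x-coordinate is the given step, and its image lies in Tr y = 0, while
-- Tr (a y/x³) = Tr y for x ≠ 0. So the starting point P is not in 3E. Let h be least with
-- τ ∉ 3ʰE. Counting fibres, #E = 3ʰ #(3ʰE), and McKay's argument gives 3 ∤ #(3ʰE). Since
-- the 3ʲ-torsion lies in 3ʰ⁻ʲE and P ∉ 3E, the multiples P, 3P, 9P, … enter 3ʰE, on which tripling
-- is injective, exactly at 3ʰP. Only commutativity and x ∙ (x ∙ y) = y of the chord-tangent
-- operation are needed, and that tripling preserves it, not associativity of the group law.

module Submission where

open import Defs
open import Algebra.Bundles using (CommutativeRing; RawRing; RawSemiring)
import Algebra.Properties.AbelianGroup as AbelianGroupProperties
import Algebra.Properties.CommutativeMonoid.Sum as CommutativeMonoidSum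
import Algebra.Properties.Group as GroupProperties
import Algebra.Properties.Ring as RingProperties
import Algebra.Properties.Semiring.Exp as Exp
import Algebra.Solver.Ring as RingSolver
open import Algebra.Solver.Ring.AlmostCommutativeRing using (fromCommutativeRing; _-Raw-AlmostCommutative⟶_)
open import Data.Bool.Base using (if_then_else_)
open import Data.Empty using (⊥-elim)
import Data.Empty.Polymorphic as Polymorphic
open import Data.Fin.Base as Fin using (Fin; zero; suc; toℕ; _↑ˡ_; _↑ʳ_; splitAt; combine; punchIn)
open import Data.Fin.Permutation using (Permutation; permutation; _⟨$⟩ʳ_)
import Data.Fin.Properties as Fin
open import Data.Integer.Base as ℤ using (ℤ; +_; 0ℤ; 1ℤ)
import Data.Integer.Properties as ℤ
import Data.Integer.Solver as ℤ
open import Data.Maybe.Base using (Maybe; just; nothing)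
open import Data.Nat.Base as ℕ using (ℕ; zero; suc; _∸_; _≤_; z≤n; s≤s) renaming (_^_ to _^ℕ_)
open import Data.Nat.Divisibility using (_∣_; _∤_; divides; _∣0; m∣m*n; ∣n⇒∣m*n; ∣1⇒≡1; ∣⇒≤; ∣m+n∣m⇒∣n; ∣m∣n⇒∣m+n; *-cancelˡ-∣)
import Data.Nat.Properties as ℕ
import Data.Nat.Solver as ℕ
open import Data.Product.Base using (Σ; ∃; _×_; _,_; proj₁; proj₂)
open import Data.Sum.Base using (_⊎_; inj₁; inj₂; [_,_]′)
open import Function.Base using (_∘_)
open import Function.Bundles using (Inverse)
open import Function.Properties.Inverse using (Inverse⇒Injection)
open import Level using (Level; _⊔_; 0ℓ) renaming (suc to lsuc)
open import Relation.Binary.Bundles using (Setoid)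
open import Relation.Binary.Definitions using (Decidable; tri<; tri≈; tri>)
open import Relation.Binary.PropositionalEquality as ≡ using (_≡_; _≢_)
import Relation.Binary.Reasoning.Setoid as SetoidReasoning
open import Relation.Nullary using (Dec; yes; no; does; ¬_; contradiction)
open import Relation.Nullary.Decidable using (via-injection; map′; _×-dec_; _⊎-dec_; ¬?; decidable-stable)
import Relation.Unary as U
open import Algebra.Properties.Semiring.Sum ℕ.+-*-semiring using (sum; sum-cong-≗; ∑-distrib-+; ∑-comm; sum-permute; *-distribˡ-sum)

-- In characteristic 3 tripling is the Frobenius map followed by a separable isogeny of degree 3.
-- This is why its formulas see a point only through s = x³ - a and v = y³, and why preservation of
-- chords is checked on the cubed curve v² = s³ + s² - a s + a². Collinearity is encoded by Vieta's
-- formulas, so multiplicities need no separate treatment and every verification becomes an identity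
-- over 𝔽₃ in a few symmetric quantities. The sequence u records only x-coordinates, hence points up
-- to sign. A repetition in u is therefore P = Q or P = -Q for iterates P, Q, and the analysis of
-- the cycle is carried out up to sign. The step from h to K rests on #E ≤ 2q: since 3ʰ divides #E,
-- this forces h ≤ m, so q is divisible by 3ʰ as well and K = #E - q inherits the power. For h = m
-- the same inequality gives |K| ≤ q, so that 3ᵐ⁺¹ could divide K only if K = 0, the case settled by
-- the convention. The trace condition acts twice: it keeps P out of 3E, and it shows that the trace
-- is nonzero, which the Hilbert 90 count requires.

module Counting where
  open ≡ using (refl; sym; trans; cong; cong₂)

  -- Indicator sums and counting over finite sets.

  ⟦_⟧ : ∀ {p} {P : Set p} → Dec P → ℕ
  ⟦ p? ⟧ = if does p? then 1 else 0

  ⟦⟧-yes : ∀ {p} {P : Set p} (p? : Dec P) → P → ⟦ p? ⟧ ≡ 1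
  ⟦⟧-yes (yes _) _ = refl
  ⟦⟧-yes (no ¬p) p = contradiction p ¬p

  ⟦⟧-no : ∀ {p} {P : Set p} (p? : Dec P) → ¬ P → ⟦ p? ⟧ ≡ 0
  ⟦⟧-no (yes p) ¬p = contradiction p ¬p
  ⟦⟧-no (no _)  _  = refl

  ⟦⟧-⇔ : ∀ {p q} {P : Set p} {Q : Set q} (p? : Dec P) (q? : Dec Q) →
         (P → Q) → (Q → P) → ⟦ p? ⟧ ≡ ⟦ q? ⟧
  ⟦⟧-⇔ (yes p) q? f g = sym (⟦⟧-yes q? (f p))
  ⟦⟧-⇔ (no ¬p) q? f g = sym (⟦⟧-no q? (¬p ∘ g))

  ⟦⟧-* : ∀ {p} {P : Set p} (p? : Dec P) {a b} → (P → a ≡ b) → ⟦ p? ⟧ ℕ.* a ≡ b ℕ.* ⟦ p? ⟧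
  ⟦⟧-* (yes p) {a} {b} eq = trans (ℕ.*-comm 1 a) (cong (ℕ._* 1) (eq p))
  ⟦⟧-* (no ¬p) {a} {b} eq = sym (ℕ.*-zeroʳ b)

  sum-mono : ∀ {n} {f g : Fin n → ℕ} → (∀ i → f i ℕ.≤ g i) → sum f ℕ.≤ sum g
  sum-mono {zero}  f≤g = z≤n
  sum-mono {suc n} f≤g = ℕ.+-mono-≤ (f≤g zero) (sum-mono (f≤g ∘ suc))

  private
    tight : ∀ {a b c d} → a ℕ.≤ b → c ℕ.≤ d → a ℕ.+ c ≡ b ℕ.+ d → a ≡ b × c ≡ d
    tight {a} {b} {c} {d} a≤b c≤d eq with ℕ.m≤n⇒m<n∨m≡n a≤b
    ... | inj₁ a<b  = contradiction eq (ℕ.<⇒≢ (ℕ.+-mono-<-≤ a<b c≤d))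
    ... | inj₂ refl = refl , ℕ.+-cancelˡ-≡ a _ _ eq

  -- Turns termwise upper bounds into equalities once the totals agree. Existence statements are
  -- obtained this way without exhibiting witnesses: solutions of z³ - z = w, and square roots of
  -- products of non-squares.
  sum-tight : ∀ {n} {f g : Fin n → ℕ} → (∀ i → f i ℕ.≤ g i) → sum f ≡ sum g → ∀ i → f i ≡ g i
  sum-tight f≤g eq zero    = proj₁ (tight (f≤g zero) (sum-mono (f≤g ∘ suc)) eq)
  sum-tight f≤g eq (suc i) =
    sum-tight (f≤g ∘ suc) (proj₂ (tight (f≤g zero) (sum-mono (f≤g ∘ suc)) eq)) i

  sum-const : ∀ n k → sum {n} (λ _ → k) ≡ n ℕ.* k
  sum-const zero    k = refl
  sum-const (suc n) k = cong (k ℕ.+_) (sum-const n k)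

  sum-zero : ∀ {n} {f : Fin n → ℕ} → (∀ i → f i ≡ 0) → sum f ≡ 0
  sum-zero {zero}  _   = refl
  sum-zero {suc n} f≡0 = cong₂ ℕ._+_ (f≡0 zero) (sum-zero (f≡0 ∘ suc))

  sum-indicator : ∀ {n} (i : Fin n) → sum (λ j → ⟦ j Fin.≟ i ⟧) ≡ 1
  sum-indicator {suc n} zero    = cong suc (sum-zero {n} {λ j → ⟦ suc j Fin.≟ zero ⟧} (λ _ → refl))
  sum-indicator {suc n} (suc i) =
    trans (sum-cong-≗ (λ j → ⟦⟧-⇔ (suc j Fin.≟ suc i) (j Fin.≟ i) Fin.suc-injective (cong suc)))
          (sum-indicator i)

  least : ∀ {p} {P : ℕ → Set p} → U.Decidable P → ∀ n →
          (∀ i → i ℕ.< n → ¬ P i) ⊎ ∃ λ k → P k × (∀ i → i ℕ.< k → ¬ P i)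
  least P? zero = inj₁ λ _ ()
  least P? (suc n) with least P? n
  ... | inj₂ found = inj₂ found
  ... | inj₁ none with P? n
  ...   | yes pn = inj₂ (n , pn , none)
  ...   | no ¬pn = inj₁ λ i i<1+n → [ none i , (λ { refl → ¬pn }) ]′ (ℕ.m<1+n⇒m<n∨m≡n i<1+n)

  -- With `fromΣ`, the bijection that numbers the points of the curve row by row.
  toΣ : ∀ {n} (s : Fin n → ℕ) → Fin (sum s) → Σ (Fin n) (Fin ∘ s)
  toΣ {suc n} s k with splitAt (s zero) k
  ... | inj₁ i = zero , i
  ... | inj₂ j with toΣ (s ∘ suc) j
  ...   | i , l = suc i , l

  fromΣ : ∀ {n} (s : Fin n → ℕ) (i : Fin n) → Fin (s i) → Fin (sum s)
  fromΣ s zero    k = k ↑ˡ sum (s ∘ suc)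
  fromΣ s (suc i) k = s zero ↑ʳ fromΣ (s ∘ suc) i k

  toΣ∘fromΣ : ∀ {n} (s : Fin n → ℕ) i k → toΣ s (fromΣ s i k) ≡ (i , k)
  toΣ∘fromΣ s zero k rewrite Fin.splitAt-↑ˡ (s zero) k (sum (s ∘ suc)) = refl
  toΣ∘fromΣ s (suc i) k
    rewrite Fin.splitAt-↑ʳ (s zero) (sum (s ∘ suc)) (fromΣ (s ∘ suc) i k)
          | toΣ∘fromΣ (s ∘ suc) i k = refl

  fromΣ∘toΣ : ∀ {n} (s : Fin n → ℕ) k → fromΣ s (proj₁ (toΣ s k)) (proj₂ (toΣ s k)) ≡ k
  fromΣ∘toΣ {suc n} s k with splitAt (s zero) k in eq
  ... | inj₁ i = Fin.splitAt⁻¹-↑ˡ eq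
  ... | inj₂ j = trans (cong (s zero ↑ʳ_) (fromΣ∘toΣ (s ∘ suc) j)) (Fin.splitAt⁻¹-↑ʳ eq)

  module FiniteSetoid {a ℓ : Level} (S : Setoid a ℓ) (n : ℕ) (enumeration : Inverse S (≡.setoid (Fin n))) where
    open Setoid S renaming (refl to ≈-refl; sym to ≈-sym; trans to ≈-trans; reflexive to ≈-reflexive)

    index : Carrier → Fin n
    index = Inverse.to enumeration

    element : Fin n → Carrier
    element = Inverse.from enumeration

    element-index : ∀ x → element (index x) ≈ x
    element-index = Inverse.strictlyInverseʳ enumeration

    index-element : ∀ i → index (element i) ≡ i
    index-element = Inverse.strictlyInverseˡ enumeration

    index-cong : ∀ {x y} → x ≈ y → index x ≡ index y
    index-cong = Inverse.to-cong enumeration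

    index-injective : ∀ {x y} → index x ≡ index y → x ≈ y
    index-injective eq = ≈-trans (≈-sym (element-index _)) (≈-trans (≈-reflexive (cong element eq)) (element-index _))

    infix 4 _≟_
    _≟_ : Decidable _≈_
    _≟_ = via-injection (Inverse⇒Injection enumeration) Fin._≟_

    any? : ∀ {p} {P : Carrier → Set p} → (∀ {x y} → x ≈ y → P x → P y) → U.Decidable P → Dec (∃ P)
    any? resp P? = map′ (λ (i , pi) → element i , pi)
                        (λ (x , px) → index x , resp (≈-sym (element-index x)) px)
                        (Fin.any? (P? ∘ element))

    Cong : (Carrier → ℕ) → Set _
    Cong φ = ∀ {x y} → x ≈ y → φ x ≡ φ y

    conjugate : (f g : Carrier → Carrier) →
                (∀ {x y} → x ≈ y → f x ≈ f y) → (∀ {x y} → x ≈ y → g x ≈ g y) →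
                (∀ x → f (g x) ≈ x) → (∀ x → g (f x) ≈ x) → Permutation n n
    conjugate f g f-cong g-cong fg gf =
      permutation (conj f) (conj g) (conj-inverse f g f-cong fg) (conj-inverse g f g-cong gf)
      where
      conj : (Carrier → Carrier) → Fin n → Fin n
      conj h i = index (h (element i))
      conj-inverse : ∀ h k → (∀ {x y} → x ≈ y → h x ≈ h y) → (∀ x → h (k x) ≈ x) →
                     ∀ i → conj h (conj k i) ≡ i
      conj-inverse h k h-cong hk i = trans
        (index-cong (≈-trans (h-cong (element-index _)) (hk _))) (index-element i)

    abstract
      ∑ : (Carrier → ℕ) → ℕ
      ∑ φ = sum (φ ∘ element)

      ∑-cong : ∀ {φ ψ} → (∀ x → φ x ≡ ψ x) → ∑ φ ≡ ∑ ψ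
      ∑-cong φ≗ψ = sum-cong-≗ (φ≗ψ ∘ element)

      ∑-+ : ∀ φ ψ → ∑ (λ x → φ x ℕ.+ ψ x) ≡ ∑ φ ℕ.+ ∑ ψ
      ∑-+ φ ψ = ∑-distrib-+ (φ ∘ element) (ψ ∘ element)

      ∑-const : ∀ k → ∑ (λ _ → k) ≡ n ℕ.* k
      ∑-const = sum-const n

      ∑-*ˡ : ∀ k φ → k ℕ.* ∑ φ ≡ ∑ (λ x → k ℕ.* φ x)
      ∑-*ˡ k φ = *-distribˡ-sum k (φ ∘ element)

      ∑-swap : ∀ (φ : Carrier → Carrier → ℕ) → ∑ (λ x → ∑ (φ x)) ≡ ∑ (λ y → ∑ λ x → φ x y)
      ∑-swap φ = ∑-comm λ i j → φ (element i) (element j)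

      ∑≡sum : ∀ φ → ∑ φ ≡ sum (φ ∘ element)
      ∑≡sum φ = refl

      ∑-permute : ∀ {φ} → Cong φ → (f g : Carrier → Carrier) →
                  (∀ {x y} → x ≈ y → f x ≈ f y) → (∀ {x y} → x ≈ y → g x ≈ g y) →
                  (∀ x → f (g x) ≈ x) → (∀ x → g (f x) ≈ x) → ∑ (φ ∘ f) ≡ ∑ φ
      ∑-permute {φ} φ-cong f g f-cong g-cong fg gf = sym (trans
        (sum-permute (φ ∘ element) (conjugate f g f-cong g-cong fg gf))
        (sum-cong-≗ λ i → φ-cong (element-index (f (element i)))))

      ∑-indicator : ∀ c → ∑ (λ x → ⟦ x ≟ c ⟧) ≡ 1
      ∑-indicator c = trans
        (sum-cong-≗ λ i → ⟦⟧-⇔ (element i ≟ c) (i Fin.≟ index c)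
          (λ eq → trans (sym (index-element i)) (index-cong eq))
          (λ { refl → element-index c }))
        (sum-indicator (index c))

      ∑-indicator-* : ∀ {φ} → Cong φ → ∀ c → ∑ (λ x → ⟦ x ≟ c ⟧ ℕ.* φ x) ≡ φ c
      ∑-indicator-* {φ} φ-cong c = trans (∑-cong at) (trans (sym (∑-*ˡ (φ c) (λ x → ⟦ x ≟ c ⟧)))
        (trans (cong (φ c ℕ.*_) (∑-indicator c)) (ℕ.*-identityʳ (φ c))))
        where
        at : ∀ x → ⟦ x ≟ c ⟧ ℕ.* φ x ≡ φ c ℕ.* ⟦ x ≟ c ⟧
        at x = ⟦⟧-* (x ≟ c) φ-cong

      ∑-tight : ∀ {φ ψ} → Cong φ → Cong ψ → (∀ x → φ x ℕ.≤ ψ x) → ∑ φ ≡ ∑ ψ → ∀ x → φ x ≡ ψ x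
      ∑-tight φ-cong ψ-cong φ≤ψ eq x = trans (φ-cong (≈-sym (element-index x)))
        (trans (sum-tight (φ≤ψ ∘ element) eq (index x)) (ψ-cong (element-index x)))

open Counting

-- The chord operation in the abstract.

module Loops where
  open ≡ using (refl; cong; cong₂; subst; subst₂)
  open import Data.Nat.Base using (_<_; _+_; _*_; _^_)

  -- x ∙ y is the third point −(x + y) of a chord; no associativity is assumed.
  record TSLoop (a ℓ : Level) (n : ℕ) : Set (lsuc (a ⊔ ℓ)) where
    infixl 7 _∙_
    field
      points      : Setoid a ℓ
      enumeration : Inverse points (≡.setoid (Fin n))
    open Setoid points public renaming (refl to ≈-refl; sym to ≈-sym; trans to ≈-trans; reflexive to ≈-reflexive)
    field
      _∙_        : Carrier → Carrier → Carrier
      ∙-cong     : ∀ {x y u v} → x ≈ y → u ≈ v → x ∙ u ≈ y ∙ v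
      ∙-comm     : ∀ x y → x ∙ y ≈ y ∙ x
      ∙-involutive : ∀ x y → x ∙ (x ∙ y) ≈ y
      O          : Carrier
      O∙O≈O      : O ∙ O ≈ O

  -- `T` stands for x ↦ 3x and `τ ∙ O` for -τ. In `flex`, the hypothesis says -2x = x, that is 3x =
  -- O.
  record Tripling {a ℓ n} (L : TSLoop a ℓ n) : Set (a ⊔ ℓ) where
    open TSLoop L
    field
      T      : Carrier → Carrier
      T-cong : ∀ {x y} → x ≈ y → T x ≈ T y
      T-homo : ∀ x y → T (x ∙ y) ≈ T x ∙ T y
      flex   : ∀ x → x ∙ x ≈ x → T x ≈ O
      τ      : Carrier
      τ≉O    : ¬ τ ≈ O
      τ≉-τ   : ¬ τ ≈ τ ∙ O
      Tτ≈O   : T τ ≈ O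
      kernel : ∀ x → T x ≈ O → x ≈ O ⊎ x ≈ τ ⊎ x ≈ τ ∙ O

  -- McKay's congruence for finite loops.

  module Subloops {a ℓ : Level} {n : ℕ} (L : TSLoop a ℓ n) where
    open TSLoop L
    open FiniteSetoid points n enumeration public

    ∙-congˡ : ∀ {x y z} → y ≈ z → x ∙ y ≈ x ∙ z
    ∙-congˡ = ∙-cong ≈-refl

    ∙-congʳ : ∀ {x y z} → y ≈ z → y ∙ x ≈ z ∙ x
    ∙-congʳ eq = ∙-cong eq ≈-refl

    ∙-involutiveʳ : ∀ x y → (x ∙ y) ∙ y ≈ x
    ∙-involutiveʳ x y = ≈-trans (∙-comm _ _) (≈-trans (∙-congˡ (∙-comm x y)) (∙-involutive y x))

    ∙-cancelˡ : ∀ x {y z} → x ∙ y ≈ x ∙ z → y ≈ z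
    ∙-cancelˡ x eq = ≈-trans (≈-sym (∙-involutive x _)) (≈-trans (∙-congˡ eq) (∙-involutive x _))

    ∙-cancelʳ : ∀ {x} y {z} → x ∙ y ≈ z ∙ y → x ≈ z
    ∙-cancelʳ y eq = ≈-trans (≈-sym (∙-involutiveʳ _ y)) (≈-trans (∙-congʳ eq) (∙-involutiveʳ _ y))

    code : Carrier → Carrier → ℕ
    code x y = toℕ (combine (index x) (index y))

    code-cong : ∀ {x y u v} → x ≈ y → u ≈ v → code x u ≡ code y v
    code-cong x≈y u≈v = cong₂ (λ i j → toℕ (combine i j)) (index-cong x≈y) (index-cong u≈v)

    code-injective : ∀ x y u v → code x y ≡ code u v → x ≈ u × y ≈ v
    code-injective x y u v eq with ix , iy ← Fin.combine-injective (index x) (index y) (index u) (index v)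
        (Fin.toℕ-injective eq)
      = index-injective ix , index-injective iy

    smallest? : ∀ k l m → Dec (k < l × k < m)
    smallest? k l m = k ℕ.<? l ×-dec k ℕ.<? m

    one-smallest : ∀ k l m → k ≢ l → l ≢ m → m ≢ k →
                   ⟦ smallest? k l m ⟧ + ⟦ smallest? l m k ⟧ + ⟦ smallest? m k l ⟧ ≡ 1
    one-smallest k l m k≢l l≢m m≢k with ℕ.<-cmp k l | ℕ.<-cmp l m | ℕ.<-cmp m k
    ... | tri≈ _ k≡l _ | _ | _ = contradiction k≡l k≢l
    ... | _ | tri≈ _ l≡m _ | _ = contradiction l≡m l≢m
    ... | _ | _ | tri≈ _ m≡k _ = contradiction m≡k m≢k
    ... | tri< k<l _ _ | tri< l<m _ _ | tri< m<k _ _ = ⊥-elim (ℕ.<-irrefl refl (ℕ.<-trans k<l (ℕ.<-trans l<m m<k)))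
    ... | tri> _ _ l<k | tri> _ _ m<l | tri> _ _ k<m = ⊥-elim (ℕ.<-irrefl refl (ℕ.<-trans l<k (ℕ.<-trans k<m m<l)))
    ... | tri< k<l _ l≮k | tri> _ _ m<l | tri< m<k _ k≮m =
      cong₂ _+_ (cong₂ _+_ (⟦⟧-no (smallest? k l m) (k≮m ∘ proj₂)) (⟦⟧-no (smallest? l m k) (l≮k ∘ proj₂)))
        (⟦⟧-yes (smallest? m k l) (m<k , m<l))
    ... | tri< k<l _ l≮k | _ | tri> m≮k _ k<m =
      cong₂ _+_ (cong₂ _+_ (⟦⟧-yes (smallest? k l m) (k<l , k<m)) (⟦⟧-no (smallest? l m k) (l≮k ∘ proj₂)))
        (⟦⟧-no (smallest? m k l) (m≮k ∘ proj₁))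
    ... | tri> k≮l _ l<k | tri< l<m _ m≮l | _ =
      cong₂ _+_ (cong₂ _+_ (⟦⟧-no (smallest? k l m) (k≮l ∘ proj₁)) (⟦⟧-yes (smallest? l m k) (l<m , l<k)))
        (⟦⟧-no (smallest? m k l) (m≮l ∘ proj₂))
    ... | tri> k≮l _ l<k | tri> l≮m _ m<l | tri< m<k _ _ =
      cong₂ _+_ (cong₂ _+_ (⟦⟧-no (smallest? k l m) (k≮l ∘ proj₁)) (⟦⟧-no (smallest? l m k) (l≮m ∘ proj₁)))
        (⟦⟧-yes (smallest? m k l) (m<k , m<l))

    -- Strict inequalities make an orbit of equal codes contribute nothing, so the fixed pair (O ,
    -- O) is counted by its own indicator.
    none-smallest : ∀ {k l m} → k ≡ l → l ≡ m → ⟦ smallest? k l m ⟧ ≡ 0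
    none-smallest {k} {l} {m} k≡l l≡m = ⟦⟧-no (smallest? k l m) λ (k<l , _) → ℕ.<⇒≢ k<l k≡l

    module _ {x : Level} {X : Carrier → Set x} (X? : U.Decidable X)
             (X-resp : ∀ {x y} → x ≈ y → X x → X y)
             (X-∙ : ∀ {x y} → X x → X y → X (x ∙ y)) (X-O : X O)
             -- X has no 3-torsion other than O.
             (fixed⇒O : ∀ {x} → X x → x ∙ x ≈ x → x ≈ O) where

      size : ℕ
      size = ∑ (λ x → ⟦ X? x ⟧)

      private
        smallest : Carrier → Carrier → ℕ
        smallest x y = ⟦ X? x ⟧ * ⟦ X? y ⟧ *
          ⟦ smallest? (code x y) (code y (x ∙ y)) (code (x ∙ y) x) ⟧

        X-cong : Cong (λ x → ⟦ X? x ⟧)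
        X-cong {x} {y} x≈y = ⟦⟧-⇔ (X? x) (X? y) (X-resp x≈y) (X-resp (≈-sym x≈y))

        smallest-cong : ∀ {x y u v} → x ≈ u → y ≈ v → smallest x y ≡ smallest u v
        smallest-cong x≈u y≈v
          rewrite X-cong x≈u | X-cong y≈v | code-cong x≈u y≈v
                | code-cong y≈v (∙-cong x≈u y≈v) | code-cong (∙-cong x≈u y≈v) x≈u = refl

        -- Rotation of the triples x, y, x ∙ y of sum zero, acting on functions of the first two
        -- members.
        ρ : (Carrier → Carrier → ℕ) → Carrier → Carrier → ℕ
        ρ φ x y = φ y (x ∙ y)

        Cong₂ : (Carrier → Carrier → ℕ) → Set _
        Cong₂ φ = ∀ {x y u v} → x ≈ u → y ≈ v → φ x y ≡ φ u v

        ∑∑ : (Carrier → Carrier → ℕ) → ℕ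
        ∑∑ φ = ∑ λ x → ∑ λ y → φ x y

        -- For fixed y the map x ↦ x ∙ y is an involution, so rotation permutes the pairs.
        ∑∑-ρ : ∀ {φ} → Cong₂ φ → ∑∑ (ρ φ) ≡ ∑∑ φ
        ∑∑-ρ {φ} φ-cong = ≡.trans (∑-swap (ρ φ)) (∑-cong λ y →
          ∑-permute {φ y} (φ-cong ≈-refl) (_∙ y) (_∙ y) ∙-congʳ ∙-congʳ
            (λ x → ∙-involutiveʳ x y) (λ x → ∙-involutiveʳ x y))

        -- Any two of x, y, x ∙ y give the third, so closure puts all three into X as soon as two
        -- lie there. The three rotations then compare the same three codes, and exactly one of them
        -- is smallest unless the pair is (O , O).
        orbit : ∀ x y → ⟦ X? x ⟧ * ⟦ X? y ⟧ ≡
                ⟦ x ≟ O ⟧ * ⟦ y ≟ O ⟧ + (smallest x y + ρ smallest x y + ρ (ρ smallest) x y)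
        orbit x y = ≡.trans (aux (X? x) (X? y) (X? (x ∙ y)) (x ≟ O) (y ≟ O))
          (cong (λ k → ⟦ x ≟ O ⟧ * ⟦ y ≟ O ⟧ + k) (cong₂ _+_ (cong (smallest x y ℕ.+_)
            (cong (⟦ X? y ⟧ * ⟦ X? z ⟧ *_) (cong₂ (λ k l → ⟦ smallest? (code y z) k l ⟧)
               (code-cong ≈-refl (≈-sym y∙z≈x)) (code-cong (≈-sym y∙z≈x) ≈-refl))))
            (≡.trans (cong₂ (λ k l → ⟦ X? z ⟧ * ⟦ X? x ⟧ * ⟦ smallest? (code z x) k l ⟧)
                (code-cong ≈-refl (≈-sym z∙x≈y)) (code-cong (≈-sym z∙x≈y) ≈-refl))
              (smallest-cong ≈-refl (≈-sym y∙z≈x)))))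
          where
          z = x ∙ y
          y∙z≈x : y ∙ z ≈ x
          y∙z≈x = ≈-trans (∙-congˡ (∙-comm x y)) (∙-involutive y x)
          z∙x≈y : z ∙ x ≈ y
          z∙x≈y = ≈-trans (∙-comm z x) (∙-involutive x y)
          k = code x y
          l = code y z
          m = code z x
          -- Equality of two codes of the orbit means x = y = x ∙ y, so x is a flex and hence O.
          -- Outside (O , O) the three codes therefore differ.
          distinct : X x → (x ≈ y → y ≈ z → x ≈ O × y ≈ O)
          distinct Xx x≈y y≈z = x≈O , ≈-trans (≈-sym x≈y) x≈O
            where x≈O = fixed⇒O Xx (≈-trans (∙-congˡ x≈y) (≈-sym (≈-trans x≈y y≈z)))
          all-equal : x ≈ O → y ≈ O → k ≡ l × l ≡ m
          all-equal x≈O y≈O = code-cong (≈-trans x≈O (≈-sym y≈O)) (≈-trans y≈O (≈-sym z≈O))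
                            , code-cong (≈-trans y≈O (≈-sym z≈O)) (≈-trans z≈O (≈-sym x≈O))
            where z≈O = ≈-trans (∙-cong x≈O y≈O) O∙O≈O
          aux : (x? : Dec (X x)) (y? : Dec (X y)) (z? : Dec (X z)) (x≈O? : Dec (x ≈ O)) (y≈O? : Dec (y ≈ O)) →
            ⟦ x? ⟧ * ⟦ y? ⟧ ≡ ⟦ x≈O? ⟧ * ⟦ y≈O? ⟧ +
              (⟦ x? ⟧ * ⟦ y? ⟧ * ⟦ smallest? k l m ⟧ + ⟦ y? ⟧ * ⟦ z? ⟧ * ⟦ smallest? l m k ⟧ + ⟦ z? ⟧ * ⟦ x? ⟧ * ⟦ smallest? m k l ⟧)
          aux (no ¬x) y? z? (yes x≈O) _ = contradiction (X-resp (≈-sym x≈O) X-O) ¬x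
          aux (no ¬x) (no _)  (no _)  (no _) _ = refl
          aux (no ¬x) (no _)  (yes _) (no _) _ = refl
          aux (no ¬x) (yes _) (no _)  (no _) _ = refl
          aux (no ¬x) (yes Xy) (yes Xz) (no _) _ = contradiction (X-resp y∙z≈x (X-∙ Xy Xz)) ¬x
          aux (yes _) (no ¬y) z? _ (yes y≈O) = contradiction (X-resp (≈-sym y≈O) X-O) ¬y
          aux (yes _) (no _) (no _) (yes _) (no _) = refl
          aux (yes _) (no _) (no _) (no _) (no _) = refl
          aux (yes Xx) (no ¬y) (yes Xz) _ (no _) = contradiction (X-resp z∙x≈y (X-∙ Xz Xx)) ¬y
          aux (yes Xx) (yes Xy) (no ¬z) _ _ = contradiction (X-∙ Xx Xy) ¬z
          aux (yes Xx) (yes Xy) (yes Xz) x? y? = distinct-case x? y?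
            where
            some-not-O : ¬ (x ≈ O × y ≈ O) →
              1 ≡ ((1 * ⟦ smallest? k l m ⟧) + (1 * ⟦ smallest? l m k ⟧) + (1 * ⟦ smallest? m k l ⟧))
            some-not-O ¬O
              rewrite ℕ.*-identityˡ ⟦ smallest? k l m ⟧ | ℕ.*-identityˡ ⟦ smallest? l m k ⟧ | ℕ.*-identityˡ ⟦ smallest? m k l ⟧
              = ≡.sym (one-smallest k l m
                (λ k≡l → let p , q = code-injective _ _ _ _ k≡l in ¬O (distinct Xx p q))
                (λ l≡m → let p , q = code-injective _ _ _ _ l≡m in ¬O (distinct Xx (≈-trans (≈-sym q) (≈-sym p)) p))
                (λ m≡k → let p , q = code-injective _ _ _ _ m≡k in ¬O (distinct Xx q (≈-trans (≈-sym q) (≈-sym p)))))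
            distinct-case : (x≈O? : Dec (x ≈ O)) (y≈O? : Dec (y ≈ O)) → 1 ≡ ⟦ x≈O? ⟧ * ⟦ y≈O? ⟧ +
              ((1 * ⟦ smallest? k l m ⟧) + (1 * ⟦ smallest? l m k ⟧) + (1 * ⟦ smallest? m k l ⟧))
            distinct-case (yes x≈O) (yes y≈O) with k≡l , l≡m ← all-equal x≈O y≈O
              rewrite none-smallest k≡l l≡m | none-smallest l≡m (≡.sym (≡.trans k≡l l≡m))
                    | none-smallest (≡.sym (≡.trans k≡l l≡m)) k≡l = refl
            distinct-case (yes _)   (no y≉O) = some-not-O (y≉O ∘ proj₂)
            distinct-case (no x≉O)  _        = some-not-O (x≉O ∘ proj₁)

      -- McKay: (x , y) ↦ (y , x ∙ y) has order 3 on pairs and fixes only (O , O); each other orbit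
      -- contains exactly one pair with smallest code.
      size²≡1mod3 : ∃ λ k → size * size ≡ 1 + 3 * k
      size²≡1mod3 = ∑∑ smallest , (begin
        size * size
          ≡⟨ ∑-*ˡ size _ ⟩
        ∑ (λ x → size * ⟦ X? x ⟧)
          ≡⟨ ∑-cong (λ x → ≡.trans (ℕ.*-comm size _) (∑-*ˡ ⟦ X? x ⟧ _)) ⟩
        ∑∑ (λ x y → ⟦ X? x ⟧ * ⟦ X? y ⟧)
          ≡⟨ ∑-cong (λ x → ∑-cong (orbit x)) ⟩
        ∑∑ (λ x y → ⟦ x ≟ O ⟧ * ⟦ y ≟ O ⟧ + (smallest x y + ρ smallest x y + ρ (ρ smallest) x y))
          ≡⟨ ∑∑-+ _ _ ⟩
        ∑∑ (λ x y → ⟦ x ≟ O ⟧ * ⟦ y ≟ O ⟧) + ∑∑ (λ x y → smallest x y + ρ smallest x y + ρ (ρ smallest) x y)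
          ≡⟨ cong₂ _+_ only-O (≡.trans (∑∑-+ _ _) (cong₂ _+_ (∑∑-+ _ _) refl)) ⟩
        1 + (∑∑ smallest + ∑∑ (ρ smallest) + ∑∑ (ρ (ρ smallest)))
          ≡⟨ cong (1 ℕ.+_) (cong₂ _+_ (cong (∑∑ smallest ℕ.+_) (∑∑-ρ smallest-cong))
               (≡.trans (∑∑-ρ {ρ smallest} (λ p q → smallest-cong q (∙-cong p q))) (∑∑-ρ smallest-cong))) ⟩
        1 + (∑∑ smallest + ∑∑ smallest + ∑∑ smallest)
          ≡⟨ solve 1 (λ s → con 1 :+ (s :+ s :+ s) := con 1 :+ con 3 :* s) refl (∑∑ smallest) ⟩
        1 + 3 * ∑∑ smallest ∎)
        where
        open ≡.≡-Reasoning
        open ℕ.+-*-Solver using (solve; _:+_; _:*_; con; _:=_)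
        ∑∑-+ : ∀ φ ψ → ∑∑ (λ x y → φ x y + ψ x y) ≡ ∑∑ φ + ∑∑ ψ
        ∑∑-+ φ ψ = ≡.trans (∑-cong λ x → ∑-+ (φ x) (ψ x)) (∑-+ _ _)
        only-O : ∑∑ (λ x y → ⟦ x ≟ O ⟧ * ⟦ y ≟ O ⟧) ≡ 1
        only-O = ≡.trans (∑-cong λ x → ≡.trans (≡.sym (∑-*ˡ ⟦ x ≟ O ⟧ (λ y → ⟦ y ≟ O ⟧)))
          (≡.trans (cong (⟦ x ≟ O ⟧ *_) (∑-indicator O)) (ℕ.*-identityʳ ⟦ x ≟ O ⟧))) (∑-indicator O)

      3∤size : 3 ∤ size
      3∤size 3∣size with k , eq ← size²≡1mod3 = contradiction
        (∣1⇒≡1 (∣m+n∣m⇒∣n (subst (3 ∣_) (≡.trans eq (ℕ.+-comm 1 (3 * k))) (∣n⇒∣m*n size 3∣size)) (m∣m*n k))) λ ()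

  -- Iterated tripling: images, kernels and orbits.

  module TriplingTheory {a ℓ : Level} {n : ℕ} (L : TSLoop a ℓ n) (tripling : Tripling L) where
    open TSLoop L
    open Tripling tripling
    open Subloops L

    T^ : ℕ → Carrier → Carrier
    T^ zero    x = x
    T^ (suc i) x = T (T^ i x)

    T^-cong : ∀ i {x y} → x ≈ y → T^ i x ≈ T^ i y
    T^-cong zero    eq = eq
    T^-cong (suc i) eq = T-cong (T^-cong i eq)

    T^-homo : ∀ i x y → T^ i (x ∙ y) ≈ T^ i x ∙ T^ i y
    T^-homo zero    x y = ≈-refl
    T^-homo (suc i) x y = ≈-trans (T-cong (T^-homo i x y)) (T-homo _ _)

    T^-+ : ∀ i j x → T^ (i + j) x ≡ T^ i (T^ j x)
    T^-+ zero    j x = refl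
    T^-+ (suc i) j x = cong T (T^-+ i j x)

    T^-comm : ∀ i j x → T^ i (T^ j x) ≡ T^ j (T^ i x)
    T^-comm i j x = ≡.trans (≡.sym (T^-+ i j x)) (≡.trans (cong (λ k → T^ k x) (ℕ.+-comm i j)) (T^-+ j i x))

    TO≈O : T O ≈ O
    TO≈O = flex O O∙O≈O

    T^O≈O : ∀ i → T^ i O ≈ O
    T^O≈O zero    = ≈-refl
    T^O≈O (suc i) = ≈-trans (T-cong (T^O≈O i)) TO≈O

    T^-O-mono : ∀ {i j x} → i ≤ j → T^ i x ≈ O → T^ j x ≈ O
    T^-O-mono {i} {j} {x} i≤j eq = ≈-trans
      (≈-reflexive (≡.trans (cong (λ k → T^ k x) (≡.sym (ℕ.m∸n+n≡m i≤j))) (T^-+ (j ℕ.∸ i) i x)))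
      (≈-trans (T^-cong (j ℕ.∸ i) eq) (T^O≈O (j ℕ.∸ i)))

    -- With x ∙ y read as -(x + y), `x ∙ O` is -x; this is x - y, and `_⊕_` is x + y.
    _⊖_ : Carrier → Carrier → Carrier
    x ⊖ y = (x ∙ O) ∙ y

    _⊕_ : Carrier → Carrier → Carrier
    x ⊕ y = (x ∙ y) ∙ O

    -- The instance of associativity on which the coset arguments rest: involutivity removes y.
    ⊕-⊖ : ∀ x y → y ⊕ (x ⊖ y) ≈ x
    ⊕-⊖ x y = ≈-trans (∙-congʳ (≈-trans (∙-congˡ (∙-comm _ _)) (∙-involutive _ _))) (∙-involutiveʳ x O)

    T^⊖≈O : ∀ i {x y} → T^ i x ≈ T^ i y → T^ i (x ⊖ y) ≈ O
    T^⊖≈O i {x} {y} eq = ≈-trans (T^-homo i _ _) (≈-trans (∙-congʳ (≈-trans (T^-homo i _ _) (∙-cong eq (T^O≈O i))))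
      (≈-trans (∙-comm _ _) (∙-involutive _ _)))

    T⊕ : ∀ {x y} → T y ≈ O → T (x ⊕ y) ≈ T x
    T⊕ {x} {y} eq = ≈-trans (T-homo _ _) (≈-trans (∙-cong (≈-trans (T-homo _ _) (∙-congˡ eq)) TO≈O)
        (∙-involutiveʳ _ _))

    ⊕-cancelˡ : ∀ x {y z} → x ⊕ y ≈ x ⊕ z → y ≈ z
    ⊕-cancelˡ x eq = ∙-cancelˡ x (∙-cancelʳ O eq)

    Image : ℕ → Carrier → Set _
    Image i x = ∃ λ r → T^ i r ≈ x

    Image-resp : ∀ i {x y} → x ≈ y → Image i x → Image i y
    Image-resp i eq (r , p) = r , ≈-trans p eq

    Image-∙ : ∀ i {x y} → Image i x → Image i y → Image i (x ∙ y)
    Image-∙ i (r , p) (s , q) = r ∙ s , ≈-trans (T^-homo i r s) (∙-cong p q)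

    Image-O : ∀ i → Image i O
    Image-O i = O , T^O≈O i

    Image-⊕ : ∀ i {x y} → Image i x → Image i y → Image i (x ⊕ y)
    Image-⊕ i p q = Image-∙ i (Image-∙ i p q) (Image-O i)

    Image-⊖ : ∀ i {x y} → Image i x → Image i y → Image i (x ⊖ y)
    Image-⊖ i p q = Image-∙ i (Image-∙ i p (Image-O i)) q

    Image-mono : ∀ {i j x} → i ≤ j → Image j x → Image i x
    Image-mono {i} {j} i≤j (r , p) = T^ (j ℕ.∸ i) r ,
      ≈-trans (≈-reflexive (≡.trans (≡.sym (T^-+ i (j ℕ.∸ i) r)) (cong (λ k → T^ k r) (ℕ.m+[n∸m]≡n i≤j)))) p

    Image? : ∀ i → U.Decidable (Image i)
    Image? i x = any? (λ p q → ≈-trans (≈-sym (T^-cong i p)) q) (λ r → T^ i r ≟ x)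

    kernel⊆Image : ∀ i → Image i τ → ∀ {x} → T x ≈ O → Image i x
    kernel⊆Image i τ∈ {x} Tx≈O with kernel x Tx≈O
    ... | inj₁ x≈O          = Image-resp i (≈-sym x≈O) (Image-O i)
    ... | inj₂ (inj₁ x≈τ)   = Image-resp i (≈-sym x≈τ) τ∈
    ... | inj₂ (inj₂ x≈-τ)  = Image-resp i (≈-sym x≈-τ) (Image-∙ i τ∈ (Image-O i))

    image-size : ℕ → ℕ
    image-size i = ∑ (λ x → ⟦ Image? i x ⟧)

    image-size-zero : image-size 0 ≡ n
    image-size-zero = ≡.trans (∑-cong (λ x → ⟦⟧-yes (Image? 0 x) (x , ≈-refl))) (≡.trans (∑-const 1)
        (ℕ.*-identityʳ n))

    -- Counts the pairs (x , T x) with x in the i-th image by their second member. The fibre over T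
    -- x₀ is x₀, x₀ + τ, x₀ - τ, and all three lie in the i-th image because τ does.
    image-size-suc : ∀ i → Image i τ → image-size i ≡ 3 * image-size (suc i)
    image-size-suc i τ∈ = begin
      ∑ (λ x → ⟦ Image? i x ⟧)
        ≡⟨ ∑-cong (λ x → ≡.trans (≡.sym (ℕ.*-identityʳ _)) (≡.trans (cong (⟦ Image? i x ⟧ *_) (≡.sym (∑-indicator
            (T x)))) (∑-*ˡ ⟦ Image? i x ⟧ (λ y → ⟦ y ≟ T x ⟧)))) ⟩
      ∑ (λ x → ∑ (λ y → ⟦ Image? i x ⟧ * ⟦ y ≟ T x ⟧))
        ≡⟨ ∑-swap _ ⟩
      ∑ (λ y → ∑ (λ x → ⟦ Image? i x ⟧ * ⟦ y ≟ T x ⟧))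
        ≡⟨ ∑-cong (λ y → fibre y (Image? (suc i) y)) ⟩
      ∑ (λ y → 3 * ⟦ Image? (suc i) y ⟧)
        ≡⟨ ∑-*ˡ 3 _ ⟨
      3 * ∑ (λ y → ⟦ Image? (suc i) y ⟧) ∎
      where
      open ≡.≡-Reasoning
      indicator-* : ∀ {p q r} {P : Set p} {Q : Set q} {R : Set r} (p? : Dec P) (q? : Dec Q) (r? : Dec R) →
                    (P → Q → R) → (R → P × Q) → ⟦ p? ⟧ * ⟦ q? ⟧ ≡ ⟦ r? ⟧
      indicator-* (yes p) (yes q) r? f g = ≡.sym (⟦⟧-yes r? (f p q))
      indicator-* (yes p) (no ¬q) r? f g = ≡.sym (⟦⟧-no r? (¬q ∘ proj₂ ∘ g))
      indicator-* (no ¬p) q?      r? f g = ≡.sym (⟦⟧-no r? (¬p ∘ proj₁ ∘ g))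
      fibre : ∀ y (y? : Dec (Image (suc i) y)) → ∑ (λ x → ⟦ Image? i x ⟧ * ⟦ y ≟ T x ⟧) ≡ 3 * ⟦ y? ⟧
      fibre y (no ¬y) = ≡.trans (∑-cong λ x → zero-* (Image? i x) (y ≟ T x) λ (r , p) y≈Tx → ¬y (r , ≈-trans
          (T-cong p) (≈-sym y≈Tx)))
        (≡.trans (∑-const 0) (ℕ.*-zeroʳ n))
        where
        zero-* : ∀ {p q} {P : Set p} {Q : Set q} (p? : Dec P) (q? : Dec Q) → (P → ¬ Q) → ⟦ p? ⟧ * ⟦ q? ⟧ ≡ 0
        zero-* (yes p) q? f = ≡.trans (ℕ.*-identityˡ _) (⟦⟧-no q? (f p))
        zero-* (no _)  q? f = refl
      fibre y (yes (r , Tx₀≈y)) = ≡.trans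
        (∑-cong λ x → ≡.trans
          (indicator-* (Image? i x) (y ≟ T x) (x ≟ x₀ ⊎-dec x ≟ x₁ ⊎-dec x ≟ x₂) (λ _ → into x) (out x))
          (three (x ≟ x₀) (x ≟ x₁) (x ≟ x₂)
            (λ p q → x₀≉x₁ (≈-trans (≈-sym p) q)) (λ p q → x₀≉x₂ (≈-trans (≈-sym p) q)) (λ p q → x₁≉x₂ (≈-trans
                (≈-sym p) q))))
        (≡.trans (∑-+ _ _) (≡.trans (cong₂ _+_ (∑-+ _ _) refl)
          (cong₂ _+_ (cong₂ _+_ (∑-indicator x₀) (∑-indicator x₁)) (∑-indicator x₂))))
        where
        x₀ = T^ i r
        x₁ = x₀ ⊕ τ
        x₂ = x₀ ⊕ (τ ∙ O)
        x₀⊕O≈x₀ : x₀ ⊕ O ≈ x₀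
        x₀⊕O≈x₀ = ∙-involutiveʳ x₀ O
        T-τ≈O : T (τ ∙ O) ≈ O
        T-τ≈O = ≈-trans (T-homo τ O) (≈-trans (∙-cong Tτ≈O TO≈O) O∙O≈O)
        x₀≉x₁ : ¬ x₀ ≈ x₁
        x₀≉x₁ eq = τ≉O (≈-sym (⊕-cancelˡ x₀ (≈-trans x₀⊕O≈x₀ eq)))
        x₀≉x₂ : ¬ x₀ ≈ x₂
        x₀≉x₂ eq = τ≉O (∙-cancelʳ O (≈-trans (≈-sym (⊕-cancelˡ x₀ (≈-trans x₀⊕O≈x₀ eq))) (≈-sym O∙O≈O)))
        x₁≉x₂ : ¬ x₁ ≈ x₂
        x₁≉x₂ eq = τ≉-τ (⊕-cancelˡ x₀ eq)
        into : ∀ x → y ≈ T x → x ≈ x₀ ⊎ x ≈ x₁ ⊎ x ≈ x₂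
        into x y≈Tx with kernel (x ⊖ x₀) (T^⊖≈O 1 (≈-trans (≈-sym y≈Tx) (≈-sym Tx₀≈y)))
        ... | inj₁ d≈O        = inj₁ (≈-trans (≈-sym (⊕-⊖ x x₀)) (≈-trans (∙-congʳ (∙-congˡ d≈O)) x₀⊕O≈x₀))
        ... | inj₂ (inj₁ d≈τ) = inj₂ (inj₁ (≈-trans (≈-sym (⊕-⊖ x x₀)) (∙-congʳ (∙-congˡ d≈τ))))
        ... | inj₂ (inj₂ d≈τ) = inj₂ (inj₂ (≈-trans (≈-sym (⊕-⊖ x x₀)) (∙-congʳ (∙-congˡ d≈τ))))
        Tx₀⊕ : ∀ {d} → T d ≈ O → y ≈ T (x₀ ⊕ d)
        Tx₀⊕ Td≈O = ≈-trans (≈-sym Tx₀≈y) (≈-sym (T⊕ Td≈O))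
        out : ∀ x → x ≈ x₀ ⊎ x ≈ x₁ ⊎ x ≈ x₂ → Image i x × y ≈ T x
        out x (inj₁ p)        = (r , ≈-sym p) , ≈-trans (≈-sym Tx₀≈y) (T-cong (≈-sym p))
        out x (inj₂ (inj₁ p)) = Image-resp i (≈-sym p) (Image-⊕ i (r , ≈-refl) τ∈) , ≈-trans (Tx₀⊕ Tτ≈O) (T-cong
            (≈-sym p))
        out x (inj₂ (inj₂ p)) = Image-resp i (≈-sym p) (Image-⊕ i (r , ≈-refl) (Image-∙ i τ∈ (Image-O i)))
                              , ≈-trans (Tx₀⊕ T-τ≈O) (T-cong (≈-sym p))
        three : ∀ {p} {P Q R : Set p} (p? : Dec P) (q? : Dec Q) (r? : Dec R) →
                (P → ¬ Q) → (P → ¬ R) → (Q → ¬ R) → ⟦ p? ⊎-dec q? ⊎-dec r? ⟧ ≡ ⟦ p? ⟧ + ⟦ q? ⟧ + ⟦ r? ⟧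
        three (yes p) q? r? f g h = ≡.sym (cong₂ _+_ (cong (1 ℕ.+_) (⟦⟧-no q? (f p))) (⟦⟧-no r? (g p)))
        three (no _) (yes q) r? f g h = ≡.sym (cong (1 ℕ.+_) (⟦⟧-no r? (h q)))
        three (no _) (no _) (yes r) f g h = refl
        three (no _) (no _) (no _)  f g h = refl

    size-factor : ∀ i → (∀ j → j < i → Image j τ) → n ≡ 3 ^ i * image-size i
    size-factor zero    τ∈ = ≡.trans (≡.sym image-size-zero) (≡.sym (ℕ.*-identityˡ _))
    size-factor (suc i) τ∈ = begin
      n                                ≡⟨ size-factor i (λ j j<i → τ∈ j (ℕ.m≤n⇒m≤1+n j<i)) ⟩
      3 ^ i * image-size i             ≡⟨ cong (3 ^ i *_) (image-size-suc i (τ∈ i ℕ.≤-refl)) ⟩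
      3 ^ i * (3 * image-size (suc i)) ≡⟨ ℕ.*-assoc (3 ^ i) 3 _ ⟨
      3 ^ i * 3 * image-size (suc i)   ≡⟨ cong (_* image-size (suc i)) (ℕ.*-comm (3 ^ i) 3) ⟩
      3 ^ suc i * image-size (suc i)   ∎
      where open ≡.≡-Reasoning

    n<3^n : ∀ k → k < 3 ^ k
    n<3^n zero    = s≤s z≤n
    n<3^n (suc k) = begin-strict
      suc k             ≤⟨ n<3^n k ⟩
      3 ^ k             <⟨ ℕ.m<m+n (3 ^ k) (ℕ.≤-trans (ℕ.≤-trans (s≤s z≤n) (n<3^n k)) (ℕ.m≤m+n _ _)) ⟩
      3 ^ k + (3 ^ k + (3 ^ k + 0)) ∎
      where open ℕ.≤-Reasoning

    -- If τ lay in the first n images, 3ⁿ would divide n, which is positive because O exists,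
    -- although n < 3ⁿ.
    depth : ∃ λ h → ¬ Image h τ × (∀ i → i < h → Image i τ)
    depth with least (λ i → ¬? (Image? i τ)) n
    ... | inj₂ (h , ¬h , below) = h , ¬h , λ i i<h → decidable-stable (Image? i τ) (below i i<h)
    ... | inj₁ all = contradiction (size-factor n λ i i<n → decidable-stable (Image? i τ) (all i i<n))
                                   (ℕ.<⇒≢ (ℕ.<-≤-trans (n<3^n n) (ℕ.m≤m*n (3 ^ n)
                                       (image-size n) ⦃ ℕ.>-nonZero size>0 ⦄)))
      where
      size>0 : 0 < image-size n
      size>0 = ℕ.n≢0⇒n>0 λ size≡0 → contradiction
        (≡.trans (size-factor n λ i i<n → decidable-stable (Image? i τ) (all i i<n)) (≡.trans (cong
            (3 ^ n *_) size≡0) (ℕ.*-zeroʳ (3 ^ n))))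
        (ℕ.>⇒≢ (ℕ.≤-<-trans z≤n (Fin.toℕ<n (index O))))

    infix 4 _~_
    -- Equality up to sign, which on the curve is equality of x-coordinates of affine points.
    _~_ : Carrier → Carrier → Set _
    x ~ y = x ≈ y ⊎ x ≈ y ∙ O

    _~?_ : ∀ x y → Dec (x ~ y)
    x ~? y = x ≟ y ⊎-dec x ≟ y ∙ O

    ~-sym : ∀ {x y} → x ~ y → y ~ x
    ~-sym (inj₁ eq) = inj₁ (≈-sym eq)
    ~-sym (inj₂ eq) = inj₂ (≈-trans (≈-sym (∙-involutiveʳ _ O)) (∙-congʳ (≈-sym eq)))

    T-neg : ∀ x → T (x ∙ O) ≈ T x ∙ O
    T-neg x = ≈-trans (T-homo x O) (∙-congˡ TO≈O)

    T^-~ : ∀ i {x y} → x ~ y → T^ i x ~ T^ i y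
    T^-~ zero    eq = eq
    T^-~ (suc i) {x} {y} eq with T^-~ i eq
    ... | inj₁ eq′ = inj₁ (T-cong eq′)
    ... | inj₂ eq′ = inj₂ (≈-trans (T-cong eq′) (T-neg _))

    Image-resp-~ : ∀ {i x y} → x ~ y → Image i x → Image i y
    Image-resp-~ {i} (inj₁ eq) x∈ = Image-resp i eq x∈
    Image-resp-~ {i} {x} {y} (inj₂ eq) x∈ =
      Image-resp i (≈-trans (∙-congʳ eq) (∙-involutiveʳ y O)) (Image-∙ i x∈ (Image-O i))

    -- `T^ g P` is then a nonzero 3-torsion point. As `T^ i P` will carry the term u (i + 1), this
    -- is u reaching ∛a at index h.
    Terminates : Carrier → ℕ → Set _
    Terminates P h = ∃ λ g → h ≡ suc g × ¬ T^ g P ≈ O × T^ h P ≈ O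

    -- The iterates up to sign have pre-period exactly h, which with the shift of index by one is a
    -- cycle of u starting at h + 1.
    Cycles : Carrier → ℕ → Set _
    Cycles P h = (∀ i → ¬ T^ i P ≈ O) × ∃ λ r → 1 ≤ r × T^ h P ~ T^ (h + r) P ×
                 (∀ i j → i < j → j < h + r → ¬ T^ i P ~ T^ j P)

    module AtDepth (h : ℕ) (τ∉ : ¬ Image h τ) (τ∈ : ∀ i → i < h → Image i τ) where

      kernel∩Image : ∀ {x} → Image h x → T x ≈ O → x ≈ O
      kernel∩Image {x} x∈ Tx≈O with kernel x Tx≈O
      ... | inj₁ x≈O         = x≈O
      ... | inj₂ (inj₁ x≈τ)  = contradiction (Image-resp h x≈τ x∈) τ∉
      ... | inj₂ (inj₂ x≈-τ) = contradiction
        (Image-resp h (≈-trans (∙-congʳ x≈-τ) (∙-involutiveʳ τ O)) (Image-∙ h x∈ (Image-O h))) τ∉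

      T-injective : ∀ {x y} → Image h x → Image h y → T x ≈ T y → x ≈ y
      T-injective {x} {y} x∈ y∈ eq = ≈-trans (≈-sym (⊕-⊖ x y))
        (≈-trans (∙-congʳ (∙-congˡ (kernel∩Image (Image-⊖ h x∈ y∈) (T^⊖≈O 1 eq)))) (∙-involutiveʳ y O))

      -- A flex is killed by `T`, and in the h-th image only O is; so McKay's congruence applies
      -- there.
      3∤image-size : 3 ∤ image-size h
      3∤image-size = 3∤size (Image? h) (Image-resp h) (Image-∙ h) (Image-O h) (λ x∈ fixed → kernel∩Image x∈
          (flex _ fixed))

      -- T x = T^(i+1) r for some r, so x and T^i r differ by an element of the kernel.
      ker⊆Image : ∀ j i → i + j ≤ h → ∀ {x} → T^ j x ≈ O → Image i x
      ker⊆Image zero    i _     x≈O = Image-resp i (≈-sym x≈O) (Image-O i)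
      ker⊆Image (suc j) i i+j<h {x} TʲTx≈O
        with r , Tⁱ⁺¹r≈Tx ← ker⊆Image j (suc i) (subst (_≤ h) (ℕ.+-suc i j) i+j<h)
               (≈-trans (≈-reflexive (T^-comm j 1 x)) TʲTx≈O)
        = Image-resp i (⊕-⊖ x (T^ i r)) (Image-⊕ i (r , ≈-refl)
            (kernel⊆Image i (τ∈ i (ℕ.<-≤-trans (ℕ.m<m+n i (s≤s z≤n)) i+j<h)) (T^⊖≈O 1 (≈-sym Tⁱ⁺¹r≈Tx))))

      T^-reaches : ∀ {i} P → h ≤ i → Image h (T^ i P)
      T^-reaches {i} P h≤i = Image-mono {h} {i} h≤i (P , ≈-refl)

      T^-kernel∩Image : ∀ d {x} → Image h x → T^ d x ≈ O → x ≈ O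
      T^-kernel∩Image zero    x∈ x≈O = x≈O
      T^-kernel∩Image (suc d) (r , p) eq =
        T^-kernel∩Image d (r , p) (kernel∩Image (T^ d r , ≈-trans (≈-reflexive (T^-comm h d r)) (T^-cong d p)) eq)

      T^-~-injective : ∀ d {x y} → Image h x → Image h y → T^ d x ~ T^ d y → x ~ y
      T^-~-injective zero    _  _  eq = eq
      T^-~-injective (suc d) {x} {y} (r , p) (s , q) eq = T^-~-injective d (r , p) (s , q) (cancel eq)
        where
        x∈ : Image h (T^ d x)
        x∈ = T^ d r , ≈-trans (≈-reflexive (T^-comm h d r)) (T^-cong d p)
        y∈ : Image h (T^ d y)
        y∈ = T^ d s , ≈-trans (≈-reflexive (T^-comm h d s)) (T^-cong d q)
        cancel : T (T^ d x) ~ T (T^ d y) → T^ d x ~ T^ d y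
        cancel (inj₁ eq) = inj₁ (T-injective x∈ y∈ eq)
        cancel (inj₂ eq) = inj₂ (T-injective x∈ (Image-∙ h y∈ (Image-O h)) (≈-trans eq (≈-sym (T-neg _))))

      -- If Tᵍ P = Tʰ R then P - T R is killed by Tᵍ. Since 1 + g = h, `ker⊆Image` places it in the
      -- first image, and P = T R + (P - T R) would lie there too.
      not-before : ∀ {g} → h ≡ suc g → ∀ {P} → ¬ Image 1 P → ¬ Image h (T^ g P)
      not-before {g} refl {P} P∉ (R , TʰR≈TᵍP) = P∉ (Image-resp 1 (⊕-⊖ P (T R)) (Image-⊕ 1 (R , ≈-refl)
        (ker⊆Image g 1 ℕ.≤-refl (T^⊖≈O g (≈-trans (≈-sym TʰR≈TᵍP) (≈-reflexive (T^-comm 1 g R)))))))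

      module Wandering {P : Carrier} (P∉ : ¬ Image 1 P) {g : ℕ} (h≡ : h ≡ suc g) (TʰP≉O : ¬ T^ h P ≈ O) where

        T^P≉O : ∀ i → ¬ T^ i P ≈ O
        T^P≉O i eq with ℕ.≤-total i h
        ... | inj₁ i≤h = TʰP≉O (T^-O-mono i≤h eq)
        ... | inj₂ h≤i = TʰP≉O (T^-kernel∩Image (i ℕ.∸ h) (P , ≈-refl)
          (≈-trans (≈-reflexive (≡.trans (≡.sym (T^-+ (i ℕ.∸ h) h P)) (cong (λ k → T^ k P) (ℕ.m∸n+n≡m h≤i)))) eq))

        -- A repetition starting at i ≤ g, pushed forward by g - i steps, would identify Tᵍ P up to
        -- sign with an iterate of index at least h, hence place it in the h-th image.
        no-early-repeat : ∀ {i j} → i < j → T^ i P ~ T^ j P → h ≤ i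
        no-early-repeat {i} {j} i<j eq with h ℕ.≤? i
        ... | yes h≤i = h≤i
        ... | no  h≰i = contradiction (Image-resp-~ {h} (~-sym T^gP~) (T^-reaches P late)) (not-before h≡ P∉)
          where
          i≤g : i ≤ g
          i≤g = ℕ.≤-pred (subst (suc i ≤_) h≡ (ℕ.≰⇒> h≰i))
          T^gP~ : T^ g P ~ T^ (g ℕ.∸ i + j) P
          T^gP~ = subst₂ _~_ (≡.trans (≡.sym (T^-+ (g ℕ.∸ i) i P)) (cong (λ k → T^ k P) (ℕ.m∸n+n≡m i≤g)))
                    (≡.sym (T^-+ (g ℕ.∸ i) j P)) (T^-~ (g ℕ.∸ i) eq)
          late : h ≤ g ℕ.∸ i + j
          late = subst (_≤ g ℕ.∸ i + j) (≡.trans (ℕ.+-suc _ i) (≡.trans (cong suc (ℕ.m∸n+n≡m i≤g)) (≡.sym h≡)))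
              (ℕ.+-monoʳ-≤ (g ℕ.∸ i) i<j)

        -- Tripling is injective up to sign on the h-th image, so the i - h steps common to both
        -- sides cancel.
        back-to-h : ∀ {i j} → i < j → T^ i P ~ T^ j P → T^ h P ~ T^ (h + (j ℕ.∸ i)) P
        back-to-h {i} {j} i<j eq = T^-~-injective (i ℕ.∸ h) (P , ≈-refl) (T^-reaches P (ℕ.m≤m+n h _))
          (subst₂ _~_ (at i (ℕ.m∸n+n≡m h≤i)) (at j shift) eq)
          where
          h≤i = no-early-repeat i<j eq
          at : ∀ k {l} → (i ℕ.∸ h) + l ≡ k → T^ k P ≡ T^ (i ℕ.∸ h) (T^ l P)
          at k {l} eq = ≡.trans (cong (λ k → T^ k P) (≡.sym eq)) (T^-+ (i ℕ.∸ h) l P)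
          shift : (i ℕ.∸ h) + (h + (j ℕ.∸ i)) ≡ j
          shift = ≡.trans (≡.sym (ℕ.+-assoc (i ℕ.∸ h) h _)) (≡.trans (cong (ℕ._+ (j ℕ.∸ i)) (ℕ.m∸n+n≡m h≤i))
              (ℕ.m+[n∸m]≡n (ℕ.<⇒≤ i<j)))

        Returns : ℕ → Set _
        Returns r = 1 ≤ r × T^ h P ~ T^ (h + r) P

        -- Among n + 1 iterates two coincide; moved back to index h, this coincidence bounds the
        -- search for the least return.
        first-return : ∃ λ r → Returns r × (∀ i → i < r → ¬ Returns i)
        first-return with i , j , i<j , eq ← Fin.pigeonhole (ℕ.n<1+n n) (λ (i : Fin (suc n)) → index (T^ (toℕ i) P))
          with least (λ r → 1 ℕ.≤? r ×-dec T^ h P ~? T^ (h + r) P) (suc (toℕ j ℕ.∸ toℕ i))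
        ... | inj₂ found = found
        ... | inj₁ none = contradiction
          (ℕ.m<n⇒0<n∸m i<j , back-to-h i<j (inj₁ (index-injective eq))) (none (toℕ j ℕ.∸ toℕ i) ℕ.≤-refl)

        cycles : Cycles P h
        cycles with r , (1≤r , ret) , minimal ← first-return =
          T^P≉O , r , 1≤r , ret , λ i j i<j j<h+r eq →
            minimal (j ℕ.∸ i) (shorter (no-early-repeat i<j eq) i<j j<h+r) (ℕ.m<n⇒0<n∸m i<j , back-to-h i<j eq)
          where
          shorter : ∀ {i j r} → h ≤ i → i < j → j < h + r → j ℕ.∸ i < r
          shorter {i} {j} {r} h≤i i<j j<h+r = ℕ.+-cancelˡ-< h _ _ (ℕ.≤-<-trans
            (ℕ.≤-trans (ℕ.+-monoˡ-≤ _ h≤i) (ℕ.≤-reflexive (ℕ.m+[n∸m]≡n (ℕ.<⇒≤ i<j)))) j<h+r)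

    depth-of-orbit : ∀ P → ¬ Image 1 P →
      ∃ λ h → (∃ λ s → n ≡ 3 ^ h * s × 3 ∤ s) × (Terminates P h ⊎ Cycles P h)
    depth-of-orbit P P∉ with depth
    -- The zeroth image is everything, so the depth is positive.
    ... | zero  , τ∉ , _  = contradiction (τ , ≈-refl) τ∉
    ... | suc g , τ∉ , τ∈ = suc g , (image-size (suc g) , size-factor (suc g) τ∈ , 3∤image-size) , behaviour (T^
        (suc g) P ≟ O)
      where
      open AtDepth (suc g) τ∉ τ∈
      behaviour : Dec (T^ (suc g) P ≈ O) → Terminates P (suc g) ⊎ Cycles P (suc g)
      behaviour (yes eq)  = inj₁ (g , refl , (λ TᵍP≈O → not-before refl P∉ (Image-resp (suc g) (≈-sym TᵍP≈O)
          (Image-O (suc g)))) , eq)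
      behaviour (no  neq) = inj₂ (Wandering.cycles P∉ refl neq)

open Loops

-- Polynomial identities in characteristic 3.

data 𝔽₃ : Set where
  𝟘 𝟙 𝟚 : 𝔽₃

𝔽₃-rawRing : RawRing 0ℓ 0ℓ
𝔽₃-rawRing = record
  { Carrier = 𝔽₃ ; _≈_ = _≡_ ; _+_ = _⊞_ ; _*_ = _⊠_ ; -_ = ⊟_ ; 0# = 𝟘 ; 1# = 𝟙 }
  where
  _⊞_ : 𝔽₃ → 𝔽₃ → 𝔽₃
  𝟘 ⊞ y = y
  𝟙 ⊞ 𝟘 = 𝟙
  𝟙 ⊞ 𝟙 = 𝟚
  𝟙 ⊞ 𝟚 = 𝟘
  𝟚 ⊞ 𝟘 = 𝟚
  𝟚 ⊞ 𝟙 = 𝟘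
  𝟚 ⊞ 𝟚 = 𝟙
  ⊟_ : 𝔽₃ → 𝔽₃
  ⊟ 𝟘 = 𝟘
  ⊟ 𝟙 = 𝟚
  ⊟ 𝟚 = 𝟙
  _⊠_ : 𝔽₃ → 𝔽₃ → 𝔽₃
  𝟘 ⊠ y = 𝟘
  𝟙 ⊠ y = y
  𝟚 ⊠ y = ⊟ y

-- Coefficients in 𝔽₃ let normalisation prove identities that fail over the integers, such as
-- additivity of cubing.
module Char3Solver {c ℓ : Level} (R : CommutativeRing c ℓ)
  (characteristic : CommutativeRing._≈_ R
     (CommutativeRing._+_ R (CommutativeRing.1# R) (CommutativeRing._+_ R (CommutativeRing.1# R)
       (CommutativeRing._+_ R (CommutativeRing.1# R) (CommutativeRing.0# R)))) (CommutativeRing.0# R)) where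

  open CommutativeRing R
  open RingProperties ring using (-0#≈0#; -‿involutive; -1*x≈-x)
  open AbelianGroupProperties +-abelianGroup using (inverseʳ-unique)

  private
    value : 𝔽₃ → Carrier
    value 𝟘 = 0#
    value 𝟙 = 1#
    value 𝟚 = - 1#

    1+1≈-1 : 1# + 1# ≈ - 1#
    1+1≈-1 = inverseʳ-unique _ _ (trans (+-congˡ (+-congˡ (sym (+-identityʳ 1#)))) characteristic)

    -1-1≈1 : - 1# + - 1# ≈ 1#
    -1-1≈1 = trans (+-congʳ (sym 1+1≈-1)) (trans (+-assoc _ _ _) (trans (+-congˡ (-‿inverseʳ 1#)) (+-identityʳ 1#)))

    morphism : 𝔽₃-rawRing -Raw-AlmostCommutative⟶ fromCommutativeRing R
    morphism = record
      { ⟦_⟧ = value ; +-homo = +-homo ; *-homo = *-homo ; -‿homo = -‿homo ; 0-homo = refl ; 1-homo = refl }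
      where
      open RawRing 𝔽₃-rawRing using () renaming (_+_ to _⊞_; _*_ to _⊠_; -_ to ⊟_)
      +-homo : ∀ x y → value (x ⊞ y) ≈ value x + value y
      +-homo 𝟘 y = sym (+-identityˡ _)
      +-homo 𝟙 𝟘 = sym (+-identityʳ _)
      +-homo 𝟙 𝟙 = sym 1+1≈-1
      +-homo 𝟙 𝟚 = sym (-‿inverseʳ 1#)
      +-homo 𝟚 𝟘 = sym (+-identityʳ _)
      +-homo 𝟚 𝟙 = sym (-‿inverseˡ 1#)
      +-homo 𝟚 𝟚 = sym -1-1≈1
      -‿homo : ∀ x → value (⊟ x) ≈ - value x
      -‿homo 𝟘 = sym -0#≈0#
      -‿homo 𝟙 = refl
      -‿homo 𝟚 = sym (-‿involutive 1#)
      *-homo : ∀ x y → value (x ⊠ y) ≈ value x * value y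
      *-homo 𝟘 y = sym (zeroˡ _)
      *-homo 𝟙 y = sym (*-identityˡ _)
      *-homo 𝟚 y = trans (-‿homo y) (sym (-1*x≈-x _))

    _≟_ : ∀ x y → Maybe (value x ≈ value y)
    𝟘 ≟ 𝟘 = just refl
    𝟙 ≟ 𝟙 = just refl
    𝟚 ≟ 𝟚 = just refl
    _ ≟ _ = nothing

  open RingSolver 𝔽₃-rawRing (fromCommutativeRing R) morphism _≟_ public
    using (solve; _:=_; _:+_; _:*_; _:-_; :-_; _:^_; con)

-- Arithmetic of the field with 3ᵐ elements.

module TernaryField {c ℓ : Level} (m : ℕ) (0<m : 0 ℕ.< m) (F : FiniteField c ℓ (3 ℕ.^ m)) where
  open FiniteField F public hiding (zero; sum; _≟_)
  open Ternary m F public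
  open Char3Solver commutativeRing characteristic public
  open Exp semiring public using (^-congˡ; ^-assocʳ)
  open RingProperties ring public using (-0#≈0#; -‿involutive; x+x≈x⇒x≈0)
  open GroupProperties +-group public using () renaming
      (∙-cancelˡ to +-cancelˡ; ∙-cancelʳ to +-cancelʳ; x∙y⁻¹≈ε⇒x≈y to x-y≈0⇒x≈y)

  q : ℕ
  q = 3 ℕ.^ m

  open FiniteSetoid setoid q enumeration public hiding (index; element; element-index; index-element; index-cong)

  module ≈-Reasoning = SetoidReasoning setoid

  x≈y⇒x-y≈0 : ∀ {x y} → x ≈ y → x - y ≈ 0#
  x≈y⇒x-y≈0 {x} {y} eq = trans (+-congʳ eq) (-‿inverseʳ y)

  *-cancelˡ-nonzero : ∀ x {y z} → x ≉ 0# → x * y ≈ x * z → y ≈ z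
  *-cancelˡ-nonzero x {y} {z} x≉0 eq with x′ , xx′≈1 ← inverse x x≉0 = begin
    y            ≈⟨ *-identityˡ y ⟨
    1# * y       ≈⟨ *-congʳ (trans (*-comm x′ x) xx′≈1) ⟨
    x′ * x * y   ≈⟨ *-assoc _ _ _ ⟩
    x′ * (x * y) ≈⟨ *-congˡ eq ⟩
    x′ * (x * z) ≈⟨ *-assoc _ _ _ ⟨
    x′ * x * z   ≈⟨ *-congʳ (trans (*-comm x′ x) xx′≈1) ⟩
    1# * z       ≈⟨ *-identityˡ z ⟩
    z            ∎
    where open ≈-Reasoning

  xy≈0⇒x≈0∨y≈0 : ∀ {x y} → x * y ≈ 0# → x ≈ 0# ⊎ y ≈ 0#
  xy≈0⇒x≈0∨y≈0 {x} {y} xy≈0 with x ≟ 0#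
  ... | yes x≈0 = inj₁ x≈0
  ... | no  x≉0 = inj₂ (*-cancelˡ-nonzero x x≉0 (trans xy≈0 (sym (zeroʳ x))))

  x^n≉0 : ∀ {x} n → x ≉ 0# → x ^ n ≉ 0#
  x^n≉0 zero    x≉0 = 1≉0
  x^n≉0 (suc n) x≉0 eq = [ x≉0 , x^n≉0 n x≉0 ]′ (xy≈0⇒x≈0∨y≈0 eq)

  x²≈0⇒x≈0 : ∀ {x} → x ^ 2 ≈ 0# → x ≈ 0#
  x²≈0⇒x≈0 {x} eq with x ≟ 0#
  ... | yes x≈0 = x≈0
  ... | no  x≉0 = contradiction eq (x^n≉0 2 x≉0)

  -1≉1 : - 1# ≉ 1#
  -1≉1 eq = 1≉0 (trans (solve 0 (con 𝟙 := :- con 𝟙 :- con 𝟙) refl) (x≈y⇒x-y≈0 eq))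

  x≈-x⇒x≈0 : ∀ {x} → x ≈ - x → x ≈ 0#
  x≈-x⇒x≈0 {x} eq = trans (solve 1 (λ x → x := :- x :- x) refl x) (trans (+-congʳ (sym eq)) (-‿inverseʳ x))

  x²≈y²⇒x≈±y : ∀ {x y} → x ^ 2 ≈ y ^ 2 → x ≈ y ⊎ x ≈ - y
  x²≈y²⇒x≈±y {x} {y} eq with xy≈0⇒x≈0∨y≈0 {x - y} {x + y}
    (trans (solve 2 (λ x y → (x :- y) :* (x :+ y) := x :^ 2 :- y :^ 2) refl x y) (x≈y⇒x-y≈0 eq))
  ... | inj₁ eq₁ = inj₁ (x-y≈0⇒x≈y x y eq₁)
  ... | inj₂ eq₂ = inj₂ (x-y≈0⇒x≈y x (- y) (trans (+-congˡ (-‿involutive y)) eq₂))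

  private
    module Π = CommutativeMonoidSum *-commutativeMonoid

    Π-point : ∀ {n} (φ : Fin n → Carrier) i → (∀ j → j ≢ i → φ j ≈ 1#) → Π.sum φ ≈ φ i
    Π-point {suc n} φ i φ≈1 = trans (Π.sum-remove {i = i} φ)
      (trans (*-congˡ (trans (Π.sum-cong-≋ (λ j → φ≈1 (punchIn i j) (Fin.punchInᵢ≢i i j))) (Π.sum-replicate-zero n)))
        (*-identityʳ (φ i)))

    -- Replacing 0 by 1 lets the product of the nonzero elements run over the whole field.
    unit : ∀ {x} → Dec (x ≈ 0#) → Carrier
    unit {x} (yes _) = 1#
    unit {x} (no _)  = x

    unit≉0 : ∀ {x} (x? : Dec (x ≈ 0#)) → unit x? ≉ 0#
    unit≉0 (yes _) = 1≉0
    unit≉0 (no ne) = ne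

    unit-cong : ∀ {x y} (x? : Dec (x ≈ 0#)) (y? : Dec (y ≈ 0#)) → x ≈ y → unit x? ≈ unit y?
    unit-cong (yes _) (yes _) eq = refl
    unit-cong (no _)  (no _)  eq = eq
    unit-cong (yes x≈0) (no y≉0) eq = contradiction (trans (sym eq) x≈0) y≉0
    unit-cong (no x≉0) (yes y≈0) eq = contradiction (trans eq y≈0) x≉0

    Π≉0 : ∀ {n} (φ : Fin n → Carrier) → (∀ i → φ i ≉ 0#) → Π.sum φ ≉ 0#
    Π≉0 {zero}  φ φ≉0 = 1≉0
    Π≉0 {suc n} φ φ≉0 eq = [ φ≉0 zero , Π≉0 (φ ∘ suc) (φ≉0 ∘ suc) ]′ (xy≈0⇒x≈0∨y≈0 eq)

  -- Compare the product of all x ≠ 0 with the product of all c x; the factor at x = 0 is c.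
  x^q≈x : ∀ x → x ^ q ≈ x
  x^q≈x x with x ≟ 0#
  ... | yes x≈0 = trans (^-congˡ q x≈0) (trans (0^q≈0 (3 ℕ.^ m) (ℕ.m^n>0 3 m)) (sym x≈0))
    where
    0^q≈0 : ∀ n → 0 ℕ.< n → 0# ^ n ≈ 0#
    0^q≈0 (suc n) _ = zeroˡ _
  ... | no x≉0 with x′ , xx′≈1 ← inverse x x≉0 = sym (*-cancelˡ-nonzero P P≉0 (begin
    P * x                                          ≈⟨ *-cong (Π.sum-permute u π) (sym Πδ≈x) ⟩
    Π.sum (λ i → u (π ⟨$⟩ʳ i)) * Π.sum δ           ≈⟨ Π.∑-distrib-+ (λ i → u (π ⟨$⟩ʳ i)) δ ⟨
    Π.sum (λ i → u (π ⟨$⟩ʳ i) * δ i)               ≈⟨ Π.sum-cong-≋ (λ i → factor i (element i ≟ 0#)) ⟩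
    Π.sum (λ i → x * u i)                          ≈⟨ Π.∑-distrib-+ (λ _ → x) u ⟩
    Π.sum {q} (λ _ → x) * P                        ≈⟨ *-congʳ (Π.sum-replicate q) ⟩
    x ^ q * P                                      ≈⟨ *-comm _ _ ⟩
    P * x ^ q                                      ∎))
    where
    open ≈-Reasoning
    u : Fin q → Carrier
    u i = unit (element i ≟ 0#)
    P = Π.sum u
    P≉0 : P ≉ 0#
    P≉0 = Π≉0 u (λ i → unit≉0 (element i ≟ 0#))
    cancel : ∀ y z → y * z ≈ 1# → ∀ w → y * (z * w) ≈ w
    cancel y z yz≈1 w = trans (sym (*-assoc y z w)) (trans (*-congʳ yz≈1) (*-identityˡ w))
    π = conjugate (x *_) (x′ *_) *-congˡ *-congˡ (cancel x x′ xx′≈1) (cancel x′ x (trans (*-comm x′ x) xx′≈1))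
    pick : ∀ {i} → Dec (element i ≈ 0#) → Carrier
    pick (yes _) = x
    pick (no _)  = 1#
    δ : Fin q → Carrier
    δ i = pick (element i ≟ 0#)
    pick-yes : ∀ {i} (i? : Dec (element i ≈ 0#)) → element i ≈ 0# → pick i? ≈ x
    pick-yes (yes _) _ = refl
    pick-yes (no ne) eq = contradiction eq ne
    pick-no : ∀ {i} (i? : Dec (element i ≈ 0#)) → element i ≉ 0# → pick i? ≈ 1#
    pick-no (yes eq) ne = contradiction eq ne
    pick-no (no _)  _ = refl
    Πδ≈x : Π.sum δ ≈ x
    Πδ≈x = trans (Π-point δ (index 0#) λ i i≢ → pick-no (element i ≟ 0#)
                    λ eq → i≢ (≡.trans (≡.sym (index-element i)) (index-cong eq)))
                 (pick-yes (element (index 0#) ≟ 0#) (element-index 0#))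
    factor : ∀ i → (i? : Dec (element i ≈ 0#)) → u (π ⟨$⟩ʳ i) * pick i? ≈ x * unit i?
    factor i (yes ei≈0) = trans (*-congʳ (unit-cong (element (π ⟨$⟩ʳ i) ≟ 0#) (yes refl)
      (trans (element-index _) (trans (*-congˡ ei≈0) (zeroʳ x))))) (*-comm 1# x)
    factor i (no ei≉0) = trans (*-identityʳ _) (unit-cong (element (π ⟨$⟩ʳ i) ≟ 0#)
      (no λ eq → [ x≉0 , ei≉0 ]′ (xy≈0⇒x≈0∨y≈0 eq)) (element-index _))

  _⁻¹ : Carrier → Carrier
  x ⁻¹ = x ⁻^ 1

  infix 8 _⁻¹

  ⁻¹-cong : ∀ {x y} → x ≈ y → x ⁻¹ ≈ y ⁻¹
  ⁻¹-cong = ^-congˡ (q ∸ 1 ∸ 1)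

  q≡2+ : q ≡ suc (suc (q ∸ 1 ∸ 1))
  q≡2+ = ≡.sym (≡.trans (≡.cong suc (ℕ.+-comm 1 (q ∸ 1 ∸ 1))) (≡.trans (≡.cong suc (ℕ.m∸n+n≡m 1≤q-1)) (≡.trans
      (ℕ.+-comm 1 _) (ℕ.m∸n+n≡m (ℕ.≤-trans (ℕ.s≤s ℕ.z≤n) 3≤q)))))
    where
    3≤q : 3 ℕ.≤ q
    3≤q = ℕ.^-monoʳ-≤ 3 0<m
    1≤q-1 : 1 ℕ.≤ q ∸ 1
    1≤q-1 = ℕ.∸-monoˡ-≤ 1 (ℕ.≤-trans (ℕ.s≤s (ℕ.s≤s ℕ.z≤n)) 3≤q)

  *-inverse : ∀ {x} → x ≉ 0# → x * x ⁻¹ ≈ 1#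
  *-inverse {x} x≉0 = *-cancelˡ-nonzero x x≉0
    (trans (reflexive (≡.cong (x ^_) (≡.sym q≡2+))) (trans (x^q≈x x) (sym (*-identityʳ x))))

  -- The exponent q - 2 is positive because q ≥ 3.
  0⁻¹≈0 : 0# ⁻¹ ≈ 0#
  0⁻¹≈0 = trans (reflexive (≡.cong (0# ^_) q-2≡1+)) (zeroˡ _)
    where
    q-2≡1+ : q ∸ 1 ∸ 1 ≡ suc (q ∸ 3)
    q-2≡1+ = ≡.trans (ℕ.∸-+-assoc q 1 1) (≡.trans (≡.sym (ℕ.m∸n+n≡m {q ∸ 2} {1} (ℕ.∸-monoˡ-≤ 2
        (ℕ.^-monoʳ-≤ 3 {1} 0<m))))
      (≡.trans (ℕ.+-comm (q ∸ 2 ∸ 1) 1) (≡.cong suc (ℕ.∸-+-assoc q 2 1))))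

  ⁻¹-unique : ∀ {x y} → x * y ≈ 1# → y ≈ x ⁻¹
  ⁻¹-unique {x} {y} xy≈1 = *-cancelˡ-nonzero x x≉0 (trans xy≈1 (sym (*-inverse x≉0)))
    where
    x≉0 : x ≉ 0#
    x≉0 x≈0 = 1≉0 (trans (sym xy≈1) (trans (*-congʳ x≈0) (zeroˡ y)))

-- Trace, additive Hilbert 90 and square roots.

module TraceTheory {c ℓ : Level} (m : ℕ) (0<m : 0 ℕ.< m) (F : FiniteField c ℓ (3 ℕ.^ m)) where
  open TernaryField m 0<m F
  private module Additive = CommutativeMonoidSum +-commutativeMonoid

  cube-+ : ∀ x y → (x + y) ^ 3 ≈ x ^ 3 + y ^ 3
  cube-+ = solve 2 (λ x y → (x :+ y) :^ 3 := x :^ 3 :+ y :^ 3) refl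

  ^3^-suc : ∀ x i → x ^ (3 ℕ.^ suc i) ≈ (x ^ (3 ℕ.^ i)) ^ 3
  ^3^-suc x i = trans (reflexive (≡.cong (x ^_) (ℕ.*-comm 3 (3 ℕ.^ i)))) (sym (^-assocʳ x (3 ℕ.^ i) 3))

  ^3^-+ : ∀ i x y → (x + y) ^ (3 ℕ.^ i) ≈ x ^ (3 ℕ.^ i) + y ^ (3 ℕ.^ i)
  ^3^-+ zero    x y = solve 2 (λ x y → (x :+ y) :^ 1 := x :^ 1 :+ y :^ 1) refl x y
  ^3^-+ (suc i) x y = trans (^3^-suc (x + y) i) (trans (^-congˡ 3 (^3^-+ i x y))
    (trans (cube-+ _ _) (+-cong (sym (^3^-suc x i)) (sym (^3^-suc y i)))))

  Tr-cong : ∀ {x y} → x ≈ y → Tr x ≈ Tr y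
  Tr-cong eq = Additive.sum-cong-≋ {m} (λ i → ^-congˡ (3 ℕ.^ toℕ i) eq)

  Tr-+ : ∀ x y → Tr (x + y) ≈ Tr x + Tr y
  Tr-+ x y = trans (Additive.sum-cong-≋ {m} (λ i → ^3^-+ (toℕ i) x y)) (Additive.∑-distrib-+ {m} _ _)

  Tr0≈0 : Tr 0# ≈ 0#
  Tr0≈0 = x+x≈x⇒x≈0 (Tr 0#) (trans (sym (Tr-+ 0# 0#)) (Tr-cong (+-identityˡ 0#)))

  Tr-neg : ∀ x → Tr (- x) ≈ - Tr x
  Tr-neg x = +-cancelˡ (Tr x) _ _ (trans (sym (Tr-+ x (- x)))
    (trans (Tr-cong (-‿inverseʳ x)) (trans Tr0≈0 (sym (-‿inverseʳ (Tr x))))))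

  private
    telescope : ∀ n (g : ℕ → Carrier) → Additive.sum {n} (g ∘ suc ∘ toℕ) + g 0 ≈ Additive.sum {n} (g ∘ toℕ) + g n
    telescope zero    g = refl
    telescope (suc n) g = trans (swap _ _ _) (trans (+-congˡ (telescope n (g ∘ suc))) (sym (+-assoc _ _ _)))
      where
      swap : ∀ x y z → x + y + z ≈ z + (y + x)
      swap = solve 3 (λ x y z → x :+ y :+ z := z :+ (y :+ x)) refl

    sum-cube : ∀ {n} (f : Fin n → Carrier) → Additive.sum f ^ 3 ≈ Additive.sum (λ i → f i ^ 3)
    sum-cube {zero}  f = zeroˡ _
    sum-cube {suc n} f = trans (cube-+ _ _) (+-congˡ (sum-cube (f ∘ suc)))

    Tr³ : ∀ x → Tr x ^ 3 ≈ Additive.sum {m} (λ i → x ^ (3 ℕ.^ suc (toℕ i)))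
    Tr³ x = trans (sum-cube {m} _) (Additive.sum-cong-≋ {m} (λ i → sym (^3^-suc x (toℕ i))))

  -- Cubing shifts the conjugates by one; the two sums telescope and differ by x^q - x = 0.
  Tr³≈Tr : ∀ x → Tr x ^ 3 ≈ Tr x
  Tr³≈Tr x = +-cancelʳ x _ _ (trans (+-cong (Tr³ x) (sym (*-identityʳ x)))
    (trans (telescope m (λ i → x ^ (3 ℕ.^ i))) (+-congˡ (x^q≈x x))))

  Tr-cube : ∀ x → Tr (x ^ 3) ≈ Tr x
  Tr-cube x = trans (Additive.sum-cong-≋ {m} (λ i → ^-assocʳ x 3 (3 ℕ.^ toℕ i))) (trans (sym (Tr³ x)) (Tr³≈Tr x))

  -- The Artin-Schreier map, whose image turns out to be the kernel of the trace.
  ℘ : Carrier → Carrier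
  ℘ z = z ^ 3 - z

  ℘-cong : ∀ {x y} → x ≈ y → ℘ x ≈ ℘ y
  ℘-cong eq = +-cong (^-congˡ 3 eq) (-‿cong eq)

  Tr-℘ : ∀ z → Tr (℘ z) ≈ 0#
  Tr-℘ z = trans (Tr-+ _ _) (trans (+-cong (Tr-cube z) (Tr-neg z)) (-‿inverseʳ _))

  cube-fixed : ∀ {t} → t ^ 3 ≈ t → t ≈ 0# ⊎ t ≈ 1# ⊎ t ≈ - 1#
  cube-fixed {t} eq with xy≈0⇒x≈0∨y≈0 {t} {(t - 1#) * (t + 1#)}
    (trans (solve 1 (λ t → t :* ((t :- con 𝟙) :* (t :+ con 𝟙)) := t :^ 3 :- t) refl t) (x≈y⇒x-y≈0 eq))
  ... | inj₁ t≈0 = inj₁ t≈0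
  ... | inj₂ eq′ with xy≈0⇒x≈0∨y≈0 eq′
  ...   | inj₁ e = inj₂ (inj₁ (x-y≈0⇒x≈y t 1# e))
  ...   | inj₂ e = inj₂ (inj₂ (x-y≈0⇒x≈y t (- 1#) (trans (+-congˡ (-‿involutive 1#)) e)))

  Tr-values : ∀ x → Tr x ≈ 0# ⊎ Tr x ≈ 1# ⊎ Tr x ≈ - 1#
  Tr-values x = cube-fixed (Tr³≈Tr x)

  1≉-1 : 1# ≉ - 1#
  1≉-1 eq = -1≉1 (sym eq)

  -1≉0 : - 1# ≉ 0#
  -1≉0 eq = 1≉0 (trans (sym (-‿involutive 1#)) (trans (-‿cong eq) -0#≈0#))

  exactly-one-value : ∀ {t} → t ≈ 0# ⊎ t ≈ 1# ⊎ t ≈ - 1# → (0? : Dec (t ≈ 0#)) (1? : Dec (t ≈ 1#)) (2? : Dec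
      (t ≈ - 1#)) →
                      ⟦ 0? ⟧ ℕ.+ ⟦ 1? ⟧ ℕ.+ ⟦ 2? ⟧ ≡ 1
  exactly-one-value {t} v 0? 1? 2? with v
  ... | inj₁ e = ≡.cong₂ ℕ._+_ (≡.cong₂ ℕ._+_ (⟦⟧-yes 0? e) (⟦⟧-no 1? λ e′ → 1≉0 (trans (sym e′) e)))
      (⟦⟧-no 2? λ e′ → -1≉0 (trans (sym e′) e))
  ... | inj₂ (inj₁ e) = ≡.cong₂ ℕ._+_ (≡.cong₂ ℕ._+_ (⟦⟧-no 0? λ e′ → 1≉0 (trans (sym e) e′)) (⟦⟧-yes 1? e))
      (⟦⟧-no 2? λ e′ → 1≉-1 (trans (sym e) e′))
  ... | inj₂ (inj₂ e) = ≡.cong₂ ℕ._+_ (≡.cong₂ ℕ._+_ (⟦⟧-no 0? λ e′ → -1≉0 (trans (sym e) e′))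
      (⟦⟧-no 1? λ e′ → -1≉1 (trans (sym e) e′))) (⟦⟧-yes 2? e)

  ≟-cong : ∀ {x y u v} → x ≈ y → u ≈ v → ⟦ x ≟ u ⟧ ≡ ⟦ y ≟ v ⟧
  ≟-cong {x} {y} {u} {v} x≈y u≈v = ⟦⟧-⇔ (x ≟ u) (y ≟ v)
    (λ e → trans (sym x≈y) (trans e u≈v)) (λ e → trans x≈y (trans e (sym u≈v)))

  ∑-translate : ∀ {φ} → Cong φ → ∀ d → ∑ (λ x → φ (x + d)) ≡ ∑ φ
  ∑-translate φ-cong d = ∑-permute φ-cong (_+ d) (_- d) +-congʳ +-congʳ
    (λ x → solve 2 (λ x d → x :- d :+ d := x) refl x d) (λ x → solve 2 (λ x d → x :+ d :- d := x) refl x d)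

  ∑-scale : ∀ {φ} → Cong φ → ∀ {d} → d ≉ 0# → ∑ (λ x → φ (d * x)) ≡ ∑ φ
  ∑-scale φ-cong {d} d≉0 = ∑-permute φ-cong (d *_) (d ⁻¹ *_) *-congˡ *-congˡ
    (cancel (*-inverse d≉0)) (cancel (trans (*-comm _ _) (*-inverse d≉0)))
    where
    cancel : ∀ {y z} → y * z ≈ 1# → ∀ w → y * (z * w) ≈ w
    cancel yz≈1 w = trans (sym (*-assoc _ _ w)) (trans (*-congʳ yz≈1) (*-identityˡ w))

  -- Both sides sum to q over w, and ≤ holds termwise.
  ℘-fibre : ∀ {θ} → Tr θ ≉ 0# → ∀ w → ∑ (λ z → ⟦ ℘ z ≟ w ⟧) ≡ 3 ℕ.* ⟦ Tr w ≟ 0# ⟧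
  ℘-fibre {θ} Trθ≉0 = ∑-tight (λ eq → ∑-cong λ z → ≟-cong refl eq) (λ eq → ≡.cong (3 ℕ.*_) (≟-cong (Tr-cong eq) refl))
    (λ w → fibre-≤ w (Tr w ≟ 0#)) (≡.trans ∑-fibres (≡.sym ∑-traces))
    where
    -- Up to sign θ has trace 1. Translation by η and -η then matches the three level sets of the
    -- trace, so each contains a third of the field.
    θ₁ : ∃ λ η → Tr η ≈ 1#
    θ₁ with Tr-values θ
    ... | inj₁ e = contradiction e Trθ≉0
    ... | inj₂ (inj₁ e) = θ , e
    ... | inj₂ (inj₂ e) = - θ , trans (Tr-neg θ) (trans (-‿cong e) (-‿involutive 1#))
    η = proj₁ θ₁
    Trη≈1 = proj₂ θ₁
    open ≡.≡-Reasoning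
    shift : ∀ d → ∑ (λ w → ⟦ Tr w ≟ Tr d ⟧) ≡ ∑ (λ w → ⟦ Tr w ≟ 0# ⟧)
    shift d = ≡.trans (≡.sym (∑-translate (λ e → ≟-cong (Tr-cong e) refl) d)) (∑-cong λ w → ⟦⟧-⇔ (Tr
        (w + d) ≟ Tr d) (Tr w ≟ 0#)
      (λ e → +-cancelʳ (Tr d) _ _ (trans (sym (Tr-+ w d)) (trans e (sym (+-identityˡ _)))))
      (λ e → trans (Tr-+ w d) (trans (+-congʳ e) (+-identityˡ _))))
    zeros = ∑ (λ w → ⟦ Tr w ≟ 0# ⟧)
    ∑-traces : ∑ (λ w → 3 ℕ.* ⟦ Tr w ≟ 0# ⟧) ≡ q
    ∑-traces = begin
      ∑ (λ w → 3 ℕ.* ⟦ Tr w ≟ 0# ⟧)  ≡⟨ ∑-*ˡ 3 _ ⟨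
      zeros ℕ.+ (zeros ℕ.+ (zeros ℕ.+ 0))  ≡⟨ ≡.cong (λ k → zeros ℕ.+ (zeros ℕ.+ k)) (ℕ.+-identityʳ zeros) ⟩
      zeros ℕ.+ (zeros ℕ.+ zeros)  ≡⟨ ℕ.+-assoc zeros zeros zeros ⟨
      zeros ℕ.+ zeros ℕ.+ zeros
        ≡⟨ ≡.cong₂ ℕ._+_ (≡.cong (zeros ℕ.+_) (≡.trans (≡.sym (shift η)) (∑-cong λ w → ≟-cong refl Trη≈1)))
             (≡.trans (≡.sym (shift (- η))) (∑-cong λ w → ≟-cong refl (trans (Tr-neg η) (-‿cong Trη≈1)))) ⟩
      zeros ℕ.+ ∑ (λ w → ⟦ Tr w ≟ 1# ⟧) ℕ.+ ∑ (λ w → ⟦ Tr w ≟ - 1# ⟧)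
        ≡⟨ ≡.trans (∑-+ _ _) (≡.cong (ℕ._+ ∑ (λ w → ⟦ Tr w ≟ - 1# ⟧)) (∑-+ _ _)) ⟨
      ∑ (λ w → ⟦ Tr w ≟ 0# ⟧ ℕ.+ ⟦ Tr w ≟ 1# ⟧ ℕ.+ ⟦ Tr w ≟ - 1# ⟧)
        ≡⟨ ∑-cong (λ w → exactly-one-value (Tr-values w) (Tr w ≟ 0#) (Tr w ≟ 1#) (Tr w ≟ - 1#)) ⟩
      ∑ (λ _ → 1) ≡⟨ ≡.trans (∑-const 1) (ℕ.*-identityʳ q) ⟩
      q ∎
    ∑-fibres : ∑ (λ w → ∑ (λ z → ⟦ ℘ z ≟ w ⟧)) ≡ q
    ∑-fibres = ≡.trans (∑-swap _) (≡.trans (∑-cong λ z → ≡.trans (∑-cong λ w → ⟦⟧-⇔ (℘ z ≟ w) (w ≟ ℘ z) sym sym)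
        (∑-indicator (℘ z)))
      (≡.trans (∑-const 1) (ℕ.*-identityʳ q)))
    -- ℘ is additive with kernel 𝔽₃, so a nonempty fibre consists of z₀, z₀ + 1 and z₀ - 1.
    roots : ∀ z₀ → ∑ (λ z → ⟦ ℘ z ≟ ℘ z₀ ⟧) ≡ 3
    roots z₀ = begin
      ∑ (λ z → ⟦ ℘ z ≟ ℘ z₀ ⟧)
        ≡⟨ ∑-cong (λ z → ≡.trans (≡.sym (ℕ.*-identityʳ _)) (at z (℘ z ≟ ℘ z₀) (z ≟ z₀) (z ≟ (z₀ + 1#)) (z ≟
            (z₀ - 1#)))) ⟩
      ∑ (λ z → ⟦ z ≟ z₀ ⟧ ℕ.+ ⟦ z ≟ (z₀ + 1#) ⟧ ℕ.+ ⟦ z ≟ (z₀ - 1#) ⟧)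
        ≡⟨ ≡.trans (∑-+ _ _) (≡.cong (ℕ._+ ∑ (λ z → ⟦ z ≟ (z₀ - 1#) ⟧)) (∑-+ _ _)) ⟩
      ∑ (λ z → ⟦ z ≟ z₀ ⟧) ℕ.+ ∑ (λ z → ⟦ z ≟ (z₀ + 1#) ⟧) ℕ.+ ∑ (λ z → ⟦ z ≟ (z₀ - 1#) ⟧)
        ≡⟨ ≡.cong₂ ℕ._+_ (≡.cong₂ ℕ._+_ (∑-indicator _) (∑-indicator _)) (∑-indicator _) ⟩
      3 ∎
      where
      d≈ : ∀ {z d} → z - z₀ ≈ d → z ≈ z₀ + d
      d≈ {z} {d} e = trans (solve 2 (λ z z₀ → z := z₀ :+ (z :- z₀)) refl z z₀) (+-congˡ e)
      ≈d : ∀ {z d} → z ≈ z₀ + d → z - z₀ ≈ d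
      ≈d {z} {d} e = trans (+-congʳ e) (solve 2 (λ z₀ d → z₀ :+ d :- z₀ := d) refl z₀ d)
      ℘d : ∀ z → (z - z₀) ^ 3 - (z - z₀) ≈ ℘ z - ℘ z₀
      ℘d z = solve 2 (λ z z₀ → (z :- z₀) :^ 3 :- (z :- z₀) := (z :^ 3 :- z) :- (z₀ :^ 3 :- z₀)) refl z z₀
      at : ∀ z (e? : Dec (℘ z ≈ ℘ z₀)) (0? : Dec (z ≈ z₀)) (1? : Dec (z ≈ z₀ + 1#)) (2? : Dec (z ≈ z₀ - 1#)) →
           ⟦ e? ⟧ ℕ.* 1 ≡ ⟦ 0? ⟧ ℕ.+ ⟦ 1? ⟧ ℕ.+ ⟦ 2? ⟧
      at z (yes e) 0? 1? 2? = ≡.sym (≡.trans (≡.sym (≡.cong₂ ℕ._+_ (≡.cong₂ ℕ._+_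
          (⟦⟧-⇔ (z - z₀ ≟ 0#) 0? (λ e → trans (d≈ e) (+-identityʳ z₀)) (λ e → ≈d (trans e (sym (+-identityʳ z₀)))))
          (⟦⟧-⇔ (z - z₀ ≟ 1#) 1? d≈ ≈d)) (⟦⟧-⇔ (z - z₀ ≟ - 1#) 2? d≈ ≈d)))
        (exactly-one-value (cube-fixed (x-y≈0⇒x≈y _ _ (trans (℘d z) (x≈y⇒x-y≈0 e)))) (z - z₀ ≟ 0#) (z - z₀ ≟ 1#)
            (z - z₀ ≟ - 1#)))
      at z (no ne) 0? 1? 2? = ≡.sym (≡.cong₂ ℕ._+_ (≡.cong₂ ℕ._+_
        (⟦⟧-no 0? λ e → ne (℘-cong e))
        (⟦⟧-no 1? λ e → ne (trans (℘-cong e) (solve 1 (λ z → (z :+ con 𝟙) :^ 3 :- (z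
            :+ con 𝟙) := z :^ 3 :- z) refl z₀))))
        (⟦⟧-no 2? λ e → ne (trans (℘-cong e) (solve 1 (λ z → (z :- con 𝟙) :^ 3 :-
            (z :- con 𝟙) := z :^ 3 :- z) refl z₀))))
    fibre-≤ : ∀ w (w? : Dec (Tr w ≈ 0#)) → ∑ (λ z → ⟦ ℘ z ≟ w ⟧) ℕ.≤ 3 ℕ.* ⟦ w? ⟧
    fibre-≤ w w? with any? {P = λ z → ℘ z ≈ w} (λ e e′ → trans (sym (℘-cong e)) e′) (λ z → ℘ z ≟ w)
    ... | yes (z₀ , e) = ℕ.≤-reflexive (≡.trans (∑-cong λ z → ≟-cong refl (sym e))
            (≡.trans (roots z₀) (≡.cong (3 ℕ.*_) (≡.sym (⟦⟧-yes w? (trans (Tr-cong (sym e)) (Tr-℘ z₀)))))))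
    ... | no  none = ℕ.≤-trans (ℕ.≤-reflexive (≡.trans (∑-cong λ z → ⟦⟧-no (℘ z ≟ w) λ e → none (z , e)) (≡.trans
        (∑-const 0) (ℕ.*-zeroʳ q)))) z≤n

  roots² : Carrier → ℕ
  roots² c = ∑ (λ w → ⟦ w ^ 2 ≟ c ⟧)

  roots²-cong : Cong roots²
  roots²-cong eq = ∑-cong λ w → ≟-cong refl eq

  roots²-0 : roots² 0# ≡ 1
  roots²-0 = ≡.trans (∑-cong λ w → ⟦⟧-⇔ (w ^ 2 ≟ 0#) (w ≟ 0#) x²≈0⇒x≈0 λ e → trans (^-congˡ 2 e) (zeroˡ _))
      (∑-indicator 0#)

  roots²-square : ∀ {r} → r ≉ 0# → roots² (r ^ 2) ≡ 2
  roots²-square {r} r≉0 = ≡.trans (∑-cong λ w → at w (w ^ 2 ≟ r ^ 2) (w ≟ r) (w ≟ (- r)))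
    (≡.trans (∑-+ _ _) (≡.cong₂ ℕ._+_ (∑-indicator r) (∑-indicator (- r))))
    where
    at : ∀ w (e? : Dec (w ^ 2 ≈ r ^ 2)) (p? : Dec (w ≈ r)) (n? : Dec (w ≈ - r)) → ⟦ e? ⟧ ≡ ⟦ p? ⟧ ℕ.+ ⟦ n? ⟧
    at w (yes e) p? n? with x²≈y²⇒x≈±y e
    ... | inj₁ p = ≡.sym (≡.cong₂ ℕ._+_ (⟦⟧-yes p? p) (⟦⟧-no n? λ n → r≉0 (x≈-x⇒x≈0 (trans (sym p) n))))
    ... | inj₂ n = ≡.sym (≡.cong₂ ℕ._+_ (⟦⟧-no p? λ p → r≉0 (x≈-x⇒x≈0 (trans (sym p) n))) (⟦⟧-yes n? n))
    at w (no ne) p? n? = ≡.sym (≡.cong₂ ℕ._+_ (⟦⟧-no p? λ p → ne (^-congˡ 2 p))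
      (⟦⟧-no n? λ n → ne (trans (^-congˡ 2 n) (solve 1 (λ r → (:- r) :^ 2 := r :^ 2) refl r))))

  roots²-none : ∀ {c} → (∀ w → w ^ 2 ≉ c) → roots² c ≡ 0
  roots²-none {c} none = ≡.trans (∑-cong λ w → ⟦⟧-no (w ^ 2 ≟ c) (none w)) (≡.trans (∑-const 0) (ℕ.*-zeroʳ q))

  square? : ∀ c → c ≈ 0# ⊎ (∃ λ r → r ≉ 0# × r ^ 2 ≈ c) ⊎ (∀ w → w ^ 2 ≉ c)
  square? c with c ≟ 0#
  ... | yes c≈0 = inj₁ c≈0
  ... | no  c≉0 with any? {P = λ w → w ^ 2 ≈ c} (λ e e′ → trans (^-congˡ 2 (sym e)) e′) (λ w → w ^ 2 ≟ c)
  ...   | yes (r , r²≈c) = inj₂ (inj₁ (r , (λ r≈0 → c≉0 (trans (sym r²≈c) (trans (^-congˡ 2 r≈0) (zeroˡ _)))) , r²≈c))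
  ...   | no  none       = inj₂ (inj₂ λ w w²≈c → none (w , w²≈c))

  roots²≤2 : ∀ c → roots² c ℕ.≤ 2
  roots²≤2 c with square? c
  ... | inj₁ c≈0                     = ℕ.≤-trans (ℕ.≤-reflexive (≡.trans (roots²-cong c≈0) roots²-0)) (s≤s z≤n)
  ... | inj₂ (inj₁ (r , r≉0 , r²≈c)) = ℕ.≤-reflexive (≡.trans (roots²-cong (sym r²≈c)) (roots²-square r≉0))
  ... | inj₂ (inj₂ none)             = ℕ.≤-trans (ℕ.≤-reflexive (roots²-none none)) z≤n

  ∑-roots² : ∑ roots² ≡ q
  ∑-roots² = ≡.trans (∑-swap _) (≡.trans
    (∑-cong λ w → ≡.trans (∑-cong λ c → ⟦⟧-⇔ (w ^ 2 ≟ c) (c ≟ w ^ 2) sym sym) (∑-indicator (w ^ 2)))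
    (≡.trans (∑-const 1) (ℕ.*-identityʳ q)))

  roots²-scale : ∀ {r} → r ≉ 0# → ∀ c → roots² (r ^ 2 * c) ≡ roots² c
  roots²-scale {r} r≉0 c = ≡.trans
    (≡.sym (∑-scale (λ e → ≟-cong (^-congˡ 2 e) refl) r≉0))
    (∑-cong λ w → ⟦⟧-⇔ ((r * w) ^ 2 ≟ r ^ 2 * c) (w ^ 2 ≟ c)
      (λ e → *-cancelˡ-nonzero (r ^ 2) (x^n≉0 2 r≉0) (trans (sym (square r w)) e))
      (λ e → trans (square r w) (*-congˡ e)))
    where
    square : ∀ r w → (r * w) ^ 2 ≈ r ^ 2 * w ^ 2
    square = solve 2 (λ r w → (r :* w) :^ 2 := r :^ 2 :* w :^ 2) refl

  -- For t a non-square, roots² c + roots² (t c) ≤ 2 for all c, with equal sums over c.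
  roots²-nonsquare : ∀ {t} → t ≉ 0# → (∀ w → w ^ 2 ≉ t) → ∀ c → roots² c ℕ.+ roots² (t * c) ≡ 2
  roots²-nonsquare {t} t≉0 none = ∑-tight (λ e → ≡.cong₂ ℕ._+_ (roots²-cong e) (roots²-cong (*-congˡ e)))
      (λ _ → ≡.refl)
    at-most-2 (≡.trans (∑-+ _ _) (≡.trans (≡.cong₂ ℕ._+_ ∑-roots² (≡.trans (∑-scale roots²-cong t≉0) ∑-roots²))
      (≡.sym (≡.trans (∑-const 2) (≡.trans (ℕ.*-comm q 2) (≡.cong (q ℕ.+_) (ℕ.+-identityʳ q)))))))
    where
    at-most-2 : ∀ c → roots² c ℕ.+ roots² (t * c) ℕ.≤ 2
    at-most-2 c with square? c
    ... | inj₁ c≈0 = ℕ.≤-reflexive (≡.cong₂ ℕ._+_ (≡.trans (roots²-cong c≈0) roots²-0)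
                       (≡.trans (roots²-cong (trans (*-congˡ c≈0) (zeroʳ t))) roots²-0))
    ... | inj₂ (inj₁ (r , r≉0 , r²≈c)) = ℕ.≤-reflexive (≡.cong₂ ℕ._+_
        (≡.trans (roots²-cong (sym r²≈c)) (roots²-square r≉0))
        (≡.trans (roots²-cong (trans (*-congˡ (sym r²≈c)) (*-comm _ _))) (≡.trans (roots²-scale r≉0 t)
            (roots²-none none))))
    ... | inj₂ (inj₂ no-root) = ℕ.≤-trans (ℕ.≤-reflexive (≡.cong (ℕ._+ roots² (t * c)) (roots²-none no-root)))
        (roots²≤2 (t * c))

  -- With roots² = 1 + χ this says χ (t c) = χ t χ c.
  roots²-* : ∀ t c → roots² t ℕ.* roots² c ℕ.+ 2 ≡ roots² t ℕ.+ roots² c ℕ.+ roots² (t * c)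
  roots²-* t c with square? t
  ... | inj₁ t≈0
    rewrite roots²-cong t≈0 | roots²-0 | roots²-cong (trans (*-congʳ {c} t≈0) (zeroˡ c)) | roots²-0
          | ℕ.*-identityˡ (roots² c) = ℕ.+-suc (roots² c) 1
  ... | inj₂ (inj₁ (r , r≉0 , r²≈t))
    rewrite roots²-cong (sym r²≈t) | roots²-square r≉0 | roots²-cong (*-congʳ {c} (sym r²≈t)) | roots²-scale r≉0 c
          | ℕ.+-identityʳ (roots² c) = ℕ.+-comm (roots² c ℕ.+ roots² c) 2
  ... | inj₂ (inj₂ none)
    rewrite roots²-none none = ≡.sym (roots²-nonsquare (λ t≈0 → none 0# (trans (zeroˡ _) (sym t≈0))) none c)

-- Chords and tangents of y² = x³ + x² - a.

module CollinearTheory {c ℓ : Level} (m : ℕ) (0<m : 0 ℕ.< m) (F : FiniteField c ℓ (3 ℕ.^ m))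
  (a : FiniteField.Carrier F) (a≉0 : FiniteField._≉_ F a (FiniteField.0# F)) where
  open TernaryField m 0<m F

  multiple : ∀ k {x y} → x ≈ y → k * (x - y) ≈ 0#
  multiple k eq = trans (*-congˡ (x≈y⇒x-y≈0 eq)) (zeroʳ k)

  -- Consequences of equations lᵢ ≈ rᵢ are proved by writing x - y as ∑ᵢ kᵢ (lᵢ - rᵢ), an identity
  -- over 𝔽₃ for the solver.
  infixl 6 _⊹_
  _⊹_ : ∀ {x y} → x ≈ 0# → y ≈ 0# → x + y ≈ 0#
  p ⊹ q = trans (+-cong p q) (+-identityʳ 0#)

  from-combination : ∀ {x y s} → x - y ≈ s → s ≈ 0# → x ≈ y
  from-combination eq s≈0 = x-y≈0⇒x≈y _ _ (trans eq s≈0)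

  -- The line y = κ x + μ meets the curve in the roots of x³ + x² - a - (κ x + μ)², with multiplicity;
  -- σ₁, σ₂, σ₃ are Vieta's formulas (-2 = 1).
  record Collinear (x₁ y₁ x₂ y₂ x₃ y₃ : Carrier) : Set (c ⊔ ℓ) where
    constructor collinear
    field
      κ μ : Carrier
      on₁ : y₁ ≈ κ * x₁ + μ
      on₂ : y₂ ≈ κ * x₂ + μ
      on₃ : y₃ ≈ κ * x₃ + μ
      σ₁  : x₁ + x₂ + x₃ ≈ κ ^ 2 - 1#
      σ₂  : x₁ * x₂ + x₂ * x₃ + x₃ * x₁ ≈ κ * μ
      σ₃  : x₁ * x₂ * x₃ ≈ a + μ ^ 2

  Collinear-swap : ∀ {x₁ y₁ x₂ y₂ x₃ y₃} → Collinear x₁ y₁ x₂ y₂ x₃ y₃ → Collinear x₂ y₂ x₁ y₁ x₃ y₃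
  Collinear-swap {x₁} {_} {x₂} {_} {x₃} (collinear κ μ on₁ on₂ on₃ σ₁ σ₂ σ₃) = collinear κ μ on₂ on₁ on₃
    (trans (solve 3 (λ x y z → y :+ x :+ z := x :+ y :+ z) refl x₁ x₂ x₃) σ₁)
    (trans (solve 3 (λ x y z → y :* x :+ x :* z :+ z :* y := x :* y :+ y :* z :+ z :* x) refl x₁ x₂ x₃) σ₂)
    (trans (solve 3 (λ x y z → y :* x :* z := x :* y :* z) refl x₁ x₂ x₃) σ₃)

  Collinear-rotate : ∀ {x₁ y₁ x₂ y₂ x₃ y₃} → Collinear x₁ y₁ x₂ y₂ x₃ y₃ → Collinear x₂ y₂ x₃ y₃ x₁ y₁
  Collinear-rotate {x₁} {_} {x₂} {_} {x₃} (collinear κ μ on₁ on₂ on₃ σ₁ σ₂ σ₃) = collinear κ μ on₂ on₃ on₁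
    (trans (solve 3 (λ x y z → y :+ z :+ x := x :+ y :+ z) refl x₁ x₂ x₃) σ₁)
    (trans (solve 3 (λ x y z → y :* z :+ z :* x :+ x :* y := x :* y :+ y :* z :+ z :* x) refl x₁ x₂ x₃) σ₂)
    (trans (solve 3 (λ x y z → y :* z :* x := x :* y :* z) refl x₁ x₂ x₃) σ₃)

  Collinear-resp : ∀ {x₁ y₁ x₂ y₂ x₃ y₃ u₁ v₁ u₂ v₂ u₃ v₃} → x₁ ≈ u₁ → y₁ ≈ v₁ → x₂ ≈ u₂ → y₂ ≈ v₂ → x₃ ≈ u₃ → y₃ ≈ v₃ →
                   Collinear x₁ y₁ x₂ y₂ x₃ y₃ → Collinear u₁ v₁ u₂ v₂ u₃ v₃
  Collinear-resp p₁ q₁ p₂ q₂ p₃ q₃ (collinear κ μ on₁ on₂ on₃ σ₁ σ₂ σ₃) = collinear κ μ (on p₁ q₁ on₁)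
      (on p₂ q₂ on₂) (on p₃ q₃ on₃)
    (trans (+-cong (+-cong (sym p₁) (sym p₂)) (sym p₃)) σ₁)
    (trans (+-cong (+-cong (*-cong (sym p₁) (sym p₂)) (*-cong (sym p₂) (sym p₃))) (*-cong (sym p₃) (sym p₁))) σ₂)
    (trans (*-cong (*-cong (sym p₁) (sym p₂)) (sym p₃)) σ₃)
    where
    on : ∀ {x y u v} → x ≈ u → y ≈ v → y ≈ κ * x + μ → v ≈ κ * u + μ
    on p q e = trans (sym q) (trans e (+-congʳ (*-congˡ p)))

  -- By Vieta the restriction of the curve equation to the line is (x - x₁)(x - x₂)(x - x₃), which
  -- vanishes at x₃.
  third-on-curve : ∀ {x₁ x₂ x₃ κ μ} → x₁ + x₂ + x₃ ≈ κ ^ 2 - 1# → x₁ * x₂ + x₂ * x₃ + x₃ * x₁ ≈ κ * μ →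
                   x₁ * x₂ * x₃ ≈ a + μ ^ 2 → E a (x₃ , κ * x₃ + μ)
  third-on-curve {x₁} {x₂} {x₃} {κ} {μ} σ₁ σ₂ σ₃ = from-combination
    (solve 6 (λ x₁ x₂ x₃ κ μ a →
        (κ :* x₃ :+ μ) :^ 2 :- (x₃ :^ 3 :+ x₃ :^ 2 :- a) :=
        (:- (x₃ :^ 2)) :* (x₁ :+ x₂ :+ x₃ :- (κ :^ 2 :- con 𝟙)) :+ x₃ :* (x₁ :* x₂ :+ x₂ :* x₃ :+ x₃ :* x₁ :- κ :* μ)
        :+ (con 𝟚) :* (x₁ :* x₂ :* x₃ :- (a :+ μ :^ 2))) refl x₁ x₂ x₃ κ μ a)
    (multiple (- (x₃ ^ 2)) σ₁ ⊹ multiple x₃ σ₂ ⊹ multiple (- 1#) σ₃)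

  -- Implicit differentiation: 2 y κ = 3 x² + 2 x, and the first term on the right vanishes in
  -- characteristic 3.
  tangent-slope : ∀ {x₁ y₁ x₂ y₂ x₃ y₃} (l : Collinear x₁ y₁ x₂ y₂ x₃ y₃) → x₂ ≈ x₁ → Collinear.κ l * y₁ ≈ x₁
  tangent-slope {x₁} {y₁} {x₂} {y₂} {x₃} (collinear κ μ on₁ _ _ σ₁ σ₂ _) x₂≈x₁ = from-combination
    (solve 6 (λ x₁ y₁ x₂ x₃ κ μ →
        κ :* y₁ :- x₁ :=
        κ :* (y₁ :- (κ :* x₁ :+ μ)) :+ con 𝟚 :* (x₁ :* x₂ :+ x₂ :* x₃ :+ x₃ :* x₁ :- κ :* μ)
        :+ :- x₁ :* (x₁ :+ x₂ :+ x₃ :- (κ :^ 2 :- con 𝟙)) :+ (x₃ :- x₁) :* (x₂ :- x₁)) refl x₁ y₁ x₂ x₃ κ μ)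
    (multiple κ on₁ ⊹ multiple (- 1#) σ₂ ⊹ multiple (- x₁) σ₁ ⊹ multiple (x₃ - x₁) x₂≈x₁)

  -- At y₁ = 0 the relation κ y₁ = x₁ would give x₁ = 0, and the curve equation a = 0. This is where
  -- smoothness enters.
  tangent-y≉0 : ∀ {x₁ y₁ x₂ y₂ x₃ y₃} → Collinear x₁ y₁ x₂ y₂ x₃ y₃ → E a (x₁ , y₁) → x₂ ≈ x₁ → y₁ ≉ 0#
  tangent-y≉0 {x₁} {y₁} l e x₂≈x₁ y₁≈0 = a≉0 (from-combination
    (solve 3 (λ x y a → a :- con 𝟘 := (:- y) :* (y :- con 𝟘) :+ (x :^ 2 :+ x) :* (x :- con 𝟘) :+ con 𝟙 :*
        (y :^ 2 :- (x :^ 3 :+ x :^ 2 :- a))) refl x₁ y₁ a)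
    (multiple (- y₁) y₁≈0 ⊹ multiple (x₁ ^ 2 + x₁) x₁≈0 ⊹ multiple 1# e))
    where
    x₁≈0 : x₁ ≈ 0#
    x₁≈0 = trans (sym (tangent-slope l x₂≈x₁)) (trans (*-congˡ y₁≈0) (zeroʳ _))

  -- On a line y = κ x + μ equal x-coordinates force equal y-coordinates, so opposite points would
  -- have y₁ = 0.
  not-vertical : ∀ {x₁ y₁ x₂ y₂ x₃ y₃} → Collinear x₁ y₁ x₂ y₂ x₃ y₃ → E a (x₁ , y₁) → x₂ ≈ x₁ → y₂ ≉ - y₁
  not-vertical l e x₂≈x₁ y₂≈-y₁ = tangent-y≉0 l e x₂≈x₁ (x≈-x⇒x≈0
    (trans on₁ (trans (+-congʳ (*-congˡ (sym x₂≈x₁))) (trans (sym on₂) y₂≈-y₁))))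
    where open Collinear l

  slope-unique : ∀ {x₁ y₁ x₂ y₂ x₃ y₃ x₃′ y₃′} (l : Collinear x₁ y₁ x₂ y₂ x₃ y₃)
      (l′ : Collinear x₁ y₁ x₂ y₂ x₃′ y₃′) →
                 E a (x₁ , y₁) → Collinear.κ l ≈ Collinear.κ l′
  slope-unique {x₁} {y₁} {x₂} {y₂} l l′ e with x₂ ≟ x₁
  ... | yes x₂≈x₁ = *-cancelˡ-nonzero y₁ (tangent-y≉0 l e x₂≈x₁)
        (trans (*-comm _ _) (trans (tangent-slope l x₂≈x₁) (trans (sym (tangent-slope l′ x₂≈x₁)) (*-comm _ _))))
  ... | no  x₂≉x₁ = *-cancelˡ-nonzero (x₂ - x₁) (λ eq → x₂≉x₁ (x-y≈0⇒x≈y _ _ eq)) (trans (chord l) (sym (chord l′)))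
    where
    chord : ∀ {x₃ y₃} (l : Collinear x₁ y₁ x₂ y₂ x₃ y₃) → (x₂ - x₁) * Collinear.κ l ≈ y₂ - y₁
    chord (collinear κ μ on₁ on₂ _ _ _ _) = from-combination
      (solve 6 (λ x₁ y₁ x₂ y₂ κ μ → (x₂ :- x₁) :* κ :- (y₂ :- y₁) :=
        con 𝟙 :* (y₁ :- (κ :* x₁ :+ μ)) :+ con 𝟚 :* (y₂ :- (κ :* x₂ :+ μ))) refl x₁ y₁ x₂ y₂ κ μ)
      (multiple 1# on₁ ⊹ multiple (- 1#) on₂)

  third-unique : ∀ {x₁ y₁ x₂ y₂ x₃ y₃ x₃′ y₃′} → Collinear x₁ y₁ x₂ y₂ x₃ y₃ → Collinear x₁ y₁ x₂ y₂ x₃′ y₃′ →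
                 E a (x₁ , y₁) → x₃ ≈ x₃′ × y₃ ≈ y₃′
  third-unique {x₁} {y₁} {x₂} {y₂} {x₃} {y₃} {x₃′} {y₃′} l l′ e =
    x₃≈ , trans (on₃ l) (trans (+-cong (*-cong κ≈ x₃≈) μ≈) (sym (on₃ l′)))
    where
    open Collinear
    κ≈ = slope-unique l l′ e
    μ≈ : μ l ≈ μ l′
    μ≈ = +-cancelˡ (κ l * x₁) _ _ (trans (sym (on₁ l)) (trans (on₁ l′) (+-congʳ (*-congʳ (sym κ≈)))))
    x₃≈ : x₃ ≈ x₃′
    x₃≈ = +-cancelˡ (x₁ + x₂) _ _ (trans (σ₁ l) (trans (+-congʳ (^-congˡ 2 κ≈)) (sym (σ₁ l′))))

  abstract
    chord : ∀ {x₁ y₁ x₂ y₂} → E a (x₁ , y₁) → E a (x₂ , y₂) → x₂ ≉ x₁ →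
            ∃ λ x₃ → ∃ λ y₃ → E a (x₃ , y₃) × Collinear x₁ y₁ x₂ y₂ x₃ y₃
    chord {x₁} {y₁} {x₂} {y₂} e₁ e₂ x₂≉x₁ = x₃ , κ * x₃ + μ , third-on-curve σ₁ σ₂ σ₃ , collinear κ μ on₁ on₂ refl σ₁ σ₂ σ₃
      where
      x₂-x₁≉0 : x₂ - x₁ ≉ 0#
      x₂-x₁≉0 eq = x₂≉x₁ (x-y≈0⇒x≈y _ _ eq)
      κ μ x₃ : Carrier
      κ = (y₂ - y₁) * (x₂ - x₁) ⁻¹
      μ = y₁ - κ * x₁
      x₃ = κ ^ 2 - 1# - x₁ - x₂
      slope : (x₂ - x₁) * κ ≈ y₂ - y₁
      slope = trans (solve 3 (λ x y z → x :* (y :* z) := y :* (x :* z)) refl (x₂ - x₁) (y₂ - y₁) ((x₂ - x₁) ⁻¹))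
        (trans (*-congˡ (*-inverse x₂-x₁≉0)) (*-identityʳ _))
      on₁ : y₁ ≈ κ * x₁ + μ
      on₁ = solve 2 (λ y z → y := z :+ (y :- z)) refl y₁ (κ * x₁)
      on₂ : y₂ ≈ κ * x₂ + μ
      on₂ = from-combination (solve 5 (λ x₁ x₂ y₁ y₂ κ → y₂ :- (κ :* x₂ :+ (y₁ :- κ :* x₁)) :=
        con 𝟚 :* ((x₂ :- x₁) :* κ :- (y₂ :- y₁))) refl x₁ x₂ y₁ y₂ κ) (multiple (- 1#) slope)
      σ₁ : x₁ + x₂ + x₃ ≈ κ ^ 2 - 1#
      σ₁ = solve 3 (λ x₁ x₂ k → x₁ :+ x₂ :+ (k :- con 𝟙 :- x₁ :- x₂) := k :- con 𝟙) refl x₁ x₂ (κ ^ 2)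
      e₂′ : E a (x₂ , κ * x₂ + μ)
      e₂′ = trans (^-congˡ 2 (sym on₂)) e₂
      σ₂ : x₁ * x₂ + x₂ * x₃ + x₃ * x₁ ≈ κ * μ
      -- Once σ₁ holds, the cubic on the line and the product of the (x - xᵢ) differ by a linear
      -- polynomial. It vanishes at x₁ and x₂; subtracting the two conditions isolates its slope
      -- times x₂ - x₁, and the condition at x₁ then gives `σ₃`.
      σ₂ = *-cancelˡ-nonzero (x₂ - x₁) x₂-x₁≉0 (from-combination
        (solve 5 (λ x₁ x₂ y₁ κ a →
           let μ = y₁ :- κ :* x₁
               x₃ = κ :^ 2 :- con 𝟙 :- x₁ :- x₂ in
           (x₂ :- x₁) :* (x₁ :* x₂ :+ x₂ :* x₃ :+ x₃ :* x₁) :- (x₂ :- x₁) :* (κ :* μ) :=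
           con 𝟙 :* ((κ :* x₂ :+ μ) :^ 2 :- (x₂ :^ 3 :+ x₂ :^ 2 :- a)) :+ con 𝟚 :* (y₁ :^ 2 :- (x₁ :^ 3
               :+ x₁ :^ 2 :- a)))
           refl x₁ x₂ y₁ κ a)
        (multiple 1# e₂′ ⊹ multiple (- 1#) e₁))
      σ₃ : x₁ * x₂ * x₃ ≈ a + μ ^ 2
      σ₃ = from-combination
        (solve 5 (λ x₁ x₂ y₁ κ a →
           let μ = y₁ :- κ :* x₁
               x₃ = κ :^ 2 :- con 𝟙 :- x₁ :- x₂ in
           x₁ :* x₂ :* x₃ :- (a :+ μ :^ 2) :=
           x₁ :* (x₁ :* x₂ :+ x₂ :* x₃ :+ x₃ :* x₁ :- κ :* μ) :+ con 𝟚 :* (y₁ :^ 2 :- (x₁ :^ 3 :+ x₁ :^ 2 :- a)))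
           refl x₁ x₂ y₁ κ a)
        (multiple x₁ σ₂ ⊹ multiple (- 1#) e₁)

    tangent : ∀ {x₁ y₁ x₂ y₂} → E a (x₁ , y₁) → x₂ ≈ x₁ → y₂ ≈ y₁ → y₁ ≉ 0# →
              ∃ λ x₃ → ∃ λ y₃ → E a (x₃ , y₃) × Collinear x₁ y₁ x₂ y₂ x₃ y₃
    tangent {x₁} {y₁} {x₂} {y₂} e₁ x₂≈x₁ y₂≈y₁ y₁≉0 = x₃ , κ * x₃ + μ , third-on-curve σ₁ σ₂ σ₃ , collinear κ μ on₁ on₂ refl σ₁ σ₂ σ₃
      where
      κ μ x₃ : Carrier
      -- The slope of the tangent; in `x₃` the double root contributes -2 x₁ = x₁.
      κ = x₁ * y₁ ⁻¹
      μ = y₁ - κ * x₁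
      x₃ = κ ^ 2 - 1# + x₁
      slope : κ * y₁ ≈ x₁
      slope = trans (*-assoc _ _ _) (trans (*-congˡ (trans (*-comm _ _) (*-inverse y₁≉0))) (*-identityʳ x₁))
      on₁ : y₁ ≈ κ * x₁ + μ
      on₁ = solve 2 (λ y z → y := z :+ (y :- z)) refl y₁ (κ * x₁)
      on₂ : y₂ ≈ κ * x₂ + μ
      on₂ = trans y₂≈y₁ (trans on₁ (+-congʳ (*-congˡ (sym x₂≈x₁))))
      σ₁ : x₁ + x₂ + x₃ ≈ κ ^ 2 - 1#
      σ₁ = from-combination (solve 3 (λ x₁ x₂ k → x₁ :+ x₂ :+ (k :- con 𝟙 :+ x₁) :- (k :- con 𝟙) := con 𝟙 :*
          (x₂ :- x₁)) refl x₁ x₂ (κ ^ 2))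
        (multiple 1# x₂≈x₁)
      σ₂ : x₁ * x₂ + x₂ * x₃ + x₃ * x₁ ≈ κ * μ
      σ₂ = from-combination
        (solve 4 (λ x₁ x₂ y₁ κ →
           let μ = y₁ :- κ :* x₁
               x₃ = κ :^ 2 :- con 𝟙 :+ x₁ in
           x₁ :* x₂ :+ x₂ :* x₃ :+ x₃ :* x₁ :- κ :* μ :=
           (x₁ :+ x₃) :* (x₂ :- x₁) :+ con 𝟚 :* (κ :* y₁ :- x₁)) refl x₁ x₂ y₁ κ)
        (multiple (x₁ + x₃) x₂≈x₁ ⊹ multiple (- 1#) slope)
      σ₃ : x₁ * x₂ * x₃ ≈ a + μ ^ 2
      σ₃ = from-combination
        (solve 5 (λ x₁ x₂ y₁ κ a →
           let μ = y₁ :- κ :* x₁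
               x₃ = κ :^ 2 :- con 𝟙 :+ x₁ in
           x₁ :* x₂ :* x₃ :- (a :+ μ :^ 2) :=
           (x₁ :* x₃) :* (x₂ :- x₁) :+ :- x₁ :* (κ :* y₁ :- x₁) :+ con 𝟚 :* (y₁ :^ 2 :- (x₁ :^ 3 :+ x₁ :^ 2 :- a)))
           refl x₁ x₂ y₁ κ a)
        (multiple (x₁ * x₃) x₂≈x₁ ⊹ multiple (- x₁) slope ⊹ multiple (- 1#) e₁)

-- Tripling formulas and their effect on collinear points.

module TripleTheory {c ℓ : Level} (m : ℕ) (0<m : 0 ℕ.< m) (F : FiniteField c ℓ (3 ℕ.^ m))
  (a : FiniteField.Carrier F) (a≉0 : FiniteField._≉_ F a (FiniteField.0# F)) where
  open TernaryField m 0<m F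
  open CollinearTheory m 0<m F a a≉0

  -- Multiplication by 3 is (x , y) ↦ (X t z , Y z) with t = 1/(x³ - a) and z = y³ t;
  -- z has simple poles at the 3-torsion and Y z = z³ - z.
  X : Carrier → Carrier → Carrier
  X t z = z ^ 2 - 1# - a * t

  Y : Carrier → Carrier
  Y z = z ^ 3 - z

  record Triples (x y t z : Carrier) : Set ℓ where
    constructor triples
    field
      t-eq : (x ^ 3 - a) * t ≈ 1#
      z-eq : z ≈ y ^ 3 * t

  abstract
    X-on-curve : ∀ {x y t z} → Triples x y t z → E a (x , y) → E a (X t z , Y z)
    X-on-curve {x} {y} {t} {z} (triples t-eq z-eq) e = from-combination
      (solve 3 (λ t z a → (z :^ 3 :- z) :^ 2 :- ((z :^ 2 :- con 𝟙 :- a :* t) :^ 3 :+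
          (z :^ 2 :- con 𝟙 :- a :* t) :^ 2 :- a) :=
          :- a :* (z :^ 2 :* t :- (con 𝟙 :+ t :- a :* t :^ 2 :+ a :^ 2 :* t :^ 3))) refl t z a)
      (multiple (- a) curve-tz)
      where
      s : Carrier
      s = x ^ 3 - a
      z²t : z ^ 2 * t ≈ (y ^ 2) ^ 3 * t ^ 3
      z²t = trans (*-congʳ (^-congˡ 2 z-eq)) (solve 2 (λ y t → (y :^ 3 :* t) :^ 2 :* t :=
          (y :^ 2) :^ 3 :* t :^ 3) refl y t)
      -- The cubed curve equation v² = s³ + s² - a s + a², with s = x³ - a and v = y³, divided by
      -- s³.
      curve-tz : z ^ 2 * t ≈ 1# + t - a * t ^ 2 + a ^ 2 * t ^ 3
      curve-tz = trans z²t (trans (*-congʳ (^-congˡ 3 e)) (from-combination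
        (solve 3 (λ x t a → let s = x :^ 3 :- a in
            (x :^ 3 :+ x :^ 2 :- a) :^ 3 :* t :^ 3 :- (con 𝟙 :+ t :- a :* t :^ 2 :+ a :^ 2 :* t :^ 3) :=
            (s :^ 2 :* t :^ 2 :+ s :* t :+ con 𝟙 :+ t :* (s :* t :+ con 𝟙) :- a :* t :^ 2) :*
                (s :* t :- con 𝟙)) refl x t a)
        (multiple (s ^ 2 * t ^ 2 + s * t + 1# + t * (s * t + 1#) - a * t ^ 2) t-eq)))

    X≈step : ∀ {x y t z} → Triples x y t z → x ^ 3 - a ≉ 0# → E a (x , y) → X t z ≈ step a x
    X≈step {x} {y} {t} {z} (triples t-eq z-eq) s≉0 e = trans
      (+-congʳ (+-congʳ (trans (^-congˡ 2 z-eq) (trans (solve 2 (λ y t → (y :^ 3 :* t) :^ 2 :=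
          (y :^ 2) :^ 3 :* t :^ 2) refl y t) (*-congʳ (^-congˡ 3 e))))))
      (trans (from-combination
        (solve 3 (λ x t a → let s = x :^ 3 :- a in
            (x :^ 3 :+ x :^ 2 :- a) :^ 3 :* t :^ 2 :- con 𝟙 :- a :* t :- (s :^ 3 :+ a :* x :^ 3) :* t :^ 2 :=
            (s :* t :+ con 𝟙 :+ a :* t) :* (s :* t :- con 𝟙)) refl x t a)
        (multiple (s * t + 1# + a * t) t-eq))
        (*-congˡ (⁻¹-unique (trans (solve 2 (λ s t → s :^ 2 :* t :^ 2 := (s :* t) :^ 2) refl s t) (trans
            (^-congˡ 2 t-eq) (solve 0 (con 𝟙 :^ 2 := con 𝟙) refl))))))
      where
      s : Carrier
      s = x ^ 3 - a

  -- The line through the cubes of three collinear points, in the coordinates s = x³ - a, v = y³;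
  -- the 3-torsion points are those with s = 0.
  record Cubed (s₁ v₁ s₂ v₂ s₃ v₃ : Carrier) : Set (c ⊔ ℓ) where
    field
      L M : Carrier
      on₁ : v₁ ≈ L * s₁ + M
      on₂ : v₂ ≈ L * s₂ + M
      on₃ : v₃ ≈ L * s₃ + M
      σ₁  : s₁ + s₂ + s₃ ≈ L ^ 2 - 1#
      σ₂  : s₁ * s₂ + s₂ * s₃ + s₃ * s₁ ≈ L * M - a
      σ₃  : s₁ * s₂ * s₃ ≈ M ^ 2 - a ^ 2

  abstract
    -- Cubing is a ring homomorphism, so the symmetric functions of the xᵢ³ are cubes of the old
    -- ones; the remaining terms come from the shift by a. The same shift turns κ³ x³ + μ³ into κ³ s
    -- + (μ³ + κ³ a).
    cubed : ∀ {x₁ y₁ x₂ y₂ x₃ y₃} → Collinear x₁ y₁ x₂ y₂ x₃ y₃ →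
            Cubed (x₁ ^ 3 - a) (y₁ ^ 3) (x₂ ^ 3 - a) (y₂ ^ 3) (x₃ ^ 3 - a) (y₃ ^ 3)
    cubed {x₁} {y₁} {x₂} {y₂} {x₃} {y₃} (collinear κ μ on₁ on₂ on₃ σ₁ σ₂ σ₃) = record
      { L = κ ^ 3 ; M = μ ^ 3 + κ ^ 3 * a
      ; on₁ = on on₁ ; on₂ = on on₂ ; on₃ = on on₃
      ; σ₁ = trans (solve 4 (λ x₁ x₂ x₃ a → (x₁ :^ 3 :- a) :+ (x₂ :^ 3 :- a) :+ (x₃ :^ 3 :- a) := (x₁ :+ x₂
          :+ x₃) :^ 3) refl x₁ x₂ x₃ a)
                   (trans (^-congˡ 3 σ₁) (solve 1 (λ κ → (κ :^ 2 :- con 𝟙) :^ 3 := (κ :^ 3) :^ 2 :- con 𝟙) refl κ))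
      ; σ₂ = trans (solve 4 (λ x₁ x₂ x₃ a →
                       let s₁ = x₁ :^ 3 :- a ; s₂ = x₂ :^ 3 :- a ; s₃ = x₃ :^ 3 :- a in
                       s₁ :* s₂ :+ s₂ :* s₃ :+ s₃ :* s₁ :=
                       (x₁ :* x₂ :+ x₂ :* x₃ :+ x₃ :* x₁) :^ 3 :+ a :* (x₁ :+ x₂ :+ x₃) :^ 3) refl x₁ x₂ x₃ a)
               (trans (+-cong (^-congˡ 3 σ₂) (*-congˡ (^-congˡ 3 σ₁)))
                 (solve 3 (λ κ μ a → (κ :* μ) :^ 3 :+ a :* (κ :^ 2 :- con 𝟙) :^ 3 := κ :^ 3 :* (μ :^ 3
                     :+ κ :^ 3 :* a) :- a) refl κ μ a))
      ; σ₃ = trans (solve 4 (λ x₁ x₂ x₃ a →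
                       (x₁ :^ 3 :- a) :* (x₂ :^ 3 :- a) :* (x₃ :^ 3 :- a) :=
                       (x₁ :* x₂ :* x₃) :^ 3 :- a :* (x₁ :* x₂ :+ x₂ :* x₃ :+ x₃ :* x₁) :^ 3 :+ a :^ 2 :* (x₁
                           :+ x₂ :+ x₃) :^ 3 :- a :^ 3)
                       refl x₁ x₂ x₃ a)
               (trans (+-congʳ (+-cong (+-cong (^-congˡ 3 σ₃) (-‿cong (*-congˡ (^-congˡ 3 σ₂)))) (*-congˡ
                   (^-congˡ 3 σ₁))))
                 (solve 3 (λ κ μ a → (a :+ μ :^ 2) :^ 3 :- a :* (κ :* μ) :^ 3 :+ a :^ 2 :*
                     (κ :^ 2 :- con 𝟙) :^ 3 :- a :^ 3 :=
                    (μ :^ 3 :+ κ :^ 3 :* a) :^ 2 :- a :^ 2) refl κ μ a))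
      }
      where
      on : ∀ {x y} → y ≈ κ * x + μ → y ^ 3 ≈ κ ^ 3 * (x ^ 3 - a) + (μ ^ 3 + κ ^ 3 * a)
      on {x} e = trans (^-congˡ 3 e) (solve 4 (λ x κ μ a →
        (κ :* x :+ μ) :^ 3 := κ :^ 3 :* (x :^ 3 :- a) :+ (μ :^ 3 :+ κ :^ 3 :* a)) refl x κ μ a)

  z-on-line : ∀ {s v t z L M} → s * t ≈ 1# → z ≈ v * t → v ≈ L * s + M → z ≈ L + M * t
  z-on-line {s} {v} {t} {z} {L} {M} st≈1 z≈ v≈ = trans z≈ (trans (*-congʳ v≈)
    (trans (solve 4 (λ s t L M → (L :* s :+ M) :* t := L :* (s :* t) :+ M :* t) refl s t L M)
      (+-congʳ (trans (*-congˡ st≈1) (*-identityʳ L)))))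

  module Generic {s₁ v₁ s₂ v₂ s₃ v₃ t₁ z₁ t₂ z₂ t₃ z₃ : Carrier} (l : Cubed s₁ v₁ s₂ v₂ s₃ v₃)
                 (st₁ : s₁ * t₁ ≈ 1#) (st₂ : s₂ * t₂ ≈ 1#) (st₃ : s₃ * t₃ ≈ 1#)
                 (z₁≈ : z₁ ≈ v₁ * t₁) (z₂≈ : z₂ ≈ v₂ * t₂) (z₃≈ : z₃ ≈ v₃ * t₃) where
    open Cubed l

    -- The tᵢ = 1/sᵢ have elementary symmetric functions p, e, d; the cofactors below come from
    -- dividing by p≈, e≈, d≈ in turn.
    private
      p = t₁ + t₂ + t₃
      e = t₁ * t₂ + t₂ * t₃ + t₃ * t₁
      d = t₁ * t₂ * t₃
      A = L ^ 2 - 1#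
      B = - (L * M + a)
      C = M ^ 2

      -- Vieta for reciprocals: p = σ₂/σ₃, e = σ₁/σ₃ and d = 1/σ₃, where σ₃ = M² - a².
      p≈ : p ≈ (L * M - a) * d
      p≈ = trans (from-combination
        (solve 6 (λ s₁ s₂ s₃ t₁ t₂ t₃ →
           t₁ :+ t₂ :+ t₃ :- (s₁ :* s₂ :+ s₂ :* s₃ :+ s₃ :* s₁) :* (t₁ :* t₂ :* t₃) :=
           :- (t₃ :* s₂ :* t₂ :+ t₂ :* s₃ :* t₃) :* (s₁ :* t₁ :- con 𝟙)
           :+ :- (t₁ :* s₃ :* t₃ :+ t₃) :* (s₂ :* t₂ :- con 𝟙)
           :+ :- (t₁ :+ t₂) :* (s₃ :* t₃ :- con 𝟙)) refl s₁ s₂ s₃ t₁ t₂ t₃)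
        (multiple (- (t₃ * s₂ * t₂ + t₂ * s₃ * t₃)) st₁ ⊹ multiple (- (t₁ * s₃ * t₃ + t₃)) st₂ ⊹ multiple (-
            (t₁ + t₂)) st₃))
        (*-congʳ σ₂)

      e≈ : e ≈ A * d
      e≈ = trans (from-combination
        (solve 6 (λ s₁ s₂ s₃ t₁ t₂ t₃ →
           t₁ :* t₂ :+ t₂ :* t₃ :+ t₃ :* t₁ :- (s₁ :+ s₂ :+ s₃) :* (t₁ :* t₂ :* t₃) :=
           :- (t₂ :* t₃) :* (s₁ :* t₁ :- con 𝟙) :+ :- (t₁ :* t₃) :* (s₂ :* t₂ :- con 𝟙) :+ :- (t₁ :* t₂) :*
               (s₃ :* t₃ :- con 𝟙))
           refl s₁ s₂ s₃ t₁ t₂ t₃)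
        (multiple (- (t₂ * t₃)) st₁ ⊹ multiple (- (t₁ * t₃)) st₂ ⊹ multiple (- (t₁ * t₂)) st₃))
        (*-congʳ σ₁)

      d≈ : (M ^ 2 - a ^ 2) * d ≈ 1#
      d≈ = trans (*-congʳ (sym σ₃)) (from-combination
        (solve 6 (λ s₁ s₂ s₃ t₁ t₂ t₃ →
           s₁ :* s₂ :* s₃ :* (t₁ :* t₂ :* t₃) :- con 𝟙 :=
           (s₂ :* t₂ :* (s₃ :* t₃)) :* (s₁ :* t₁ :- con 𝟙) :+ (s₃ :* t₃) :* (s₂ :* t₂ :- con 𝟙) :+ con 𝟙 :*
               (s₃ :* t₃ :- con 𝟙))
           refl s₁ s₂ s₃ t₁ t₂ t₃)
        (multiple (s₂ * t₂ * (s₃ * t₃)) st₁ ⊹ multiple (s₃ * t₃) st₂ ⊹ multiple 1# st₃))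

      -- With z = L + M t, reduce Y z - κ′ X t z modulo the cubic whose roots are the tᵢ. This κ′
      -- cancels the t² term, `μ′` is the constant term, and the t term vanishes by `p≈`, `e≈` and
      -- `d≈`.
      κ′ = M * p
      μ′ = L ^ 3 - L - κ′ * A + M ^ 3 * d

      root₁ : t₁ ^ 3 ≈ p * t₁ ^ 2 - e * t₁ + d
      root₁ = solve 3 (λ x y z → x :^ 3 := (x :+ y :+ z) :* x :^ 2 :- (x :* y :+ y :* z :+ z :* x) :* x
          :+ x :* y :* z) refl t₁ t₂ t₃
      root₂ : t₂ ^ 3 ≈ p * t₂ ^ 2 - e * t₂ + d
      root₂ = solve 3 (λ x y z → y :^ 3 := (x :+ y :+ z) :* y :^ 2 :- (x :* y :+ y :* z :+ z :* x) :* y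
          :+ x :* y :* z) refl t₁ t₂ t₃
      root₃ : t₃ ^ 3 ≈ p * t₃ ^ 2 - e * t₃ + d
      root₃ = solve 3 (λ x y z → z :^ 3 := (x :+ y :+ z) :* z :^ 2 :- (x :* y :+ y :* z :+ z :* x) :* z
          :+ x :* y :* z) refl t₁ t₂ t₃

      on′ : ∀ {t z} → t ^ 3 ≈ p * t ^ 2 - e * t + d → z ≈ L + M * t → Y z ≈ κ′ * X t z + μ′
      on′ {t} {z} root z≈ = trans (+-cong (^-congˡ 3 z≈) (-‿cong z≈)) (trans (from-combination
        (solve 7 (λ t p e d L M a →
           let z = L :+ M :* t ; A = L :^ 2 :- con 𝟙 in
           z :^ 3 :- z :- ((M :* p) :* (z :^ 2 :- con 𝟙 :- a :* t) :+ (L :^ 3 :- L :- M :* p :* A :+ M :^ 3 :* d)) :=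
           M :^ 3 :* (t :^ 3 :- (p :* t :^ 2 :- e :* t :+ d))
           :+ (t :* M :* (L :* M :+ a)) :* (p :- (L :* M :- a) :* d)
           :+ :- (t :* M :^ 3) :* (e :- A :* d)
           :+ (t :* M) :* ((M :^ 2 :- a :^ 2) :* d :- con 𝟙)) refl t p e d L M a)
        (multiple (M ^ 3) root ⊹ multiple (t * M * (L * M + a)) p≈ ⊹ multiple (- (t * M ^ 3)) e≈ ⊹ multiple
            (t * M) d≈))
        (+-congʳ (*-congˡ (+-congʳ (+-congʳ (^-congˡ 2 (sym z≈)))))))

      X-quadratic : ∀ {t z} → z ≈ L + M * t → X t z ≈ A + B * t + C * t ^ 2
      X-quadratic {t} z≈ = trans (+-congʳ (+-congʳ (^-congˡ 2 z≈))) (solve 4 (λ t L M a →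
        (L :+ M :* t) :^ 2 :- con 𝟙 :- a :* t := L :^ 2 :- con 𝟙 :+ :- (L :* M :+ a) :* t
            :+ M :^ 2 :* t :^ 2) refl t L M a)

      z₁-line : z₁ ≈ L + M * t₁
      z₁-line = z-on-line st₁ z₁≈ on₁
      z₂-line : z₂ ≈ L + M * t₂
      z₂-line = z-on-line st₂ z₂≈ on₂
      z₃-line : z₃ ≈ L + M * t₃
      z₃-line = z-on-line st₃ z₃≈ on₃

      X₁≈ = X-quadratic z₁-line
      X₂≈ = X-quadratic z₂-line
      X₃≈ = X-quadratic z₃-line

      σ₁′ : X t₁ z₁ + X t₂ z₂ + X t₃ z₃ ≈ κ′ ^ 2 - 1#
      σ₁′ = trans (+-cong (+-cong X₁≈ X₂≈) X₃≈) (trans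
        (solve 6 (λ A B C x y z →
           (A :+ B :* x :+ C :* x :^ 2) :+ (A :+ B :* y :+ C :* y :^ 2) :+ (A :+ B :* z :+ C :* z :^ 2) :=
           B :* (x :+ y :+ z) :+ C :* ((x :+ y :+ z) :^ 2 :+ (x :* y :+ y :* z :+ z :* x))) refl A B C t₁ t₂ t₃)
        (from-combination
          (solve 6 (λ p e d L M a →
             :- (L :* M :+ a) :* p :+ M :^ 2 :* (p :^ 2 :+ e) :- ((M :* p) :^ 2 :- con 𝟙) :=
             :- (L :* M :+ a) :* (p :- (L :* M :- a) :* d) :+ (M :^ 2) :* (e :- (L :^ 2 :- con 𝟙) :* d)
             :+ con 𝟚 :* ((M :^ 2 :- a :^ 2) :* d :- con 𝟙)) refl p e d L M a)
          (multiple (- (L * M + a)) p≈ ⊹ multiple (M ^ 2) e≈ ⊹ multiple (- 1#) d≈)))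

      σ₂′ : X t₁ z₁ * X t₂ z₂ + X t₂ z₂ * X t₃ z₃ + X t₃ z₃ * X t₁ z₁ ≈ κ′ * μ′
      σ₂′ = trans (+-cong (+-cong (*-cong X₁≈ X₂≈) (*-cong X₂≈ X₃≈)) (*-cong X₃≈ X₁≈)) (trans
        (solve 6 (λ A B C x y z →
           let f = λ t → A :+ B :* t :+ C :* t :^ 2
               p = x :+ y :+ z ; e = x :* y :+ y :* z :+ z :* x ; d = x :* y :* z in
           f x :* f y :+ f y :* f z :+ f z :* f x :=
           :- (A :* B :* p) :- A :* C :* (p :^ 2 :+ e) :+ B :^ 2 :* e :+ B :* C :* p :* e :+ C :^ 2 :* (e :^ 2
               :+ p :* d)) refl A B C t₁ t₂ t₃)
        (from-combination
          (solve 6 (λ p e d L M a →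
             let A = L :^ 2 :- con 𝟙 ; B = :- (L :* M :+ a) ; C = M :^ 2 in
             :- (A :* B :* p) :- A :* C :* (p :^ 2 :+ e) :+ B :^ 2 :* e :+ B :* C :* p :* e :+ C :^ 2 :* (e :^ 2
                 :+ p :* d)
               :- M :* p :* (L :^ 3 :- L :- M :* p :* A :+ M :^ 3 :* d) :=
             (:- (L :* M :^ 3 :* e) :+ L :^ 2 :* a :- M :^ 2 :* a :* e :- a) :* (p :- (L :* M :- a) :* d)
             :+ (:- (L :* M :* a) :+ M :^ 2 :+ M :^ 2 :* a :^ 2 :* d :- M :^ 4 :* d :+ M :^ 4 :* e :+ a :^ 2) :*
                 (e :- A :* d)
             :+ (M :^ 2 :* d :- L :^ 2 :* M :^ 2 :* d) :* ((M :^ 2 :- a :^ 2) :* d :- con 𝟙)) refl p e d L M a)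
          (multiple (- (L * M ^ 3 * e) + L ^ 2 * a - M ^ 2 * a * e - a) p≈
           ⊹ multiple (- (L * M * a) + M ^ 2 + M ^ 2 * a ^ 2 * d - M ^ 4 * d + M ^ 4 * e + a ^ 2) e≈
           ⊹ multiple (M ^ 2 * d - L ^ 2 * M ^ 2 * d) d≈)))

      σ₃′ : X t₁ z₁ * X t₂ z₂ * X t₃ z₃ ≈ a + μ′ ^ 2
      σ₃′ = trans (*-cong (*-cong X₁≈ X₂≈) X₃≈) (trans
        (solve 6 (λ A B C x y z →
           let f = λ t → A :+ B :* t :+ C :* t :^ 2
               p = x :+ y :+ z ; e = x :* y :+ y :* z :+ z :* x ; d = x :* y :* z in
           f x :* f y :* f z :=
           A :^ 3 :+ A :^ 2 :* B :* p :+ A :^ 2 :* C :* (p :^ 2 :+ e) :+ A :* B :^ 2 :* e :+ A :* B :* C :* p :* e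
           :+ A :* C :^ 2 :* (e :^ 2 :+ p :* d) :+ B :^ 3 :* d :+ B :^ 2 :* C :* p :* d :+ B :* C :^ 2 :* e :* d
               :+ C :^ 3 :* d :^ 2)
           refl A B C t₁ t₂ t₃)
        (from-combination
          (solve 6 (λ p e d L M a →
             let A = L :^ 2 :- con 𝟙 ; B = :- (L :* M :+ a) ; C = M :^ 2 in
             A :^ 3 :+ A :^ 2 :* B :* p :+ A :^ 2 :* C :* (p :^ 2 :+ e) :+ A :* B :^ 2 :* e :+ A :* B :* C :* p :* e
             :+ A :* C :^ 2 :* (e :^ 2 :+ p :* d) :+ B :^ 3 :* d :+ B :^ 2 :* C :* p :* d
                 :+ B :* C :^ 2 :* e :* d :+ C :^ 3 :* d :^ 2
               :- (a :+ (L :^ 3 :- L :- M :* p :* A :+ M :^ 3 :* d) :^ 2) :=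
             (L :* M :- L :* M :^ 3 :* a :* d :+ L :* M :^ 3 :* e :- L :^ 2 :* M :^ 2 :* a :* e
                 :+ L :^ 2 :* M :^ 4 :* d :- L :^ 2 :* a :+ L :^ 3 :* M :- L :^ 3 :* M :^ 3 :* e :- L :^ 4 :* a
                 :+ L :^ 5 :* M :+ M :^ 2 :* a :* e :+ M :^ 2 :* a :^ 2 :* d :- a) :* (p :- (L :* M :- a) :* d)
             :+ (L :* M :* a :- L :* M :^ 5 :* d :+ L :^ 2 :* M :^ 2 :* a :^ 2 :* d :- L :^ 2 :* M :^ 4 :* d
                 :+ L :^ 2 :* M :^ 4 :* e :+ L :^ 2 :* a :^ 2 :- L :^ 3 :* M :* a :- L :^ 4 :* M :^ 2
                 :+ M :^ 2 :- M :^ 2 :* a :^ 2 :* d :- M :^ 4 :* a :* d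
                 :+ M :^ 4 :* d :- M :^ 4 :* e :- a :^ 2) :* (e :- A :* d)
             :+ (con 𝟙 :+ L :* M :^ 3 :* d :+ L :^ 2 :- L :^ 2 :* M :^ 2 :* d :+ L :^ 4 :- L :^ 4 :* M :^ 2 :* d
                 :+ M :^ 2 :* a :* d :- M :^ 2 :* d :+ a) :* ((M :^ 2 :- a :^ 2) :* d :- con 𝟙)) refl p e d L M a)
          (multiple (L * M - L * M ^ 3 * a * d + L * M ^ 3 * e - L ^ 2 * M ^ 2 * a * e + L ^ 2 * M ^ 4 * d - L ^ 2 * a + L ^ 3 * M - L ^ 3 * M ^ 3 * e - L ^ 4 * a + L ^ 5 * M + M ^ 2 * a * e + M ^ 2 * a ^ 2 * d - a) p≈
           ⊹ multiple (L * M * a - L * M ^ 5 * d + L ^ 2 * M ^ 2 * a ^ 2 * d - L ^ 2 * M ^ 4 * d + L ^ 2 * M ^ 4 * e + L ^ 2 * a ^ 2 - L ^ 3 * M * a - L ^ 4 * M ^ 2 + M ^ 2 - M ^ 2 * a ^ 2 * d - M ^ 4 * a * d + M ^ 4 * d - M ^ 4 * e - a ^ 2) e≈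
           ⊹ multiple (1# + L * M ^ 3 * d + L ^ 2 - L ^ 2 * M ^ 2 * d + L ^ 4 - L ^ 4 * M ^ 2 * d + M ^ 2 * a * d - M ^ 2 * d + a) d≈)))

    abstract
      image-collinear : Collinear (X t₁ z₁) (Y z₁) (X t₂ z₂) (Y z₂) (X t₃ z₃) (Y z₃)
      image-collinear = collinear κ′ μ′ (on′ root₁ z₁-line) (on′ root₂ z₂-line) (on′ root₃ z₃-line) σ₁′ σ₂′ σ₃′

  abstract
    -- A 3-torsion third point makes σ₃ zero, so M² = a². Then w = z₁ + z₂ satisfies a w = M, hence
    -- w² = 1. Now Y z₁ + Y z₂ = w³ - w = 0, and X agrees because z₁ - z₂ = M (t₁ - t₂) and M w = a.
    image-opposite : ∀ {s₁ v₁ s₂ v₂ s₃ v₃ t₁ z₁ t₂ z₂} → Cubed s₁ v₁ s₂ v₂ s₃ v₃ → s₃ ≈ 0# →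
                     s₁ * t₁ ≈ 1# → s₂ * t₂ ≈ 1# → z₁ ≈ v₁ * t₁ → z₂ ≈ v₂ * t₂ →
                     X t₁ z₁ ≈ X t₂ z₂ × Y z₁ ≈ - Y z₂
    image-opposite {s₁} {v₁} {s₂} {v₂} {s₃} {v₃} {t₁} {z₁} {t₂} {z₂} l s₃≈0 st₁ st₂ z₁≈ z₂≈ = X≈ , Y≈
      where
      open Cubed l
      M²≈a² : M ^ 2 ≈ a ^ 2
      M²≈a² = sym (x-y≈0⇒x≈y _ _ (trans (solve 2 (λ x y → x :- y := :- (y :- x)) refl (a ^ 2) (M ^ 2))
        (trans (-‿cong (trans (sym σ₃) (trans (*-congˡ s₃≈0) (zeroʳ _)))) -0#≈0#)))
      s₁+s₂ : s₁ + s₂ ≈ L ^ 2 - 1#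
      s₁+s₂ = trans (trans (sym (+-identityʳ _)) (+-congˡ (sym s₃≈0))) σ₁
      s₁s₂ : s₁ * s₂ ≈ L * M - a
      s₁s₂ = trans (from-combination (solve 3 (λ x y z → x :* y :- (x :* y :+ y :* z :+ z :* x) := :- (x :+ y) :*
          (z :- con 𝟘)) refl s₁ s₂ s₃)
        (multiple (- (s₁ + s₂)) s₃≈0)) σ₂
      w u : Carrier
      w = z₁ + z₂
      z₁-line : z₁ ≈ L + M * t₁
      z₁-line = z-on-line st₁ z₁≈ on₁
      z₂-line : z₂ ≈ L + M * t₂
      z₂-line = z-on-line st₂ z₂≈ on₂
      u = t₁ * t₂
      t₁+t₂ : t₁ + t₂ ≈ (L ^ 2 - 1#) * u
      t₁+t₂ = trans (from-combination (solve 4 (λ s₁ s₂ t₁ t₂ → t₁ :+ t₂ :- (s₁ :+ s₂) :* (t₁ :* t₂) :=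
          :- t₂ :* (s₁ :* t₁ :- con 𝟙) :+ :- t₁ :* (s₂ :* t₂ :- con 𝟙)) refl s₁ s₂ t₁ t₂)
        (multiple (- t₂) st₁ ⊹ multiple (- t₁) st₂)) (*-congʳ s₁+s₂)
      u≈ : (L * M - a) * u ≈ 1#
      u≈ = trans (*-congʳ (sym s₁s₂)) (from-combination (solve 4 (λ s₁ s₂ t₁ t₂ → s₁ :* s₂ :* (t₁ :* t₂) :- con 𝟙 :=
          (s₂ :* t₂) :* (s₁ :* t₁ :- con 𝟙) :+ con 𝟙 :* (s₂ :* t₂ :- con 𝟙)) refl s₁ s₂ t₁ t₂)
        (multiple (s₂ * t₂) st₁ ⊹ multiple 1# st₂))
      aw≈M : a * w ≈ M
      aw≈M = *-cancelˡ-nonzero a a≉0 (trans (*-congˡ (*-congˡ (+-cong z₁-line z₂-line))) (from-combination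
        (solve 6 (λ t₁ t₂ u L M a →
           a :* (a :* (L :+ M :* t₁ :+ (L :+ M :* t₂))) :- a :* M :=
           (a :^ 2 :* M) :* (t₁ :+ t₂ :- (L :^ 2 :- con 𝟙) :* u)
           :+ (:- (M :* L :^ 2 :* u) :+ L) :* (M :^ 2 :- a :^ 2)
           :+ (M :* (L :* M :+ a)) :* ((L :* M :- a) :* u :- con 𝟙)) refl t₁ t₂ u L M a)
        (multiple (a ^ 2 * M) t₁+t₂ ⊹ multiple (- (M * L ^ 2 * u) + L) M²≈a² ⊹ multiple (M * (L * M + a)) u≈)))
      w²≈1 : w ^ 2 ≈ 1#
      w²≈1 = *-cancelˡ-nonzero (a ^ 2) (x^n≉0 2 a≉0) (trans (solve 2 (λ a w → a :^ 2 :* w :^ 2 :=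
          (a :* w) :^ 2) refl a w)
        (trans (^-congˡ 2 aw≈M) (trans M²≈a² (sym (*-identityʳ _)))))
      Mw≈a : M * w ≈ a
      Mw≈a = trans (*-congʳ (sym aw≈M)) (trans (solve 2 (λ a w → a :* w :* w := a :* w :^ 2) refl a w) (trans
          (*-congˡ w²≈1) (*-identityʳ a)))
      Y≈ : Y z₁ ≈ - Y z₂
      Y≈ = from-combination (solve 2 (λ x y → x :^ 3 :- x :- :- (y :^ 3 :- y) := (x :+ y) :* ((x
          :+ y) :^ 2 :- con 𝟙)) refl z₁ z₂)
        (multiple w w²≈1)
      X≈ : X t₁ z₁ ≈ X t₂ z₂
      X≈ = from-combination
        (solve 7 (λ t₁ t₂ z₁ z₂ L M a →
           z₁ :^ 2 :- con 𝟙 :- a :* t₁ :- (z₂ :^ 2 :- con 𝟙 :- a :* t₂) :=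
           (z₁ :+ z₂) :* (z₁ :- (L :+ M :* t₁)) :+ :- (z₁ :+ z₂) :* (z₂ :- (L :+ M :* t₂)) :+ (t₁ :- t₂) :* (M :*
               (z₁ :+ z₂) :- a)) refl t₁ t₂ z₁ z₂ L M a)
        (multiple w z₁-line ⊹ multiple (- w) z₂-line ⊹ multiple (t₁ - t₂) Mw≈a)

  abstract
    -- With s₁ = s₂ = 0, `σ₂` gives L M = a and `σ₃` gives M² = a². Hence L² = 1, and `σ₁` becomes
    -- s₃ = 0.
    torsion-third : ∀ {s₁ v₁ s₂ v₂ s₃ v₃} → Cubed s₁ v₁ s₂ v₂ s₃ v₃ → s₁ ≈ 0# → s₂ ≈ 0# → s₃ ≈ 0#
    torsion-third {s₁} {v₁} {s₂} {v₂} {s₃} l s₁≈0 s₂≈0 = *-cancelˡ-nonzero (a ^ 2) (x^n≉0 2 a≉0) (from-combination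
      (solve 6 (λ s₁ s₂ s₃ L M a → a :^ 2 :* s₃ :- a :^ 2 :* con 𝟘 :=
         (a :^ 2) :* (s₁ :+ s₂ :+ s₃ :- (L :^ 2 :- con 𝟙)) :+ (:- (a :^ 2) :- s₂ :* s₃ :* L :^ 2 :+ (L :* M
             :+ a) :* (s₂ :+ s₃)) :* (s₁ :- con 𝟘)
         :+ (:- (a :^ 2) :+ (L :* M :+ a) :* s₃) :* (s₂ :- con 𝟘)
         :+ L :^ 2 :* (s₁ :* s₂ :* s₃ :- (M :^ 2 :- a :^ 2))
         :+ :- (L :* M :+ a) :* (s₁ :* s₂ :+ s₂ :* s₃ :+ s₃ :* s₁ :- (L :* M :- a))) refl s₁ s₂ s₃ L M a)
      (multiple (a ^ 2) σ₁ ⊹ multiple (- (a ^ 2) - s₂ * s₃ * L ^ 2 + (L * M + a) * (s₂ + s₃)) s₁≈0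
        ⊹ multiple (- (a ^ 2) + (L * M + a) * s₃) s₂≈0 ⊹ multiple (L ^ 2) σ₃ ⊹ multiple (- (L * M + a)) σ₂))
      where open Cubed l

-- The points of the curve as a finite loop with tripling.

module CurveTheory {c ℓ : Level} (m : ℕ) (0<m : 0 ℕ.< m) (F : FiniteField c ℓ (3 ℕ.^ m))
  (a : FiniteField.Carrier F) (a≉0 : FiniteField._≉_ F a (FiniteField.0# F)) where
  open TernaryField m 0<m F
  open CollinearTheory m 0<m F a a≉0
  open TripleTheory m 0<m F a a≉0

  data Point : Set (c ⊔ ℓ) where
    O  : Point
    pt : ∀ x y → E a (x , y) → Point

  infix 4 _≋_
  data _≋_ : Point → Point → Set (c ⊔ ℓ) where
    O≋  : O ≋ O
    pt≋ : ∀ {x y u v e e′} → x ≈ u → y ≈ v → pt x y e ≋ pt u v e′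

  ≋-refl : ∀ {P} → P ≋ P
  ≋-refl {O}        = O≋
  ≋-refl {pt _ _ _} = pt≋ refl refl

  ≋-sym : ∀ {P Q} → P ≋ Q → Q ≋ P
  ≋-sym O≋        = O≋
  ≋-sym (pt≋ p q) = pt≋ (sym p) (sym q)

  ≋-trans : ∀ {P Q R} → P ≋ Q → Q ≋ R → P ≋ R
  ≋-trans O≋        O≋          = O≋
  ≋-trans (pt≋ p q) (pt≋ p′ q′) = pt≋ (trans p p′) (trans q q′)

  Points : Setoid _ _
  Points = record { Carrier = Point ; _≈_ = _≋_ ; isEquivalence = record { refl = ≋-refl ; sym = ≋-sym ; trans = ≋-trans } }

  -- The constructor names show which of the three points are at infinity.
  data Chord : Point → Point → Point → Set (c ⊔ ℓ) where
    ooo  : Chord O O O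
    opp  : ∀ {x y u v e e′} → x ≈ u → y ≈ - v → Chord O (pt x y e) (pt u v e′)
    pop  : ∀ {x y u v e e′} → x ≈ u → y ≈ - v → Chord (pt x y e) O (pt u v e′)
    ppo  : ∀ {x y u v e e′} → x ≈ u → y ≈ - v → Chord (pt x y e) (pt u v e′) O
    line : ∀ {x₁ y₁ x₂ y₂ x₃ y₃ e₁ e₂ e₃} → Collinear x₁ y₁ x₂ y₂ x₃ y₃ → Chord (pt x₁ y₁ e₁) (pt x₂ y₂ e₂)
        (pt x₃ y₃ e₃)

  ≈-neg-sym : ∀ {x y} → x ≈ - y → y ≈ - x
  ≈-neg-sym eq = trans (sym (-‿involutive _)) (-‿cong (sym eq))

  swap : ∀ {P Q R} → Chord P Q R → Chord Q P R
  swap ooo       = ooo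
  swap (opp p q) = pop p q
  swap (pop p q) = opp p q
  swap (ppo p q) = ppo (sym p) (≈-neg-sym q)
  swap (line l)  = line (Collinear-swap l)

  rotate : ∀ {P Q R} → Chord P Q R → Chord Q R P
  rotate ooo       = ooo
  rotate (opp p q) = ppo p q
  rotate (pop p q) = opp (sym p) (≈-neg-sym q)
  rotate (ppo p q) = pop (sym p) (≈-neg-sym q)
  rotate (line l)  = line (Collinear-rotate l)

  Chord-unique : ∀ {P Q R P′ Q′ R′} → P ≋ P′ → Q ≋ Q′ → Chord P Q R → Chord P′ Q′ R′ → R ≋ R′
  Chord-unique O≋ O≋ ooo ooo = O≋
  Chord-unique O≋ (pt≋ p q) (opp r s) (opp r′ s′) = pt≋ (trans (sym r) (trans p r′)) (trans (≈-neg-sym s) (trans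
      (-‿cong q) (sym (≈-neg-sym s′))))
  Chord-unique (pt≋ p q) O≋ (pop r s) (pop r′ s′) = pt≋ (trans (sym r) (trans p r′)) (trans (≈-neg-sym s) (trans
      (-‿cong q) (sym (≈-neg-sym s′))))
  Chord-unique (pt≋ _ _) (pt≋ _ _) (ppo _ _) (ppo _ _) = O≋
  Chord-unique (pt≋ p q) (pt≋ p′ q′) (ppo r s) (line {e₁ = e₁} l) =
    contradiction (trans (sym q′) (trans (≈-neg-sym s) (-‿cong q))) (not-vertical l e₁ (trans (sym p′) (trans
        (sym r) p)))
  Chord-unique (pt≋ p q) (pt≋ p′ q′) (line {e₁ = e₁} l) (ppo r s) =
    contradiction (trans q′ (trans (≈-neg-sym s) (-‿cong (sym q)))) (not-vertical l e₁ (trans p′ (trans (sym r)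
        (sym p))))
  Chord-unique (pt≋ p q) (pt≋ p′ q′) (line l) (line {e₁ = e₁} l′)
    with x≈ , y≈ ← third-unique (Collinear-resp p q p′ q′ refl refl l) l′ e₁ = pt≋ x≈ y≈

  neg : Point → Point
  neg O          = O
  neg (pt x y e) = pt x (- y) (trans (solve 1 (λ y → (:- y) :^ 2 := y :^ 2) refl y) e)

  third : ∀ P Q → ∃ λ R → Chord P Q R
  third O O = O , ooo
  third O (pt x y e) = neg (pt x y e) , opp refl (sym (-‿involutive y))
  third (pt x y e) O = neg (pt x y e) , pop refl (sym (-‿involutive y))
  third (pt x₁ y₁ e₁) (pt x₂ y₂ e₂) = by-cases (x₂ ≟ x₁) (y₁ ≟ - y₂)
    where
    on-line : (∃ λ x₃ → ∃ λ y₃ → E a (x₃ , y₃) × Collinear x₁ y₁ x₂ y₂ x₃ y₃) →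
              ∃ λ R → Chord (pt x₁ y₁ e₁) (pt x₂ y₂ e₂) R
    on-line (x₃ , y₃ , e₃ , l) = pt x₃ y₃ e₃ , line l
    by-cases : Dec (x₂ ≈ x₁) → Dec (y₁ ≈ - y₂) → ∃ λ R → Chord (pt x₁ y₁ e₁) (pt x₂ y₂ e₂) R
    by-cases (no x₂≉x₁)  _           = on-line (chord e₁ e₂ x₂≉x₁)
    by-cases (yes x₂≈x₁) (yes y₁≈-y₂) = O , ppo (sym x₂≈x₁) y₁≈-y₂
    -- Equal x-coordinates leave y₂ = y₁ or y₂ = -y₁, so the points coincide; y₁ = 0 would make them
    -- opposite.
    by-cases (yes x₂≈x₁) (no y₁≉-y₂)  = on-line (tangent e₁ x₂≈x₁ y₂≈y₁
      λ y₁≈0 → y₁≉-y₂ (trans y₁≈0 (trans (sym -0#≈0#) (-‿cong (sym (trans y₂≈y₁ y₁≈0))))))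
      where
      y₂≈y₁ : y₂ ≈ y₁
      y₂≈y₁ = [ (λ eq → eq) , (λ y₂≈-y₁ → contradiction (≈-neg-sym y₂≈-y₁) y₁≉-y₂) ]′
        (x²≈y²⇒x≈±y (trans e₂ (trans (+-congʳ (+-cong (^-congˡ 3 x₂≈x₁) (^-congˡ 2 x₂≈x₁))) (sym e₁))))

  _∙_ : Point → Point → Point
  P ∙ Q = proj₁ (third P Q)

  Chord-∙ : ∀ P Q → Chord P Q (P ∙ Q)
  Chord-∙ P Q = proj₂ (third P Q)

  ∙-unique : ∀ {P Q R} → Chord P Q R → P ∙ Q ≋ R
  ∙-unique {P} {Q} c = Chord-unique ≋-refl ≋-refl (Chord-∙ P Q) c

  -- The torsion test is an argument so that statements about several points can run through all
  -- combinations of its outcomes.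
  T-at : ∀ x y → E a (x , y) → Dec (x ^ 3 - a ≈ 0#) → Point
  T-at x y e (yes _)  = O
  T-at x y e (no s≉0) = pt (X t z) (Y z) (X-on-curve (triples (*-inverse s≉0) refl) e)
    where
    t = (x ^ 3 - a) ⁻¹
    z = y ^ 3 * t

  T : Point → Point
  T O          = O
  T (pt x y e) = T-at x y e (x ^ 3 - a ≟ 0#)

  T-at-opposite : ∀ {x y u v} e e′ (d : Dec (x ^ 3 - a ≈ 0#)) (d′ : Dec (u ^ 3 - a ≈ 0#)) → x ≈ u → y ≈ - v →
                  Chord O (T-at x y e d) (T-at u v e′ d′)
  T-at-opposite e e′ (yes _) (yes _) _ _ = ooo
  T-at-opposite e e′ (yes s≈0) (no s≉0) x≈u _ = contradiction (trans (+-congʳ (^-congˡ 3 (sym x≈u))) s≈0) s≉0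
  T-at-opposite e e′ (no s≉0) (yes s≈0) x≈u _ = contradiction (trans (+-congʳ (^-congˡ 3 x≈u)) s≈0) s≉0
  T-at-opposite {x} {y} {u} {v} e e′ (no _) (no _) x≈u y≈-v = opp
    (+-cong (+-congʳ (trans (^-congˡ 2 z≈-z) (solve 1 (λ z → (:- z) :^ 2 := z :^ 2) refl _))) (-‿cong (*-congˡ t≈)))
    (trans (+-cong (^-congˡ 3 z≈-z) (-‿cong z≈-z)) (solve 1 (λ z → (:- z) :^ 3 :- :- z := :- (z :^ 3 :- z)) refl _))
    where
    t≈ : (x ^ 3 - a) ⁻¹ ≈ (u ^ 3 - a) ⁻¹
    t≈ = ⁻¹-cong (+-congʳ (^-congˡ 3 x≈u))
    z≈-z : y ^ 3 * (x ^ 3 - a) ⁻¹ ≈ - (v ^ 3 * (u ^ 3 - a) ⁻¹)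
    z≈-z = trans (*-cong (^-congˡ 3 y≈-v) t≈) (solve 2 (λ v t → (:- v) :^ 3 :* t := :- (v :^ 3 :* t)) refl v _)

  -- Sorted by how many of the three points are 3-torsion: all three map to O, exactly two cannot
  -- occur, one leaves the other two with opposite images, and none is the generic case.
  T-at-line : ∀ {x₁ y₁ x₂ y₂ x₃ y₃} e₁ e₂ e₃ (d₁ : Dec (x₁ ^ 3 - a ≈ 0#)) (d₂ : Dec (x₂ ^ 3 - a ≈ 0#)) (d₃ : Dec
      (x₃ ^ 3 - a ≈ 0#)) →
              Collinear x₁ y₁ x₂ y₂ x₃ y₃ → Chord (T-at x₁ y₁ e₁ d₁) (T-at x₂ y₂ e₂ d₂) (T-at x₃ y₃ e₃ d₃)
  T-at-line e₁ e₂ e₃ (yes s₁≈0) (yes s₂≈0) (yes s₃≈0) l = ooo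
  T-at-line e₁ e₂ e₃ (yes s₁≈0) (yes s₂≈0) (no s₃≉0) l = contradiction (torsion-third (cubed l) s₁≈0 s₂≈0) s₃≉0
  T-at-line e₁ e₂ e₃ (yes s₁≈0) (no s₂≉0) (yes s₃≈0) l =
    contradiction (torsion-third (cubed (Collinear-rotate (Collinear-rotate l))) s₃≈0 s₁≈0) s₂≉0
  T-at-line e₁ e₂ e₃ (no s₁≉0) (yes s₂≈0) (yes s₃≈0) l =
    contradiction (torsion-third (cubed (Collinear-rotate l)) s₂≈0 s₃≈0) s₁≉0
  T-at-line e₁ e₂ e₃ (no s₁≉0) (no s₂≉0) (yes s₃≈0) l
    with x≈ , y≈ ← image-opposite (cubed l) s₃≈0 (*-inverse s₁≉0) (*-inverse s₂≉0) refl refl = ppo x≈ y≈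
  T-at-line e₁ e₂ e₃ (yes s₁≈0) (no s₂≉0) (no s₃≉0) l
    with x≈ , y≈ ← image-opposite (cubed (Collinear-rotate l)) s₁≈0 (*-inverse s₂≉0)
        (*-inverse s₃≉0) refl refl = opp x≈ y≈
  T-at-line e₁ e₂ e₃ (no s₁≉0) (yes s₂≈0) (no s₃≉0) l
    with x≈ , y≈ ← image-opposite (cubed (Collinear-rotate (Collinear-swap l))) s₂≈0 (*-inverse s₁≉0)
        (*-inverse s₃≉0) refl refl = pop x≈ y≈
  T-at-line e₁ e₂ e₃ (no s₁≉0) (no s₂≉0) (no s₃≉0) l =
    line (Generic.image-collinear (cubed l) (*-inverse s₁≉0) (*-inverse s₂≉0) (*-inverse s₃≉0) refl refl refl)

  T-Chord : ∀ {P Q R} → Chord P Q R → Chord (T P) (T Q) (T R)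
  T-Chord ooo = ooo
  T-Chord (opp {x} {y} {u} {v} {e} {e′} p q) = T-at-opposite e e′ (x ^ 3 - a ≟ 0#) (u ^ 3 - a ≟ 0#) p q
  T-Chord (pop {x} {y} {u} {v} {e} {e′} p q) = swap (T-at-opposite e e′ (x ^ 3 - a ≟ 0#) (u ^ 3 - a ≟ 0#) p q)
  T-Chord (ppo {x} {y} {u} {v} {e} {e′} p q) = rotate (T-at-opposite e e′ (x ^ 3 - a ≟ 0#) (u ^ 3 - a ≟ 0#) p q)
  T-Chord (line {x₁} {y₁} {x₂} {y₂} {x₃} {y₃} {e₁} {e₂} {e₃} l) =
    T-at-line e₁ e₂ e₃ (x₁ ^ 3 - a ≟ 0#) (x₂ ^ 3 - a ≟ 0#) (x₃ ^ 3 - a ≟ 0#) l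

  T-at-cong : ∀ {x y u v} e e′ (d : Dec (x ^ 3 - a ≈ 0#)) (d′ : Dec
      (u ^ 3 - a ≈ 0#)) → x ≈ u → y ≈ v → T-at x y e d ≋ T-at u v e′ d′
  T-at-cong e e′ (yes _) (yes _) _ _ = O≋
  T-at-cong e e′ (yes s≈0) (no s≉0) x≈u _ = contradiction (trans (+-congʳ (^-congˡ 3 (sym x≈u))) s≈0) s≉0
  T-at-cong e e′ (no s≉0) (yes s≈0) x≈u _ = contradiction (trans (+-congʳ (^-congˡ 3 x≈u)) s≈0) s≉0
  T-at-cong {x} {y} {u} {v} e e′ (no _) (no _) x≈u y≈v = pt≋
    (+-cong (+-congʳ (^-congˡ 2 z≈)) (-‿cong (*-congˡ t≈))) (+-cong (^-congˡ 3 z≈) (-‿cong z≈))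
    where
    t≈ : (x ^ 3 - a) ⁻¹ ≈ (u ^ 3 - a) ⁻¹
    t≈ = ⁻¹-cong (+-congʳ (^-congˡ 3 x≈u))
    z≈ = *-cong (^-congˡ 3 y≈v) t≈

  T-cong : ∀ {P Q} → P ≋ Q → T P ≋ T Q
  T-cong O≋ = O≋
  T-cong (pt≋ {x} {y} {u} {v} {e} {e′} p q) = T-at-cong e e′ (x ^ 3 - a ≟ 0#) (u ^ 3 - a ≟ 0#) p q

  T-torsion : ∀ {x y e} → x ^ 3 ≈ a → T (pt x y e) ≋ O
  T-torsion {x} {y} {e} x³≈a = at (x ^ 3 - a ≟ 0#)
    where
    at : (d : Dec (x ^ 3 - a ≈ 0#)) → T-at x y e d ≋ O
    at (yes _)  = O≋
    at (no s≉0) = contradiction (x≈y⇒x-y≈0 x³≈a) s≉0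

  T≋O⇒torsion : ∀ {x y e} → T (pt x y e) ≋ O → x ^ 3 ≈ a
  T≋O⇒torsion {x} {y} {e} = at (x ^ 3 - a ≟ 0#)
    where
    at : (d : Dec (x ^ 3 - a ≈ 0#)) → T-at x y e d ≋ O → x ^ 3 ≈ a
    at (yes s≈0) _ = x-y≈0⇒x≈y _ _ s≈0

  -- With x₁ = x₂ = x₃ = x the left sides of `σ₁` and `σ₂` are multiples of 3. So κ² = 1 and κ μ =
  -- 0, whence μ = 0, and `σ₃` reads x³ = a.
  flex : ∀ P → P ∙ P ≋ P → T P ≋ O
  flex O _ = O≋
  flex P@(pt x y e) P∙P≋P = at (Chord-∙ P P) P∙P≋P
    where
    at : ∀ {R} → Chord P P R → R ≋ P → T P ≋ O
    at (line l) (pt≋ p q) with collinear κ μ on₁ on₂ on₃ σ₁ σ₂ σ₃ ← Collinear-resp refl refl refl refl p q l =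
      T-torsion {x} {y} {e} (trans (trans (solve 1 (λ x → x :^ 3 := x :* x :* x) refl x) σ₃)
        (trans (+-congˡ (trans (^-congˡ 2 μ≈0) (zeroˡ _))) (+-identityʳ a)))
      where
      κ²≈1 : κ ^ 2 ≈ 1#
      κ²≈1 = x-y≈0⇒x≈y _ _ (trans (sym σ₁) (solve 1 (λ x → x :+ x :+ x := con 𝟘) refl x))
      μ≈0 : μ ≈ 0#
      μ≈0 = from-combination
        (solve 3 (λ x κ μ → μ :- con 𝟘 := :- μ :* (κ :^ 2 :- con 𝟙) :+ :- κ :* (x :* x :+ x :* x
            :+ x :* x :- κ :* μ)) refl x κ μ)
        (multiple (- μ) κ²≈1 ⊹ multiple (- κ) σ₂)

  r = ∛ a

  on-curve-τ : E a (r , r)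
  on-curve-τ = from-combination
    (solve 2 (λ r a → r :^ 2 :- (r :^ 3 :+ r :^ 2 :- a) := con 𝟚 :* (r :^ 3 :- a)) refl r a) (multiple (- 1#)
        (∛-cubed a))

  τ : Point
  τ = pt r r on-curve-τ

  r≉0 : r ≉ 0#
  r≉0 r≈0 = a≉0 (trans (sym (∛-cubed a)) (trans (^-congˡ 3 r≈0) (zeroˡ _)))

  torsion-point : ∀ {x y e} → x ≈ r → pt x y e ≋ τ ⊎ pt x y e ≋ τ ∙ O
  torsion-point {x} {y} {e} x≈r = [ (λ y≈r → inj₁ (pt≋ x≈r y≈r)) , (λ y≈-r → inj₂ (pt≋ x≈r y≈-r)) ]′ (x²≈y²⇒x≈±y
      (trans e
    (trans (+-congʳ (+-cong (trans (^-congˡ 3 x≈r) (∛-cubed a)) (^-congˡ 2 x≈r))) (solve 2 (λ a b → a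
        :+ b :- a := b) refl a (r ^ 2)))))

  T-kernel : ∀ P → T P ≋ O → P ≋ O ⊎ P ≋ τ ⊎ P ≋ τ ∙ O
  T-kernel O          _    = inj₁ O≋
  T-kernel (pt x y e) TP≋O = inj₂ (torsion-point (cube-injective (trans (T≋O⇒torsion {x} {y} {e} TP≋O) (sym
      (∛-cubed a)))))

  τ≉-τ : ¬ τ ≋ τ ∙ O
  τ≉-τ (pt≋ _ r≈-r) = r≉0 (x≈-x⇒x≈0 r≈-r)

  on-curve? : ∀ x y → Dec (E a (x , y))
  on-curve? x y = y ^ 2 ≟ x ^ 3 + x ^ 2 - a

  private
    -- A cell of the grid has as many positions as its indicator says, so all proofs that a pair
    -- lies on the curve share one number.
    mark : ∀ {p} {P : Set p} (p? : Dec P) → P → Fin ⟦ p? ⟧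
    mark (yes _)  _ = zero
    mark (no ¬p) p = contradiction p ¬p

    unmark : ∀ {p} {P : Set p} (p? : Dec P) → Fin ⟦ p? ⟧ → P
    unmark (yes p) _ = p

    mark-unique : ∀ {p} {P : Set p} (p? : Dec P) (x : P) k → mark p? x ≡ k
    mark-unique (yes _) _ zero = ≡.refl
    mark-unique (no ¬p) p _    = contradiction p ¬p

    cell? : ∀ i j → Dec (E a (element i , element j))
    cell? i j = on-curve? (element i) (element j)

    row : Fin q → Fin q → ℕ
    row i j = ⟦ cell? i j ⟧

    rows : Fin q → ℕ
    rows i = sum (row i)

  N : ℕ
  N = suc (sum rows)

  N≡ : N ≡ suc (∑ λ x → ∑ λ y → ⟦ on-curve? x y ⟧)
  N≡ = ≡.cong suc (≡.sym (≡.trans (∑≡sum λ x → ∑ λ y → ⟦ on-curve? x y ⟧)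
    (sum-cong-≗ λ i → ∑≡sum λ y → ⟦ on-curve? (element i) y ⟧)))

  enumeratePoints : Inverse Points (≡.setoid (Fin N))
  enumeratePoints = record
    { to = to ; from = from ; to-cong = to-cong ; from-cong = λ { ≡.refl → ≋-refl }
    ; inverse = (λ {k} eq → ≡.trans (to-cong eq) (to∘from k)) , (λ {P} eq → ≋-trans (≡⇒≋ (≡.cong from eq))
        (from∘to P)) }
    where
    ≡⇒≋ : ∀ {P Q} → P ≡ Q → P ≋ Q
    ≡⇒≋ ≡.refl = ≋-refl
    position : ∀ i j → E a (element i , element j) → Fin (sum rows)
    position i j e = fromΣ rows i (fromΣ (row i) j (mark (cell? i j) e))
    position-cong : ∀ {i i′ j j′} {e e′} → i ≡ i′ → j ≡ j′ → position i j e ≡ position i′ j′ e′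
    position-cong {i} {_} {j} {_} {e} {e′} ≡.refl ≡.refl =
      ≡.cong (λ k → fromΣ rows i (fromΣ (row i) j k)) (mark-unique (cell? i j) e (mark (cell? i j) e′))
    to-cell : ∀ {x y} → E a (x , y) → E a (element (index x) , element (index y))
    to-cell {x} {y} e = trans (^-congˡ 2 (element-index y)) (trans e
      (sym (+-congʳ (+-cong (^-congˡ 3 (element-index x)) (^-congˡ 2 (element-index x))))))
    to : Point → Fin N
    to O          = zero
    to (pt x y e) = suc (position (index x) (index y) (to-cell e))
    to-cong : ∀ {P Q} → P ≋ Q → to P ≡ to Q
    to-cong O≋        = ≡.refl
    to-cong (pt≋ p q) = ≡.cong suc (position-cong (index-cong p) (index-cong q))
    decode-cell : ∀ i → ∃ (λ j → Fin (row i j)) → Point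
    decode-cell i (j , l) = pt (element i) (element j) (unmark (cell? i j) l)
    decode : ∃ (λ i → Fin (rows i)) → Point
    decode (i , k) = decode-cell i (toΣ (row i) k)
    from : Fin N → Point
    from zero    = O
    from (suc k) = decode (toΣ rows k)
    from∘to : ∀ P → from (to P) ≋ P
    from∘to O = O≋
    from∘to (pt x y e) = ≋-trans
      (≡⇒≋ (≡.trans (≡.cong decode (toΣ∘fromΣ rows (index x) _)) (≡.cong (decode-cell (index x)) (toΣ∘fromΣ (row
          (index x)) (index y) _))))
      (pt≋ (element-index x) (element-index y))
    to∘decode-cell : ∀ i j l → to (decode-cell i (j , l)) ≡ suc (fromΣ rows i (fromΣ (row i) j l))
    to∘decode-cell i j l = ≡.cong suc (≡.trans (position-cong {e′ = unmark (cell? i j) l} (index-element i)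
        (index-element j))
      (≡.cong (λ k → fromΣ rows i (fromΣ (row i) j k)) (mark-unique (cell? i j) _ l)))
    to∘from : ∀ k → to (from k) ≡ k
    to∘from zero    = ≡.refl
    to∘from (suc k) = ≡.trans (to∘decode-cell i j l) (≡.cong suc (≡.trans
      (≡.cong (fromΣ rows i) (fromΣ∘toΣ (row i) k′)) (fromΣ∘toΣ rows k)))
      where
      i = proj₁ (toΣ rows k)
      k′ = proj₂ (toΣ rows k)
      j = proj₁ (toΣ (row i) k′)
      l = proj₂ (toΣ (row i) k′)

  loop : TSLoop (c ⊔ ℓ) (c ⊔ ℓ) N
  loop = record
    { points = Points ; enumeration = enumeratePoints ; _∙_ = _∙_
    ; ∙-cong = λ {P} {P′} {Q} {Q′} p q → Chord-unique p q (Chord-∙ P Q) (Chord-∙ P′ Q′)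
    ; ∙-comm = λ P Q → ∙-unique (swap (Chord-∙ Q P))
    ; ∙-involutive = λ P Q → ∙-unique (rotate (swap (Chord-∙ P Q)))
    ; O = O ; O∙O≈O = O≋ }

  tripling : Tripling loop
  tripling = record
    { T = T ; T-cong = T-cong ; T-homo = λ P Q → ≋-sym (∙-unique (T-Chord (Chord-∙ P Q)))
    ; flex = flex ; τ = τ ; τ≉O = λ () ; τ≉-τ = τ≉-τ ; Tτ≈O = T-torsion {r} {r} {on-curve-τ}
        (∛-cubed a) ; kernel = T-kernel }

-- The Kloosterman sum and the number of points.

module _ where
  open ℤ.+-*-Solver using (solve; _:+_; _:-_; _:=_; con)

  1+[x-y] : ∀ x y → 1ℤ ℤ.+ (x ℤ.- y) ≡ 1ℤ ℤ.+ x ℤ.- y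
  1+[x-y] = solve 2 (λ x y → con 1ℤ :+ (x :- y) := con 1ℤ :+ x :- y) ≡.refl

  -1+[x-y] : ∀ x y → ℤ.-1ℤ ℤ.+ (x ℤ.- y) ≡ x ℤ.- (1ℤ ℤ.+ y)
  -1+[x-y] = solve 2 (λ x y → con ℤ.-1ℤ :+ (x :- y) := x :- (con 1ℤ :+ y)) ≡.refl

  balance : ∀ {x y u v} → x ℕ.+ y ≡ u ℕ.+ v → + u ℤ.- + y ≡ + x ℤ.- + v
  balance {x} {y} {u} {v} eq = begin
    + u ℤ.- + y                       ≡⟨ solve 3 (λ u v y → u :- y := u :+ v :- (y :+ v)) ≡.refl (+ u) (+ v) (+ y) ⟩
    + (u ℕ.+ v) ℤ.- (+ y ℤ.+ + v)     ≡⟨ ≡.cong (λ k → + k ℤ.- (+ y ℤ.+ + v)) eq ⟨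
    + (x ℕ.+ y) ℤ.- (+ y ℤ.+ + v)     ≡⟨ solve 3 (λ x y v → x :+ y :- (y :+ v) := x :- v) ≡.refl (+ x) (+ y) (+ v) ⟩
    + x ℤ.- + v                       ∎
    where
    open ≡.≡-Reasoning
    open ℤ.+-*-Solver using (solve; _:+_; _:-_; _:=_)

-- Eliminates the covering count k. Here c₀ and c₁ count the x for which x + a/x has trace 0 and 1,
-- and n counts affine points; the outcome is twice n + 1 - q = c₀ - c₁, free of subtraction.
arithmetic : ∀ c₀ c₁ n k q → 3 ℕ.* c₀ ≡ 3 ℕ.+ k → k ℕ.+ 2 ℕ.* q ℕ.+ 1 ≡ q ℕ.+ 2 ℕ.* n → c₀ ℕ.+ c₁ ℕ.+ c₁ ≡ q →
             2 ℕ.* (suc n ℕ.+ c₁) ≡ 2 ℕ.* (c₀ ℕ.+ q)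
arithmetic c₀ c₁ n k q h₁ h₂ h₃ = ℕ.+-cancelʳ-≡ (q ℕ.+ c₀) _ _ (begin
  2 ℕ.* (suc n ℕ.+ c₁) ℕ.+ (q ℕ.+ c₀)
    ≡⟨ solve 4 (λ n c₁ q c₀ → con 2 :* (con 1 :+ n :+ c₁) :+ (q :+ c₀) := (q :+ con 2 :* n) :+ (c₀ :+ c₁ :+ c₁)
        :+ con 2) ≡.refl n c₁ q c₀ ⟩
  (q ℕ.+ 2 ℕ.* n) ℕ.+ (c₀ ℕ.+ c₁ ℕ.+ c₁) ℕ.+ 2
    ≡⟨ ≡.cong (ℕ._+ 2) (≡.cong₂ ℕ._+_ (≡.sym h₂) h₃) ⟩
  k ℕ.+ 2 ℕ.* q ℕ.+ 1 ℕ.+ q ℕ.+ 2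
    ≡⟨ solve 2 (λ k q → k :+ con 2 :* q :+ con 1 :+ q :+ con 2 := con 3 :+ k :+ con 3 :* q) ≡.refl k q ⟩
  3 ℕ.+ k ℕ.+ 3 ℕ.* q
    ≡⟨ ≡.cong (ℕ._+ 3 ℕ.* q) h₁ ⟨
  3 ℕ.* c₀ ℕ.+ 3 ℕ.* q
    ≡⟨ solve 2 (λ c₀ q → con 3 :* c₀ :+ con 3 :* q := con 2 :* (c₀ :+ q) :+ (q :+ c₀)) ≡.refl c₀ q ⟩
  2 ℕ.* (c₀ ℕ.+ q) ℕ.+ (q ℕ.+ c₀) ∎)
  where
  open ≡.≡-Reasoning
  open ℕ.+-*-Solver using (solve; _:+_; _:*_; _:=_; con)

module KloostermanTheory {c ℓ : Level} (m : ℕ) (0<m : 0 ℕ.< m) (F : FiniteField c ℓ (3 ℕ.^ m))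
  (a : FiniteField.Carrier F) (a≉0 : FiniteField._≉_ F a (FiniteField.0# F)) where
  open TernaryField m 0<m F
  open TraceTheory m 0<m F

  affine-points : ℕ
  affine-points = ∑ λ x → ∑ λ y → ⟦ y ^ 2 ≟ x ^ 3 + x ^ 2 - a ⟧

  f : Carrier → Carrier
  f x = x + a / x

  f-cong : ∀ {x y} → x ≈ y → f x ≈ f y
  f-cong eq = +-cong eq (*-congˡ (⁻¹-cong eq))

  f0≈0 : ∀ {x} → x ≈ 0# → f x ≈ 0#
  f0≈0 eq = trans (+-cong eq (trans (*-congˡ (trans (⁻¹-cong eq) 0⁻¹≈0)) (zeroʳ a))) (+-identityʳ 0#)

  f-neg : ∀ x → f (- x) ≈ - f x
  f-neg x with x ≟ 0#
  ... | yes x≈0 = trans (f0≈0 (trans (-‿cong x≈0) -0#≈0#)) (trans (sym -0#≈0#) (-‿cong (sym (f0≈0 x≈0))))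
  ... | no  x≉0 = trans (+-congˡ (*-congˡ (sym (⁻¹-unique
      (trans (solve 2 (λ x i → :- x :* :- i := x :* i) refl x (x ⁻¹)) (*-inverse x≉0))))))
    (solve 3 (λ x a i → :- x :+ a :* :- i := :- (x :+ a :* i)) refl x a (x ⁻¹))

  traces : Carrier → ℕ
  traces t = ∑ λ x → ⟦ Tr (f x) ≟ t ⟧

  -- x + a/x is odd, so x ↦ -x exchanges the trace values 1 and -1. This makes the Kloosterman sum
  -- an integer.
  traces-symmetric : traces 1# ≡ traces (- 1#)
  traces-symmetric = ≡.trans (≡.sym (∑-permute (λ eq → ≟-cong (Tr-cong
      (f-cong eq)) refl) -_ -_ -‿cong -‿cong -‿involutive -‿involutive))
    (∑-cong λ x → ⟦⟧-⇔ (Tr (f (- x)) ≟ 1#) (Tr (f x) ≟ - 1#)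
      (λ e → trans (sym (-‿involutive _)) (-‿cong (trans (sym (trans (Tr-cong (f-neg x)) (Tr-neg _))) e)))
      (λ e → trans (trans (Tr-cong (f-neg x)) (Tr-neg _)) (trans (-‿cong e) (-‿involutive 1#))))

  traces-total : traces 0# ℕ.+ traces 1# ℕ.+ traces (- 1#) ≡ q
  traces-total = ≡.trans (≡.sym (≡.trans (∑-+ _ _) (≡.cong (ℕ._+ traces (- 1#)) (∑-+ _ _))))
    (≡.trans (∑-cong λ x → exactly-one-value (Tr-values (f x)) (Tr (f x) ≟ 0#) (Tr (f x) ≟ 1#) (Tr (f x) ≟ - 1#))
      (≡.trans (∑-const 1) (ℕ.*-identityʳ q)))

  -- x² + a = (z³ − z) x is x + a/x = z³ − z; x ≠ 0 is automatic since a ≠ 0.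
  covering : ℕ
  covering = ∑ λ x → ∑ λ z → ⟦ x ^ 2 + a ≟ ℘ z * x ⟧

  -- Each x ≠ 0 of trace 0 carries three values of z. The summand 3 is x = 0, where x + a/x is 0 by
  -- convention while the covering has no point.
  3*traces0 : ∀ {θ} → Tr θ ≉ 0# → 3 ℕ.* traces 0# ≡ 3 ℕ.+ covering
  3*traces0 {θ} Trθ≉0 = ≡.trans (∑-*ˡ 3 _) (≡.trans (∑-cong λ x → at x (x ≟ 0#)) (≡.trans (∑-+ _ _)
    (≡.cong (ℕ._+ covering) (≡.trans (≡.sym (∑-*ˡ 3 _)) (≡.cong (3 ℕ.*_) (∑-indicator 0#))))))
    where
    at : ∀ x (x? : Dec (x ≈ 0#)) → 3 ℕ.* ⟦ Tr (f x) ≟ 0# ⟧ ≡ 3 ℕ.* ⟦ x? ⟧ ℕ.+ ∑ (λ z → ⟦ x ^ 2 + a ≟ ℘ z * x ⟧)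
    at x (yes x≈0) = ≡.trans (≡.cong (3 ℕ.*_) (⟦⟧-yes (Tr (f x) ≟ 0#) (trans (Tr-cong (f0≈0 x≈0)) Tr0≈0)))
      (≡.cong (3 ℕ.+_) (≡.sym (≡.trans (∑-cong λ z → ⟦⟧-no (x ^ 2 + a ≟ ℘ z * x) λ e → a≉0 (trans (sym
          (+-identityˡ a))
        (trans (+-congʳ (sym (trans (^-congˡ 2 x≈0) (zeroˡ _)))) (trans e (trans (*-congˡ x≈0) (zeroʳ _))))))
            (≡.trans (∑-const 0) (ℕ.*-zeroʳ q)))))
    at x (no x≉0) = ≡.trans (≡.sym (℘-fibre Trθ≉0 (f x))) (∑-cong λ z → ⟦⟧-⇔ (℘ z ≟ f x) (x ^ 2 + a ≟ ℘ z * x)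
        (λ e → trans (sym f*x) (*-congʳ (sym e)))
        (λ e → *-cancelˡ-nonzero x x≉0 (trans (*-comm _ _) (trans (sym e) (trans (sym f*x) (*-comm _ _))))))
      where
      f*x : f x * x ≈ x ^ 2 + a
      f*x = trans (solve 3 (λ x a i → (x :+ a :* i) :* x := x :^ 2 :+ a :* (x :* i)) refl x a (x ⁻¹))
        (+-congˡ (trans (*-congˡ (*-inverse x≉0)) (*-identityʳ a)))

  -- (z³ - z)² - a as a function of t = z².
  g : Carrier → Carrier
  g t = t * (t - 1#) ^ 2 - a

  g-cong : ∀ {x y} → x ≈ y → g x ≈ g y
  g-cong eq = +-congʳ (*-cong eq (^-congˡ 2 (+-congʳ eq)))

  covering≡ : covering ≡ ∑ λ t → roots² t ℕ.* roots² (g t)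
  covering≡ = begin
    covering
      ≡⟨ ∑-swap _ ⟩
    ∑ (λ z → ∑ λ x → ⟦ x ^ 2 + a ≟ ℘ z * x ⟧)
      ≡⟨ ∑-cong (λ z → ≡.trans (∑-cong λ x → complete-square (℘ z) x) (∑-translate (λ e → ≟-cong
          (^-congˡ 2 e) refl) (℘ z))) ⟩
    ∑ (λ z → roots² (℘ z ^ 2 - a))
      ≡⟨ ∑-cong (λ z → roots²-cong (solve 2 (λ z a → (z :^ 3 :- z) :^ 2 :- a := z :^ 2 :*
          (z :^ 2 :- con 𝟙) :^ 2 :- a) refl z a)) ⟩
    ∑ (λ z → roots² (g (z ^ 2)))
      ≡⟨ ∑-cong (λ z → ≡.sym (∑-indicator-* (λ e → roots²-cong (g-cong e)) (z ^ 2))) ⟩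
    ∑ (λ z → ∑ λ t → ⟦ t ≟ z ^ 2 ⟧ ℕ.* roots² (g t))
      ≡⟨ ∑-swap _ ⟩
    ∑ (λ t → ∑ λ z → ⟦ t ≟ z ^ 2 ⟧ ℕ.* roots² (g t))
      ≡⟨ ∑-cong (λ t → ≡.trans (∑-cong λ z → ≡.trans (≡.cong (ℕ._* roots² (g t)) (⟦⟧-⇔ (t ≟ z ^ 2)
          (z ^ 2 ≟ t) sym sym)) (ℕ.*-comm _ (roots² (g t))))
           (≡.trans (≡.sym (∑-*ˡ (roots² (g t)) _)) (ℕ.*-comm (roots² (g t)) (roots² t)))) ⟩
    ∑ (λ t → roots² t ℕ.* roots² (g t)) ∎
    where
    open ≡.≡-Reasoning
    -- In 𝔽₃ one has -1/2 = 1 and 1/4 = 1, so the square is that of x + b and the constant is b² -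
    -- a.
    complete-square : ∀ b x → ⟦ x ^ 2 + a ≟ b * x ⟧ ≡ ⟦ (x + b) ^ 2 ≟ b ^ 2 - a ⟧
    complete-square b x = ⟦⟧-⇔ (x ^ 2 + a ≟ b * x) ((x + b) ^ 2 ≟ b ^ 2 - a)
      (λ e → x-y≈0⇒x≈y _ _ (trans (sym difference) (x≈y⇒x-y≈0 e)))
      (λ e → x-y≈0⇒x≈y _ _ (trans difference (x≈y⇒x-y≈0 e)))
      where
      difference : x ^ 2 + a - b * x ≈ (x + b) ^ 2 - (b ^ 2 - a)
      difference = solve 3 (λ x a b → x :^ 2 :+ a :- b :* x := (x :+ b) :^ 2 :- (b :^ 2 :- a)) refl x a b

  -- The substitution t = x + 1 turns t (t - 1)² - a into x³ + x² - a.
  ∑-roots²-g : ∑ (λ t → roots² (g t)) ≡ affine-points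
  ∑-roots²-g = ≡.trans (≡.sym (∑-translate (λ e → roots²-cong (g-cong e)) 1#)) (∑-cong λ x →
    roots²-cong (solve 2 (λ x a → (x :+ con 𝟙) :* (x :+ con 𝟙 :- con 𝟙) :^ 2 :- a := x :^ 3 :+ x :^ 2 :- a) refl x a))

  ∑-cube : ∀ {φ} → Cong φ → ∑ (λ x → φ (x ^ 3)) ≡ ∑ φ
  ∑-cube φ-cong = ∑-permute φ-cong (_^ 3) ∛_ (^-congˡ 3)
    (λ eq → cube-injective (trans (∛-cubed _) (trans eq (sym (∛-cubed _)))))
    ∛-cubed (λ x → cube-injective (∛-cubed (x ^ 3)))

  roots²-cube : ∀ c → roots² (c ^ 3) ≡ roots² c
  roots²-cube c = ≡.trans (≡.sym (∑-cube (λ e → ≟-cong (^-congˡ 2 e) refl)))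
    (∑-cong λ w → ⟦⟧-⇔ ((w ^ 3) ^ 2 ≟ c ^ 3) (w ^ 2 ≟ c)
      (λ e → cube-injective (trans (square-cube w) e)) (λ e → trans (sym (square-cube w)) (^-congˡ 3 e)))
    where
    square-cube : ∀ w → (w ^ 2) ^ 3 ≈ (w ^ 3) ^ 2
    square-cube = solve 1 (λ w → (w :^ 2) :^ 3 := (w :^ 3) :^ 2) refl

  G : Carrier → Carrier
  G u = u ^ 3 + u ^ 2 - a * u + a ^ 2

  G-cong : ∀ {x y} → x ≈ y → G x ≈ G y
  G-cong eq = +-congʳ (+-cong (+-cong (^-congˡ 3 eq) (^-congˡ 2 eq)) (-‿cong (*-congˡ eq)))

  -- v² = G u is the curve with parameter a³ shifted by a, and cubing identifies it with the original curve.
  ∑-roots²-G : ∑ (λ u → roots² (G u)) ≡ affine-points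
  ∑-roots²-G = begin
    ∑ (λ u → roots² (G u))
      ≡⟨ ∑-translate (λ e → roots²-cong (G-cong e)) (- a) ⟨
    ∑ (λ x → roots² (G (x - a)))
      ≡⟨ ∑-cong (λ x → roots²-cong (solve 2 (λ x a → let u = x :- a in u :^ 3 :+ u :^ 2 :- a :* u :+ a :^ 2 := x :^ 3 :+ x :^ 2 :- a :^ 3) refl x a)) ⟩
    ∑ (λ x → roots² (x ^ 3 + x ^ 2 - a ^ 3))
      ≡⟨ ∑-cube (λ e → roots²-cong (+-congʳ (+-cong (^-congˡ 3 e) (^-congˡ 2 e)))) ⟨
    ∑ (λ x → roots² ((x ^ 3) ^ 3 + (x ^ 3) ^ 2 - a ^ 3))
      ≡⟨ ∑-cong (λ x → ≡.trans (roots²-cong (solve 2 (λ x a → (x :^ 3) :^ 3 :+ (x :^ 3) :^ 2 :- a :^ 3 := (x :^ 3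
          :+ x :^ 2 :- a) :^ 3) refl x a))
           (roots²-cube (x ^ 3 + x ^ 2 - a))) ⟩
    affine-points ∎
    where open ≡.≡-Reasoning

  inversion : Carrier → Carrier
  inversion t = - a * t ⁻¹

  inversion-cong : ∀ {x y} → x ≈ y → inversion x ≈ inversion y
  inversion-cong eq = *-congˡ (⁻¹-cong eq)

  inversion-0 : ∀ {t} → t ≈ 0# → inversion t ≈ 0#
  inversion-0 eq = trans (*-congˡ (trans (⁻¹-cong eq) 0⁻¹≈0)) (zeroʳ _)

  inversion-* : ∀ {t} → t ≉ 0# → t * inversion t ≈ - a
  inversion-* {t} t≉0 = trans (solve 3 (λ t a i → t :* (a :* i) := a :* (t :* i)) refl t (- a) (t ⁻¹)) (trans
      (*-congˡ (*-inverse t≉0)) (*-identityʳ _))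

  inversion-involutive : ∀ t → inversion (inversion t) ≈ t
  inversion-involutive t with t ≟ 0#
  ... | yes t≈0 = trans (inversion-0 (inversion-0 t≈0)) (sym t≈0)
  ... | no  t≉0 = *-cancelˡ-nonzero (inversion t) w≉0 (trans (inversion-* w≉0) (trans (sym (inversion-* t≉0))
      (*-comm _ _)))
    where
    w≉0 : inversion t ≉ 0#
    w≉0 eq = a≉0 (trans (sym (-‿involutive a)) (trans (-‿cong (trans (sym (inversion-* t≉0)) (trans (*-congˡ eq)
        (zeroʳ t)))) -0#≈0#))

  -- For t ≠ 0, G(-a/t) is t g(t) times the square of a/t². At t = 0 the value G(0) = a² has two
  -- square roots while t g(t) = 0 has one; this is the summand 1.
  ∑-roots²-tg : ∑ (λ t → roots² (t * g t)) ℕ.+ 1 ≡ affine-points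
  ∑-roots²-tg = ≡.sym (begin
    affine-points
      ≡⟨ ∑-roots²-G ⟨
    ∑ (λ u → roots² (G u))
      ≡⟨ ∑-permute (λ e → roots²-cong
          (G-cong e)) inversion inversion inversion-cong inversion-cong inversion-involutive inversion-involutive ⟨
    ∑ (λ t → roots² (G (inversion t)))
      ≡⟨ ∑-cong (λ t → at t (t ≟ 0#)) ⟩
    ∑ (λ t → roots² (t * g t) ℕ.+ ⟦ t ≟ 0# ⟧)
      ≡⟨ ≡.trans (∑-+ _ _) (≡.cong (∑ (λ t → roots² (t * g t)) ℕ.+_) (∑-indicator 0#)) ⟩
    ∑ (λ t → roots² (t * g t)) ℕ.+ 1 ∎)
    where
    open ≡.≡-Reasoning
    at : ∀ t (t? : Dec (t ≈ 0#)) → roots² (G (inversion t)) ≡ roots² (t * g t) ℕ.+ ⟦ t? ⟧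
    at t (yes t≈0) = ≡.trans
      (≡.trans (roots²-cong (trans (G-cong (inversion-0 t≈0)) (solve 1 (λ a → con 𝟘 :^ 3
          :+ con 𝟘 :^ 2 :- a :* con 𝟘 :+ a :^ 2 := a :^ 2) refl a))) (roots²-square a≉0))
      (≡.cong (ℕ._+ 1) (≡.sym (≡.trans (roots²-cong (trans (*-congʳ t≈0) (zeroˡ _))) roots²-0)))
    at t (no t≉0) = ≡.trans (≡.trans (roots²-cong G≈) (roots²-scale r≉0 (t * g t))) (≡.sym (ℕ.+-identityʳ _))
      where
      i = t ⁻¹
      r≉0 : a * i ^ 2 ≉ 0#
      r≉0 eq = [ a≉0 , (λ e → 1≉0 (trans (sym (*-inverse t≉0)) (trans (*-congˡ (x²≈0⇒x≈0 e)) (zeroʳ t)))) ]′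
          (xy≈0⇒x≈0∨y≈0 eq)
      G≈ : G (- a * i) ≈ (a * i ^ 2) ^ 2 * (t * g t)
      G≈ = sym (x-y≈0⇒x≈y _ _ (trans
        (solve 3 (λ t a i → let e = t :* i ; u = :- a :* i in
           (a :* i :^ 2) :^ 2 :* (t :* (t :* (t :- con 𝟙) :^ 2 :- a)) :- (u :^ 3 :+ u :^ 2 :- a :* u :+ a :^ 2) :=
           a :^ 2 :* ((e :^ 3 :+ e :^ 2 :+ e :+ con 𝟙) :+ (e :^ 2 :+ e :+ con 𝟙) :* i :+ (e
               :+ con 𝟙) :* i :^ 2 :- a :* i :^ 3) :* (e :- con 𝟙)) refl t a i)
        (trans (*-congˡ (x≈y⇒x-y≈0 (*-inverse t≉0))) (zeroʳ _))))

  covering-count : covering ℕ.+ 2 ℕ.* q ℕ.+ 1 ≡ q ℕ.+ 2 ℕ.* affine-points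
  covering-count = begin
    covering ℕ.+ 2 ℕ.* q ℕ.+ 1
      ≡⟨ ≡.cong (ℕ._+ 1) (≡.cong₂ ℕ._+_ covering≡ (≡.trans (ℕ.*-comm 2 q) (≡.sym (∑-const 2)))) ⟩
    ∑ (λ t → roots² t ℕ.* roots² (g t)) ℕ.+ ∑ (λ _ → 2) ℕ.+ 1
      ≡⟨ ≡.cong (ℕ._+ 1) (≡.trans (≡.sym (∑-+ _ _)) (∑-cong λ t → roots²-* t (g t))) ⟩
    ∑ (λ t → roots² t ℕ.+ roots² (g t) ℕ.+ roots² (t * g t)) ℕ.+ 1
      ≡⟨ ≡.cong (ℕ._+ 1) (≡.trans (∑-+ _ _) (≡.cong (ℕ._+ ∑ (λ t → roots² (t * g t))) (∑-+ _ _))) ⟩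
    ∑ roots² ℕ.+ ∑ (λ t → roots² (g t)) ℕ.+ ∑ (λ t → roots² (t * g t)) ℕ.+ 1
      ≡⟨ ℕ.+-assoc (∑ roots² ℕ.+ ∑ (λ t → roots² (g t))) _ 1 ⟩
    ∑ roots² ℕ.+ ∑ (λ t → roots² (g t)) ℕ.+ (∑ (λ t → roots² (t * g t)) ℕ.+ 1)
      ≡⟨ ≡.cong₂ ℕ._+_ (≡.cong₂ ℕ._+_ ∑-roots² ∑-roots²-g) ∑-roots²-tg ⟩
    q ℕ.+ affine-points ℕ.+ affine-points
      ≡⟨ ≡.trans (ℕ.+-assoc q _ _) (≡.cong (λ k → q ℕ.+ (affine-points ℕ.+ k)) (≡.sym
          (ℕ.+-identityʳ affine-points))) ⟩
    q ℕ.+ 2 ℕ.* affine-points ∎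
    where
    open ≡.≡-Reasoning

  points-and-traces : ∀ {θ} → Tr θ ≉ 0# → suc affine-points ℕ.+ traces 1# ≡ traces 0# ℕ.+ q
  points-and-traces Trθ≉0 = ℕ.*-cancelˡ-≡ _ _ 2 (arithmetic (traces 0#) (traces 1#) affine-points covering q
    (3*traces0 Trθ≉0) covering-count (≡.trans (≡.cong (traces 0# ℕ.+ traces 1# ℕ.+_) traces-symmetric) traces-total))

  -- The trace value -1 has residue 2, and ω² = -1 - ω subtracts its count from both coordinates.
  ω^-sum : ∀ {n} (t : Fin n → Carrier) → (∀ i → t i ≈ 0# ⊎ t i ≈ 1# ⊎ t i ≈ - 1#) →
           ℤω.sum (λ i → ω ℤω.^ residue (t i)) ≡
           _+_ω (+ sum (λ i → ⟦ t i ≟ 0# ⟧) ℤ.- + sum (λ i → ⟦ t i ≟ - 1# ⟧)) (+ sum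
               (λ i → ⟦ t i ≟ 1# ⟧) ℤ.- + sum (λ i → ⟦ t i ≟ - 1# ⟧))
  ω^-sum {zero}  t v = ≡.refl
  ω^-sum {suc n} t v = ≡.trans (≡.cong (add (ω ℤω.^ residue (t zero))) (ω^-sum (t ∘ suc) (v ∘ suc)))
    (at (t zero) (v zero) (sum (λ i → ⟦ t (suc i) ≟ 0# ⟧)) (sum (λ i → ⟦ t (suc i) ≟ 1# ⟧)) (sum (λ i → ⟦ t
        (suc i) ≟ - 1# ⟧)))
    where
    add = RawSemiring._+_ ℤ[ω]-rawSemiring
    at : ∀ x → x ≈ 0# ⊎ x ≈ 1# ⊎ x ≈ - 1# → ∀ k₀ k₁ k₂ →
         add (ω ℤω.^ residue x) (_+_ω (+ k₀ ℤ.- + k₂) (+ k₁ ℤ.- + k₂)) ≡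
         _+_ω (+ (⟦ x ≟ 0# ⟧ ℕ.+ k₀) ℤ.- + (⟦ x ≟ - 1# ⟧ ℕ.+ k₂)) (+ (⟦ x ≟ 1# ⟧ ℕ.+ k₁) ℤ.- + (⟦ x ≟ - 1# ⟧ ℕ.+ k₂))
    at x v k₀ k₁ k₂ = by (x ≟ 0#) (x ≟ 1#) (x ≟ - 1#)
      where
      by : (0? : Dec (x ≈ 0#)) (1? : Dec (x ≈ 1#)) (2? : Dec (x ≈ - 1#)) →
        add (ω ℤω.^ (if does 0? then 0 else if does 1? then 1 else 2)) (_+_ω (+ k₀ ℤ.- + k₂) (+ k₁ ℤ.- + k₂)) ≡
         _+_ω (+ (⟦ 0? ⟧ ℕ.+ k₀) ℤ.- + (⟦ 2? ⟧ ℕ.+ k₂)) (+ (⟦ 1? ⟧ ℕ.+ k₁) ℤ.- + (⟦ 2? ⟧ ℕ.+ k₂))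
      by (yes e) (yes e′) _ = contradiction (trans (sym e′) e) 1≉0
      by (yes e) _ (yes e′) = contradiction (trans (sym e′) e) -1≉0
      by _ (yes e) (yes e′) = contradiction (trans (sym e) e′) 1≉-1
      by (yes _) (no _) (no _) = ≡.cong₂ _+_ω
        (1+[x-y] (+ k₀) (+ k₂)) (ℤ.+-identityˡ _)
      by (no _) (yes _) (no _) = ≡.cong₂ _+_ω (ℤ.+-identityˡ _)
        (1+[x-y] (+ k₁) (+ k₂))
      by (no _) (no _) (yes _) = ≡.cong₂ _+_ω
        (-1+[x-y] (+ k₀) (+ k₂))
        (-1+[x-y] (+ k₁) (+ k₂))
      by (no ¬0) (no ¬1) (no ¬2) = contradiction v [ ¬0 , [ ¬1 , ¬2 ]′ ]′

  Kloosterman≡ : ∀ {θ} → Tr θ ≉ 0# → Kloosterman a ≡ fromℤ (+ suc affine-points ℤ.- + q)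
  Kloosterman≡ Trθ≉0 = ≡.trans (ω^-sum (λ i → Tr (f (element i))) (λ i → Tr-values (f (element i))))
    (≡.cong₂ _+_ω re im)
    where
    count : ∀ t → sum (λ i → ⟦ Tr (f (element i)) ≟ t ⟧) ≡ traces t
    count t = ≡.sym (∑≡sum λ x → ⟦ Tr (f x) ≟ t ⟧)
    re : + sum (λ i → ⟦ Tr (f (element i)) ≟ 0# ⟧) ℤ.- + sum (λ i → ⟦ Tr (f
        (element i)) ≟ - 1# ⟧) ≡ + suc affine-points ℤ.- + q
    re = ≡.trans (≡.cong₂ (λ j k → + j ℤ.- + k) (count 0#) (≡.trans (count (- 1#)) (≡.sym traces-symmetric)))
      (balance {suc affine-points} {traces 1#} {traces 0#} {q} (points-and-traces Trθ≉0))
    im : + sum (λ i → ⟦ Tr (f (element i)) ≟ 1# ⟧) ℤ.- + sum (λ i → ⟦ Tr (f (element i)) ≟ - 1# ⟧) ≡ 0ℤ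
    im = ≡.trans (≡.cong₂ (λ j k → + j ℤ.- + k) (≡.trans (count 1#) traces-symmetric) (count (- 1#)))
        (ℤ.+-inverseʳ (+ traces (- 1#)))

-- From the power of 3 in the number of points to that in K.

distance : ℕ → ℕ → ℕ
distance m n = ℤ.∣ + m ℤ.- + n ∣

distance-≤ : ∀ {m n} → m ≤ n → distance m n ≡ n ℕ.∸ m
distance-≤ {m} {n} m≤n = ≡.trans (≡.cong ℤ.∣_∣ (ℤ.[+m]-[+n]≡m⊖n m n)) (ℤ.∣⊖∣-≤ m≤n)

distance-sym : ∀ m n → distance m n ≡ distance n m
distance-sym m n = ℤ.∣i-j∣≡∣j-i∣ (+ m) (+ n)

distance-+ : ∀ m n → (m ℕ.+ distance m n ≡ n) ⊎ (n ℕ.+ distance m n ≡ m)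
distance-+ m n with ℕ.≤-total m n
... | inj₁ m≤n = inj₁ (≡.trans (≡.cong (m ℕ.+_) (distance-≤ m≤n)) (ℕ.m+[n∸m]≡n m≤n))
... | inj₂ n≤m = inj₂ (≡.trans (≡.cong (n ℕ.+_) (≡.trans (distance-sym m n) (distance-≤ n≤m))) (ℕ.m+[n∸m]≡n n≤m))

∣-distance : ∀ {d} m n → d ∣ m → d ∣ n → d ∣ distance m n
∣-distance {d} m n d∣m d∣n with distance-+ m n
... | inj₁ eq = ∣m+n∣m⇒∣n (≡.subst (d ∣_) (≡.sym eq) d∣n) d∣m
... | inj₂ eq = ∣m+n∣m⇒∣n (≡.subst (d ∣_) (≡.sym eq) d∣m) d∣n

∣-distance⇒∣ : ∀ {d} m n → d ∣ n → d ∣ distance m n → d ∣ m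
∣-distance⇒∣ {d} m n d∣n d∣δ with distance-+ m n
... | inj₁ eq = ∣m+n∣m⇒∣n (≡.subst (d ∣_) (≡.trans (≡.sym eq) (ℕ.+-comm m _)) d∣n) d∣δ
... | inj₂ eq = ≡.subst (d ∣_) eq (∣m∣n⇒∣m+n d∣n d∣δ)

distance-bound : ∀ m n → m ≤ 2 ℕ.* n → distance m n ≤ n
distance-bound m n m≤2n with distance-+ m n
... | inj₁ eq = ≡.subst (distance m n ≤_) eq (ℕ.m≤n+m _ m)
... | inj₂ eq = ℕ.+-cancelˡ-≤ n _ _ (≡.subst₂ _≤_ (≡.sym eq) (≡.cong (n ℕ.+_) (ℕ.+-identityʳ n)) m≤2n)

small-multiple : ∀ {d n} → n ℕ.< d → d ∣ n → n ≡ 0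
small-multiple {d} {zero}  _   _   = ≡.refl
small-multiple {d} {suc n} n<d d∣n = contradiction (∣⇒≤ d∣n) (ℕ.<⇒≱ n<d)

3^-∣ : ∀ {h m} → h ≤ m → 3 ^ℕ h ∣ 3 ^ℕ m
3^-∣ {h} {m} h≤m = ≡.subst (3 ^ℕ h ∣_) (≡.trans (≡.sym (ℕ.^-distribˡ-+-* 3 h (m ℕ.∸ h))) (≡.cong (3 ^ℕ_)
    (ℕ.m+[n∸m]≡n h≤m))) (m∣m*n (3 ^ℕ (m ℕ.∸ h)))

-- 3ʰ ≤ N ≤ 2q < 3ᵐ⁺¹ gives h ≤ m, so 3ʰ divides both N and q. For h < m also 3ʰ⁺¹ divides q, so it
-- cannot divide N - q without dividing N.
valuation : ∀ m h N s → N ≡ 3 ^ℕ h ℕ.* s → 3 ∤ s → N ≤ 2 ℕ.* 3 ^ℕ m →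
            h ≤ m × 3^ h Divides⟨ m ⟩ (+ N ℤ.- + (3 ^ℕ m)) × ¬ 3^ suc h Divides⟨ m ⟩ (+ N ℤ.- + (3 ^ℕ m))
valuation m h N s N≡ 3∤s N≤2q = h≤m , (∣-distance N q (divides s (≡.trans N≡ (ℕ.*-comm _ s)))
    (3^-∣ h≤m) , λ _ → h≤m) , not-more
  where
  q = 3 ^ℕ m
  2q<3q : 2 ℕ.* q ℕ.< 3 ℕ.* q
  2q<3q = ℕ.*-monoˡ-< q {{ℕ.m^n≢0 3 m}} {2} {3} (s≤s (s≤s (s≤s z≤n)))
  3^h≤N : 3 ^ℕ h ≤ N
  3^h≤N = ≡.subst (3 ^ℕ h ≤_) (≡.sym N≡) (ℕ.m≤m*n (3 ^ℕ h) s {{ℕ.≢-nonZero λ { ≡.refl → 3∤s (3 ∣0) }}})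
  h≤m : h ≤ m
  h≤m with h ℕ.≤? m
  ... | yes h≤m = h≤m
  ... | no  h≰m = contradiction (ℕ.≤-trans (ℕ.^-monoʳ-≤ 3 (ℕ.≰⇒> h≰m)) (ℕ.≤-trans 3^h≤N N≤2q)) (ℕ.<⇒≱ 2q<3q)
  not-more : ¬ 3^ suc h Divides⟨ m ⟩ (+ N ℤ.- + q)
  not-more (3ʰ⁺¹∣ , K≡0⇒) with ℕ.m≤n⇒m<n∨m≡n h≤m
  ... | inj₁ h<m = 3∤s (*-cancelˡ-∣ (3 ^ℕ h) {{ℕ.m^n≢0 3 h}}
        (≡.subst₂ _∣_ (ℕ.*-comm 3 (3 ^ℕ h)) N≡ (∣-distance⇒∣ N q (3^-∣ h<m) 3ʰ⁺¹∣)))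
  -- For h = m, a multiple of 3ᵐ⁺¹ of size at most q is zero, and the convention denies 3ᵐ⁺¹ to K =
  -- 0.
  ... | inj₂ ≡.refl = ℕ.1+n≰n (K≡0⇒ (ℤ.∣i∣≡0⇒i≡0 (small-multiple
        (ℕ.≤-<-trans (distance-bound N q N≤2q) (ℕ.≤-<-trans (ℕ.m≤m+n q _) 2q<3q)) 3ʰ⁺¹∣)))

-- From multiples of a point to the sequence u.

module Orbit {c ℓ : Level} (m : ℕ) (0<m : 0 ℕ.< m) (F : FiniteField c ℓ (3 ^ℕ m))
  (a : FiniteField.Carrier F) (a≉0 : FiniteField._≉_ F a (FiniteField.0# F)) where
  open TernaryField m 0<m F
  open TraceTheory m 0<m F
  open TripleTheory m 0<m F a a≉0 using (triples; X≈step)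
  open CurveTheory m 0<m F a a≉0
  open KloostermanTheory m 0<m F a a≉0 using (affine-points; Kloosterman≡; points-and-traces; traces; traces-total)
  open TriplingTheory loop tripling
  open ≡ using (subst)

  -- Substituting a = x³ + x² - y² gives a y/x³ = y + y/x - (y/x)³ = y - ℘(y/x), and ℘ has trace
  -- zero. At x = 0 the quotient is 0 by convention.
  Tr-image : ∀ {x y z} → E a (x , y) → y ≈ ℘ z → Tr (a * y / x ^ 3) ≈ 0#
  Tr-image {x} {y} {z} e y≈℘z with x ≟ 0#
  ... | yes x≈0 = trans (Tr-cong (trans (*-congˡ (trans (⁻¹-cong (trans (^-congˡ 3 x≈0) (zeroˡ _))) 0⁻¹≈0))
      (zeroʳ _))) Tr0≈0
  ... | no  x≉0 = trans (Tr-cong ay/x³) (trans (Tr-+ _ _) (trans (+-cong (Tr-℘ z) (trans (Tr-neg _) (trans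
      (-‿cong (Tr-℘ (y * i))) -0#≈0#))) (+-identityʳ 0#)))
    where
    i = x ⁻¹
    x³i³ : x ^ 3 * i ^ 3 ≈ 1#
    x³i³ = trans (solve 2 (λ x i → x :^ 3 :* i :^ 3 := (x :* i) :^ 3) refl x i) (trans (^-congˡ 3
        (*-inverse x≉0)) (solve 0 (con 𝟙 :^ 3 := con 𝟙) refl))
    a≈ : a ≈ x ^ 3 + x ^ 2 - y ^ 2
    a≈ = trans (solve 2 (λ a b → a := b :- (b :- a)) refl a (x ^ 3 + x ^ 2)) (+-congˡ (-‿cong (sym e)))
    ay/x³ : a * y / x ^ 3 ≈ ℘ z - ℘ (y * i)
    ay/x³ = begin
      a * y * (x ^ 3) ⁻¹                        ≈⟨ *-cong (*-congʳ a≈) (sym (⁻¹-unique x³i³)) ⟩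
      (x ^ 3 + x ^ 2 - y ^ 2) * y * i ^ 3       ≈⟨ solve 3 (λ x y i → let e = x :* i in
                                                     (x :^ 3 :+ x :^ 2 :- y :^ 2) :* y :* i :^ 3 :=
                                                     y :* e :^ 3 :+ y :* i :* e :^ 2 :- (y :* i) :^ 3) refl x y i ⟩
      y * (x * i) ^ 3 + y * i * (x * i) ^ 2 - (y * i) ^ 3
                                                ≈⟨ +-congʳ (+-cong (*-congˡ (^-congˡ 3 (*-inverse x≉0))) (*-congˡ
                                                    (^-congˡ 2 (*-inverse x≉0)))) ⟩
      y * 1# ^ 3 + y * i * 1# ^ 2 - (y * i) ^ 3 ≈⟨ solve 2 (λ y w → y :* con 𝟙 :^ 3
          :+ w :* con 𝟙 :^ 2 :- w :^ 3 := y :- (w :^ 3 :- w)) refl y (y * i) ⟩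
      y - ℘ (y * i)                             ≈⟨ +-congʳ y≈℘z ⟩
      ℘ z - ℘ (y * i)                           ∎
      where open ≈-Reasoning

  not-tripled : ∀ {x y e} → Tr (a * y / x ^ 3) ≉ 0# → ¬ Image 1 (pt x y e)
  not-tripled {x} {y} {e} Tr≉0 (pt u v e′ , Tr≋) = at (u ^ 3 - a ≟ 0#) Tr≋
    where
    at : (d : Dec (u ^ 3 - a ≈ 0#)) → ¬ T-at u v e′ d ≋ pt x y e
    at (no _) (pt≋ _ Y≈y) = Tr≉0 (Tr-image e (sym Y≈y))

  IsX : Carrier → Point → Set ℓ
  IsX v O          = Polymorphic.⊥
  IsX v (pt x y e) = v ≈ x

  IsX⇒~ : ∀ {v w} P Q → IsX v P → IsX w Q → v ≈ w → P ~ Q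
  IsX⇒~ (pt x y e) (pt x′ y′ e′) v≈x w≈x′ v≈w =
    [ (λ y≈y′ → inj₁ (pt≋ x≈x′ y≈y′)) , (λ y≈-y′ → inj₂ (pt≋ x≈x′ y≈-y′)) ]′
      (x²≈y²⇒x≈±y (trans e (trans (+-congʳ (+-cong (^-congˡ 3 x≈x′) (^-congˡ 2 x≈x′))) (sym e′))))
    where
    x≈x′ : x ≈ x′
    x≈x′ = trans (sym v≈x) (trans v≈w w≈x′)

  ~⇒≈ : ∀ {v w} P Q → IsX v P → IsX w Q → P ~ Q → v ≈ w
  ~⇒≈ (pt x y e) (pt x′ y′ e′) v≈x w≈x′ (inj₁ (pt≋ x≈x′ _)) = trans v≈x (trans x≈x′ (sym w≈x′))
  ~⇒≈ (pt x y e) (pt x′ y′ e′) v≈x w≈x′ (inj₂ (pt≋ x≈x′ _)) = trans v≈x (trans x≈x′ (sym w≈x′))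

  ∛⇒T≋O : ∀ {v} P → IsX v P → v ≈ ∛ a → T P ≋ O
  ∛⇒T≋O (pt x y e) v≈x v≈∛a = T-torsion {x} {y} {e} (trans (^-congˡ 3 (trans (sym v≈x) v≈∛a)) (∛-cubed a))

  T≋O⇒∛ : ∀ {v} P → IsX v P → T P ≋ O → v ≈ ∛ a
  T≋O⇒∛ (pt x y e) v≈x TP≋O = trans v≈x (cube-injective (trans (T≋O⇒torsion {x} {y} {e} TP≋O) (sym (∛-cubed a))))

  step-cong : ∀ {u v} → u ≈ v → step a u ≈ step a v
  step-cong eq = *-cong (+-cong (^-congˡ 3 s≈) (*-congˡ (^-congˡ 3 eq))) (⁻¹-cong (^-congˡ 2 s≈))
    where
    s≈ = +-congʳ {x = - a} (^-congˡ 3 eq)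

  IsX-step : ∀ {v w} P → IsX v P → w ≈ step a v → ¬ T P ≋ O → IsX w (T P)
  IsX-step {v} {w} (pt x y e) v≈x w≈step = at (x ^ 3 - a ≟ 0#)
    where
    at : (d : Dec (x ^ 3 - a ≈ 0#)) → ¬ T-at x y e d ≋ O → IsX w (T-at x y e d)
    at (yes _)  TP≉O = contradiction O≋ TP≉O
    at (no s≉0) _    = trans w≈step (trans (step-cong v≈x) (sym (X≈step (triples (*-inverse s≉0) refl) s≉0 e)))

  module Tracking (u : ℕ → Carrier) (orbit : IsOrbit a u) (P : Point) (u₁ : IsX (u 1) P) where

    -- The recursion may be applied at index i + 1 only if no earlier term is ∛a. The points already
    -- tracked guarantee this, because u (j + 1) = ∛a would make the next multiple of P equal to O.
    tracks-up-to : ∀ i → (∀ j → j ≤ i → ¬ T^ j P ≋ O) → ∀ j → j ≤ i → IsX (u (suc j)) (T^ j P)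
    tracks-up-to zero    _     zero    _     = u₁
    tracks-up-to (suc i) alive j       j≤1+i =
      [ (λ j<1+i → earlier j (ℕ.≤-pred j<1+i)) , (λ j≡1+i → subst (λ j → IsX (u (suc j)) (T^ j P))
          (≡.sym j≡1+i) last) ]′
        (ℕ.m≤n⇒m<n∨m≡n j≤1+i)
      where
      earlier : ∀ j → j ≤ i → IsX (u (suc j)) (T^ j P)
      earlier = tracks-up-to i (λ j j≤i → alive j (ℕ.m≤n⇒m≤1+n j≤i))
      running : ∀ j → 1 ≤ j → j ≤ suc i → u j ≉ ∛ a
      running (suc j) _ (s≤s j≤i) uⱼ≈∛a = alive (suc j) (s≤s j≤i) (∛⇒T≋O (T^ j P) (earlier j j≤i) uⱼ≈∛a)
      last : IsX (u (suc (suc i))) (T^ (suc i) P)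
      last = IsX-step (T^ i P) (earlier i ℕ.≤-refl) (orbit (suc i) (s≤s z≤n) running) (alive (suc i) ℕ.≤-refl)

    terminates : ∀ {h} → Terminates P h → TerminatesAt a u h
    terminates (g , ≡.refl , TᵍP≉O , TʰP≋O) = s≤s z≤n , T≋O⇒∛ (T^ g P) (tracks g ℕ.≤-refl) TʰP≋O , running
      where
      alive : ∀ j → j ≤ g → ¬ T^ j P ≋ O
      alive j j≤g eq = TᵍP≉O (T^-O-mono j≤g eq)
      tracks : ∀ j → j ≤ g → IsX (u (suc j)) (T^ j P)
      tracks = tracks-up-to g alive
      running : ∀ i → 1 ≤ i → i ℕ.< suc g → u i ≉ ∛ a
      running (suc i) _ (s≤s i<g) uᵢ≈∛a = alive (suc i) i<g (∛⇒T≋O (T^ i P) (tracks i (ℕ.<⇒≤ i<g)) uᵢ≈∛a)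

    cycles : ∀ {h} → Cycles P h → CyclesFrom a u h
    cycles {h} (alive , r , 1≤r , returns , distinct) = r , 1≤r ,
      subst₂ (λ j k → u j ≈ u k) (ℕ.+-comm 1 h) (≡.sym h+1+r) (~⇒≈ (T^ h P) (T^ (h ℕ.+ r) P) (tracks h) (tracks
          (h ℕ.+ r)) returns) ,
      (λ { (suc i) (suc j) _ (s≤s i<j) j<h+1+r uᵢ≈uⱼ → distinct i j i<j (ℕ.≤-pred (subst (suc
          (suc j) ≤_) h+1+r j<h+1+r)) (IsX⇒~ (T^ i P) (T^ j P) (tracks i) (tracks j) uᵢ≈uⱼ) }) ,
      (λ { (suc i) _ _ uᵢ≈∛a → alive (suc i) (∛⇒T≋O (T^ i P) (tracks i) uᵢ≈∛a) })
      where
      open ≡ using (subst₂)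
      tracks : ∀ j → IsX (u (suc j)) (T^ j P)
      tracks j = tracks-up-to j (λ i _ → alive i) j ℕ.≤-refl
      h+1+r : h ℕ.+ 1 ℕ.+ r ≡ suc (h ℕ.+ r)
      h+1+r = ≡.cong (ℕ._+ r) (ℕ.+-comm h 1)

  -- N - q is the number of trace values 0 minus the number of trace values 1, hence at most q.
  N≤2q : ∀ {θ} → Tr θ ≉ 0# → N ≤ 2 ℕ.* q
  N≤2q Trθ≉0 = begin
    N                              ≡⟨ N≡ ⟩
    suc affine-points              ≤⟨ ℕ.m≤m+n _ (traces 1#) ⟩
    suc affine-points ℕ.+ traces 1# ≡⟨ points-and-traces Trθ≉0 ⟩
    traces 0# ℕ.+ q                ≤⟨ ℕ.+-monoˡ-≤ q (≡.subst (traces 0# ≤_) traces-total (ℕ.≤-trans (ℕ.m≤m+n _ _)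
        (ℕ.m≤m+n _ _))) ⟩
    q ℕ.+ q                        ≡⟨ ≡.cong (q ℕ.+_) (ℕ.+-identityʳ q) ⟨
    2 ℕ.* q                        ∎
    where open ℕ.≤-Reasoning

theorem1 : ∀ {c ℓ} (m : ℕ) → 2 ≤ m →
    (F : FiniteField c ℓ (3 ^ℕ m)) →
    let open FiniteField F
        open Ternary m F in
    (a : Carrier) → a ≉ 0# →
    (u : ℕ → Carrier) → IsOrbit a u →
    (y : Carrier) → E a (u 1 , y) →
    Tr (a * y / u 1 ^ 3) ≉ 0# →
    ∃ λ (k : ℕ) → k ≤ m ×
      (TerminatesAt a u k ⊎ CyclesFrom a u k) ×
      ∃ λ (K : ℤ) → Kloosterman a ≡ fromℤ K ×
        3^ k Divides⟨ m ⟩ K ×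
        ¬ 3^ suc k Divides⟨ m ⟩ K
theorem1 m 2≤m F a a≉0 u orbit y e Tr≉0 =
  let h , (s , N≡3ʰs , 3∤s) , behaviour = depth-of-orbit (pt (u 1) y e) (not-tripled Tr≉0)
      h≤m , 3ʰ∣K , 3ʰ⁺¹∤K = valuation m h N s N≡3ʰs 3∤s (N≤2q Tr≉0)
  -- The integer k is the depth of τ, which is the exponent of 3 in the number of points.
  in h , h≤m , [ inj₁ ∘ terminates , inj₂ ∘ cycles ]′ behaviour ,
     + N ℤ.- + (3 ^ℕ m) , ≡.trans (Kloosterman≡ Tr≉0) (≡.cong (λ n → fromℤ (+ n ℤ.- + (3 ^ℕ m)))
         (≡.sym N≡)) , 3ʰ∣K , 3ʰ⁺¹∤K
  where
  0<m : 0 ℕ.< m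
  0<m = ℕ.≤-trans (s≤s z≤n) 2≤m
  open FiniteField F using (refl)
  open CurveTheory m 0<m F a a≉0
  open TriplingTheory loop tripling using (depth-of-orbit)
  open Orbit m 0<m F a a≉0
  open KloostermanTheory m 0<m F a a≉0 using (Kloosterman≡)
  open Tracking u orbit (pt (u 1) y e) refl
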